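{- There exist a matroid $M$ and a matroid subdivision $\mathcal{D}$ of the matroid polytope $P_M$ such that $\mathcal{D}$ is finest (no matroid subdivision of $P_M$ other than $\mathcal{D}$ refines $\mathcal{D}$) and such that some maximal cell of $\mathcal{D}$ is the matroid polytope of a matroid which is not rigid.
   Context: For a matroid $M$ of rank $d$ on $[n]$ with set of bases $\mathcal{B}$, the matroid polytope is $P_M=\mathrm{conv}\{\sum_{i\in\sigma}e_i : \sigma\in\mathcal{B}\}\subset\mathbb{R}^n$. A polyhedral subdivision of $P_M$ (all of whose vertices are vertices of $P_M$) is called a matroid subdivision (or matroidal subdivision) if all of its edges are parallel to vectors $e_i-e_j$; equivalently, every cell of the subdivision is the matroid polytope of some matroid. A matroid $M$ is called rigid if $P_M$ has no matroid subdivision other than the trivial one (whose only maximal cell is $P_M$ itself). -}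

module Defs where

open import Algebra.Bundles using (CommutativeRing)
open import Data.Bool.Base using (if_then_else_)
open import Data.Fin.Base using (Fin)
open import Data.Fin.Subset as Subset using (Subset; ⁅_⁆; _∪_; ∣_∣)
open import Data.List.Base using (List; []; _∷_; length; lookup; map)
open import Data.List.Membership.Propositional using (_∈_)
open import Data.List.Relation.Unary.All using (All)
open import Data.List.Relation.Unary.Any using (Any)
open import Data.Nat.Base using (ℕ)
open import Data.Product.Base using (Σ; ∃-syntax; _×_)
import Data.Vec.Base as Vec
open import Data.Vec.Functional using (Vector)
open import Level using (_⊔_) renaming (suc to lsuc)
open import Relation.Binary.Core using (Rel)
open import Relation.Binary.PropositionalEquality.Core using (_≡_; _≢_)
open import Relation.Binary.Structures using (IsDecTotalOrder)
open import Relation.Nullary.Negation.Core using (¬_)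
open import Relation.Unary using (Pred; _⊆_; _≐_; _∩_)

import Algebra.Properties.CommutativeMonoid.Sum as CMSum

-- A matroid on the ground set Fin n, given by its bases; the order and the
-- multiplicities in the list are irrelevant.
record Matroid (n : ℕ) : Set where
  field
    rank     : ℕ
    bases    : List (Subset n)
    nonempty : ∃[ σ ] σ ∈ bases
    size     : ∀ {σ} → σ ∈ bases → ∣ σ ∣ ≡ rank
    exchange : ∀ {σ τ} → σ ∈ bases → τ ∈ bases →
               ∀ {i} → i Subset.∈ σ → i Subset.∉ τ →
               ∃[ j ] j Subset.∈ τ × j Subset.∉ σ ×
                      ((σ Subset.- i) ∪ ⁅ j ⁆) ∈ bases

-- Ordered fields, of which ℝ is the classical example.
record OrderedField c ℓ₁ ℓ₂ : Set (lsuc (c ⊔ ℓ₁ ⊔ ℓ₂)) where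
  field
    commutativeRing : CommutativeRing c ℓ₁
  open CommutativeRing commutativeRing public
  field
    _≤_             : Rel Carrier ℓ₂
    isDecTotalOrder : IsDecTotalOrder _≈_ _≤_
    +-monoʳ-≤       : ∀ z {x y} → x ≤ y → (z + x) ≤ (z + y)
    *-nonNeg        : ∀ {x y} → 0# ≤ x → 0# ≤ y → 0# ≤ (x * y)
    0≉1             : ¬ 0# ≈ 1#
    inverse         : ∀ {x} → ¬ x ≈ 0# → ∃[ y ] (x * y) ≈ 1#

module MatroidPolytopes {c ℓ₁ ℓ₂} (K : OrderedField c ℓ₁ ℓ₂) where
  open OrderedField K
    using (Carrier; _≈_; _≤_; _*_; _-_; 0#; 1#; +-commutativeMonoid)
  open CMSum +-commutativeMonoid using (sum)

  private variable
    n : ℕ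

  Point : ℕ → Set c
  Point n = Vector Carrier n

  PointSet : ℕ → Set (lsuc (c ⊔ ℓ₁ ⊔ ℓ₂))
  PointSet n = Pred (Point n) (c ⊔ ℓ₁ ⊔ ℓ₂)

  infix 4 _≋_
  _≋_ : Point n → Point n → Set ℓ₁
  u ≋ v = ∀ i → u i ≈ v i

  dot : Point n → Point n → Carrier
  dot a x = sum (λ i → a i * x i)

  -- A polytope is presented by a finite list of points spanning it.  Two
  -- presentations are the same polytope when their point sets are _≐_.
  Polytope : ℕ → Set c
  Polytope n = List (Point n)

  ⟦_⟧ : Polytope n → PointSet n
  ⟦_⟧ {n} V x = Σ (Vector Carrier (length V)) λ w →
    (∀ k → 0# ≤ w k) × sum w ≈ 1# ×
    (∀ i → x i ≈ sum (λ k → w k * lookup V k i))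

  -- Q is cut out of P by a valid inequality a · x ≤ b.  Taking a = 0 gives
  -- the improper faces ∅ and P.
  IsFaceOf : ∀ {q} → Pred (Point n) q → PointSet n → Set _
  IsFaceOf Q P = ∃[ a ] ∃[ b ]
    (∀ {x} → P x → dot a x ≤ b) × Q ≐ (λ x → P x × dot a x ≈ b)

  IsVertexOf : Point n → PointSet n → Set _
  IsVertexOf v P = IsFaceOf (v ≋_) P

  -- Polyhedral subdivisions of P without new vertices: a polyhedral complex,
  -- with cells of all dimensions (the empty cell allowed), whose union is P.
  --
  -- A cell is presented by a list of vertices of P.  As a vertex of P lying
  -- in a polytope C contained in P is a vertex of C, this is exactly the list
  -- of the vertices of the cell, up to order and repetition.
  record Subdivision (P : Polytope n) : Set (lsuc (c ⊔ ℓ₁ ⊔ ℓ₂)) where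
    field
      Cell         : Pred (Polytope n) (c ⊔ ℓ₁ ⊔ ℓ₂)
      vertices     : ∀ {C} → Cell C → All (λ v → IsVertexOf v ⟦ P ⟧) C
      finite       : Σ (List (Polytope n)) λ L →
                     ∀ {C} → Cell C → Any (λ C′ → ⟦ C ⟧ ≐ ⟦ C′ ⟧) L
      faces        : ∀ {C} → Cell C → {Q : PointSet n} → IsFaceOf Q ⟦ C ⟧ →
                     ∃[ F ] Cell F × ⟦ F ⟧ ≐ Q
      intersection : ∀ {C C′} → Cell C → Cell C′ →
                     IsFaceOf (⟦ C ⟧ ∩ ⟦ C′ ⟧) ⟦ C ⟧ ×
                     IsFaceOf (⟦ C ⟧ ∩ ⟦ C′ ⟧) ⟦ C′ ⟧
      union        : ⟦ P ⟧ ≐ (λ x → ∃[ C ] Cell C × ⟦ C ⟧ x)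

    IsMaximal : Pred (Polytope n) _
    IsMaximal C = Cell C × (∀ {C′} → Cell C′ → ⟦ C ⟧ ⊆ ⟦ C′ ⟧ → ⟦ C′ ⟧ ⊆ ⟦ C ⟧)

    IsTrivial : Set _
    IsTrivial = (∃[ C ] IsMaximal C × ⟦ C ⟧ ≐ ⟦ P ⟧) ×
                (∀ {C} → IsMaximal C → ⟦ C ⟧ ≐ ⟦ P ⟧)

  open Subdivision public using (Cell; IsMaximal; IsTrivial)

  Refines : {P : Polytope n} → Subdivision P → Subdivision P → Set _
  Refines D′ D = ∀ {C′} → Cell D′ C′ → ∃[ C ] Cell D C × ⟦ C′ ⟧ ⊆ ⟦ C ⟧

  Same : {P : Polytope n} → Subdivision P → Subdivision P → Set _
  Same D D′ = (∀ {C} → Cell D C → ∃[ C′ ] Cell D′ C′ × ⟦ C ⟧ ≐ ⟦ C′ ⟧) ×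
              (∀ {C′} → Cell D′ C′ → ∃[ C ] Cell D C × ⟦ C′ ⟧ ≐ ⟦ C ⟧)

  -- indicator σ is the sum of the standard basis vectors e i for i in σ.
  indicator : Subset n → Point n
  indicator σ i = if Vec.lookup σ i then 1# else 0#

  e : Fin n → Point n
  e i = indicator ⁅ i ⁆

  matroidPolytope : Matroid n → Polytope n
  matroidPolytope M = map indicator (Matroid.bases M)

  -- The edges are the cells that are segments with distinct endpoints u, v.
  IsMatroidal : {P : Polytope n} → Subdivision P → Set _
  IsMatroidal D = ∀ {C} → Cell D C →
    ∀ {u v} → ¬ u ≋ v → ⟦ C ⟧ ≐ ⟦ u ∷ v ∷ [] ⟧ →
    ∃[ i ] ∃[ j ] i ≢ j × ∃[ t ] (∀ k → u k - v k ≈ t * (e i k - e j k))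

  IsRigid : Matroid n → Set _
  IsRigid M = ¬ Σ (Subdivision (matroidPolytope M)) λ D →
    IsMatroidal D × ¬ IsTrivial D

  IsFinest : (M : Matroid n) → Subdivision (matroidPolytope M) → Set _
  IsFinest M D = ¬ Σ (Subdivision (matroidPolytope M)) λ D′ →
    IsMatroidal D′ × Refines D′ D × ¬ Same D′ D

{-# OPTIONS --safe #-}
module Submission where

open import Defs
open import Data.Nat.Base using (ℕ)
open import Data.Product.Base using (Σ; ∃-syntax; _×_)
open import Relation.Nullary.Negation.Core using (¬_)
open import Relation.Unary using (_≐_)

import Algebra.Properties.CommutativeSemigroup
import Algebra.Properties.Ring
import Algebra.Properties.Semiring.Sum
import Algebra.Solver.Ring.NaturalCoefficients.Default as SemiringSolver
open import Data.Bool.Base using (Bool; true; false; if_then_else_; T; not; _∧_; _∨_; _xor_)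
open import Data.Bool.ListAction using (any; all)
import Data.Bool.Properties as Bool
open import Data.Empty using (⊥; ⊥-elim)
open import Data.Fin.Base using (Fin; zero; suc)
open import Data.Fin.Patterns
import Data.Fin.Properties as Fin
open import Data.Fin.Subset as Subset using (Subset; ⁅_⁆; _∪_; ∣_∣) renaming (_∩_ to _⋂_)
open import Data.List.Base as List using (List; []; _∷_)
open import Data.List.Membership.Propositional using (_∈_; find; lose)
open import Data.List.Membership.Propositional.Properties
  using (∈-filter⁺; ∈-filter⁻; ∈-map⁺; ∈-map⁻; ∈-++⁺ˡ; ∈-++⁺ʳ)
open import Data.List.Relation.Unary.All as All using (All; []; _∷_)
import Data.List.Relation.Unary.All.Properties as All
open import Data.List.Relation.Unary.Any as Any using (Any; here; there)
import Data.List.Relation.Unary.Any.Properties as Any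
open import Data.Nat.Base as ℕ using (zero; suc)
import Data.Nat.Properties as ℕ
open import Data.Product.Base using (∃; _,_; proj₁; proj₂; swap)
open import Data.Sum.Base using (_⊎_; inj₁; inj₂; [_,_]′)
open import Data.Unit.Base using (⊤; tt)
open import Data.Vec.Base as Vec using ([]; _∷_)
open import Data.Vec.Functional using (Vector)
import Data.Vec.Properties as Vec
open import Function.Base using (_∘_; const; id)
open import Function.Bundles using (Equivalence)
open import Level using (Level; Lift; lift; _⊔_)
import Relation.Binary.PropositionalEquality.Core as ≡
open ≡ using (_≡_; _≢_)
open import Relation.Binary.Structures using (IsDecTotalOrder)
open import Relation.Nullary.Decidable.Core using (Dec; yes; no; isNo; map′; toWitnessFalse; T?; _×-dec_)
open import Relation.Nullary.Negation.Core using (contradiction)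
open import Relation.Unary using (Pred; _⊆_; _∩_)

private variable
  n : ℕ

-- Let N be the matroid of rank four formed by four points Q spanning 3-space and the
-- points S in which a generic line meets the four planes spanned by triples of Q.
-- By von Staudt's theorem the cross ratio of S equals that of the planes joining
-- the line to Q, and correspondingly a matroid subdivision of P_N splits all the
-- octahedra of P_N alike; one such subdivision has four maximal cells, so N is not
-- rigid.  Glue P_N along the hyperplane x(S) = 2 to the polytope of a second copy with
-- the roles of S and Q exchanged and matched by a permutation that permutes the
-- three ways of splitting an octahedron cyclically.  The union is the polytope of a
-- matroid M.  A refinement of this subdivision splitting one octahedron would split a
-- common octahedron of both cells in two different ways, so it splits none, and a
-- cell containing a suitable point near the vertex Q (or S) is all of P_N (or its copy).

-- Ordered fields and weighted sums

-- The cells of a given subdivision form an arbitrary predicate, so one cannot decide how it splits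
-- an octahedron; what can be decided is whether a given cell lists a given basis. Splits are
-- therefore recorded by the positive statement `Together`: both ends of a diagonal lie in one cell.
-- Cutting an octahedron into two pyramids denies this for exactly one of its three diagonals.
-- Information about unknown cells comes from one device: take a cell through a chosen rational
-- point; a linear functional reaches its value at that point on some vertex of the cell. With
-- denominators cleared this becomes a finite check over the bases in natural numbers, the same for
-- every ordered field. The edge condition enters through squares: a cell containing two bases at
-- distance two must contain another opposite pair with the same midpoint, since otherwise the two
-- would span a forbidden edge. The von Staudt correspondence takes the form of chains of steps,
-- each replacing an element by one that is parallel or coparallel to it in a minor.

module OrderedFieldProperties {c ℓ₁ ℓ₂} (K : OrderedField c ℓ₁ ℓ₂) where
  open OrderedField K public hiding (zero) renaming (_≤_ to infix 4 _≤_)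
  open IsDecTotalOrder isDecTotalOrder public
    using (_≟_; _≤?_; total; antisym; ≤-respˡ-≈; ≤-respʳ-≈)
    renaming (refl to ≤-refl; trans to ≤-trans; reflexive to ≤-reflexive)
  open Algebra.Properties.Ring ring public
    using (-‿distribˡ-*; -‿distribʳ-*; -‿involutive)
  open Algebra.Properties.Semiring.Sum semiring public
    using (sum; sum-cong-≋; ∑-distrib-+; *-distribˡ-sum)
  open Algebra.Properties.CommutativeSemigroup +-commutativeSemigroup public
    using (x∙yz≈y∙xz) renaming (interchange to +-interchange)
  open Algebra.Properties.CommutativeSemigroup *-commutativeSemigroup public
    using () renaming (x∙yz≈y∙xz to *-swap)

  +-monoˡ-≤ : ∀ z {x y} → x ≤ y → x + z ≤ y + z
  +-monoˡ-≤ z {x} {y} x≤y = ≤-respˡ-≈ (+-comm z x) (≤-respʳ-≈ (+-comm z y) (+-monoʳ-≤ z x≤y))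

  +-mono-≤ : ∀ {x y u v} → x ≤ y → u ≤ v → x + u ≤ y + v
  +-mono-≤ x≤y u≤v = ≤-trans (+-monoˡ-≤ _ x≤y) (+-monoʳ-≤ _ u≤v)

  -z+[z+x]≈x : ∀ z x → - z + (z + x) ≈ x
  -z+[z+x]≈x z x = trans (sym (+-assoc (- z) z x)) (trans (+-congʳ (-‿inverseˡ z)) (+-identityˡ x))

  +-cancelˡ-≤ : ∀ z {x y} → z + x ≤ z + y → x ≤ y
  +-cancelˡ-≤ z {x} {y} p = ≤-respˡ-≈ (-z+[z+x]≈x z x) (≤-respʳ-≈ (-z+[z+x]≈x z y) (+-monoʳ-≤ (- z) p))

  +-cancelʳ-≤ : ∀ z {x y} → x + z ≤ y + z → x ≤ y
  +-cancelʳ-≤ z {x} {y} p = +-cancelˡ-≤ z (≤-respˡ-≈ (+-comm x z) (≤-respʳ-≈ (+-comm y z) p))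

  [x-y]+y≈x : ∀ x y → (x - y) + y ≈ x
  [x-y]+y≈x x y = trans (+-assoc x (- y) y) (trans (+-congˡ (-‿inverseˡ y)) (+-identityʳ x))

  x≤y⇒0≤y-x : ∀ {x y} → x ≤ y → 0# ≤ y - x
  x≤y⇒0≤y-x {x} {y} p = ≤-respˡ-≈ (-‿inverseʳ x) (+-monoˡ-≤ (- x) p)

  0≤y-x⇒x≤y : ∀ {x y} → 0# ≤ y - x → x ≤ y
  0≤y-x⇒x≤y {x} {y} p = ≤-respˡ-≈ (+-identityˡ x) (≤-respʳ-≈ ([x-y]+y≈x y x) (+-monoˡ-≤ x p))

  *-monoˡ-≤ : ∀ {w x y} → 0# ≤ w → x ≤ y → w * x ≤ w * y
  *-monoˡ-≤ {w} {x} {y} 0≤w x≤y = 0≤y-x⇒x≤y (≤-respʳ-≈ eq (*-nonNeg 0≤w (x≤y⇒0≤y-x x≤y)))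
    where
    eq : w * (y - x) ≈ w * y - w * x
    eq = trans (distribˡ w y (- x)) (+-congˡ (sym (-‿distribʳ-* w x)))

  infix 4 _<_
  _<_ : Carrier → Carrier → Set ℓ₂
  x < y = ¬ y ≤ x

  <⇒≤ : ∀ {x y} → x < y → x ≤ y
  <⇒≤ {x} {y} x<y = [ (λ p → p) , (λ p → contradiction p x<y) ]′ (total x y)

  ≤∧≉⇒< : ∀ {x y} → x ≤ y → ¬ x ≈ y → x < y
  ≤∧≉⇒< x≤y x≉y y≤x = x≉y (antisym x≤y y≤x)

  0<⇒≉0 : ∀ {x} → 0# < x → ¬ x ≈ 0#
  0<⇒≉0 0<x x≈0 = 0<x (≤-reflexive x≈0)

  -- 1 ≤ 0 would give 0 ≤ -1, whence 0 ≤ (-1)(-1) = 1.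
  0<1 : 0# < 1#
  0<1 1≤0 = 0≉1 (antisym 0≤1 1≤0)
    where
    0≤-1 : 0# ≤ - 1#
    0≤-1 = ≤-respʳ-≈ (+-identityˡ (- 1#)) (x≤y⇒0≤y-x 1≤0)
    0≤1 : 0# ≤ 1#
    0≤1 = ≤-respʳ-≈ (trans (sym (-‿distribˡ-* 1# (- 1#)))
                      (trans (-‿cong (*-identityˡ (- 1#))) (-‿involutive 1#)))
                    (*-nonNeg 0≤-1 0≤-1)

  0≤1 : 0# ≤ 1#
  0≤1 = <⇒≤ 0<1

  x+y-x≈y : ∀ x y → (x + y) - x ≈ y
  x+y-x≈y x y = trans (+-congʳ (+-comm x y)) (trans (+-assoc y x (- x)) (trans (+-congˡ (-‿inverseʳ x)) (+-identityʳ y)))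

  *-cancelˡ-≈ : ∀ {w x y} → ¬ w ≈ 0# → w * x ≈ w * y → x ≈ y
  *-cancelˡ-≈ {w} {x} {y} w≉0 eq with inverse w≉0
  ... | v , wv≈1 = trans (sym (undo x)) (trans (*-congˡ eq) (undo y))
    where
    undo : ∀ z → v * (w * z) ≈ z
    undo z = trans (sym (*-assoc v w z)) (trans (*-congʳ (trans (*-comm v w) wv≈1)) (*-identityˡ z))

  *-cancelˡ-≤ : ∀ {w x y} → 0# < w → w * x ≤ w * y → x ≤ y
  *-cancelˡ-≤ {w} {x} {y} 0<w p with total x y
  ... | inj₁ x≤y = x≤y
  ... | inj₂ y≤x = ≤-reflexive (*-cancelˡ-≈ (0<⇒≉0 0<w) (antisym p (*-monoˡ-≤ (<⇒≤ 0<w) y≤x)))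

  0<* : ∀ {x y} → 0# < x → 0# < y → 0# < x * y
  0<* {x} 0<x 0<y p = 0<y (*-cancelˡ-≤ 0<x (≤-respʳ-≈ (sym (zeroʳ x)) p))

  inverse-pos : ∀ {x} → 0# < x → ∃[ y ] 0# < y × x * y ≈ 1#
  inverse-pos {x} 0<x with inverse (0<⇒≉0 0<x)
  ... | y , xy≈1 = y , (λ y≤0 → 0<1 (≤-respˡ-≈ xy≈1 (≤-respʳ-≈ (zeroʳ x) (*-monoˡ-≤ (<⇒≤ 0<x) y≤0)))) , xy≈1

  0<+ : ∀ {x y} → 0# < x → 0# ≤ y → 0# < x + y
  0<+ {x} {y} 0<x 0≤y p = 0<x (≤-trans (≤-respˡ-≈ (+-identityʳ x) (+-monoʳ-≤ x 0≤y)) p)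

  x≤x+y : ∀ {x y} → 0# ≤ y → x ≤ x + y
  x≤x+y {x} 0≤y = ≤-respˡ-≈ (+-identityʳ x) (+-monoʳ-≤ x 0≤y)

  ι : ℕ → Carrier
  ι zero    = 0#
  ι (suc n) = 1# + ι n

  ι-+ : ∀ m n → ι (m ℕ.+ n) ≈ ι m + ι n
  ι-+ zero    n = sym (+-identityˡ (ι n))
  ι-+ (suc m) n = trans (+-congˡ (ι-+ m n)) (sym (+-assoc 1# (ι m) (ι n)))

  ι-* : ∀ m n → ι (m ℕ.* n) ≈ ι m * ι n
  ι-* zero    n = sym (zeroˡ (ι n))
  ι-* (suc m) n = trans (ι-+ n (m ℕ.* n)) (trans (+-cong (sym (*-identityˡ (ι n))) (ι-* m n)) (sym (distribʳ (ι n) 1# (ι m))))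

  0≤ι : ∀ n → 0# ≤ ι n
  0≤ι zero    = ≤-refl
  0≤ι (suc n) = ≤-trans 0≤1 (x≤x+y (0≤ι n))

  0<ι : ∀ n → 0# < ι (suc n)
  0<ι n = 0<+ 0<1 (0≤ι n)

  ι-mono-≤ : ∀ {m n} → m ℕ.≤ n → ι m ≤ ι n
  ι-mono-≤ {n = n} ℕ.z≤n = 0≤ι n
  ι-mono-≤ (ℕ.s≤s p) = +-monoʳ-≤ 1# (ι-mono-≤ p)

  ι-cancel-≤ : ∀ {m n} → ι m ≤ ι n → m ℕ.≤ n
  ι-cancel-≤ {zero}  {n}     p = ℕ.z≤n
  ι-cancel-≤ {suc m} {zero}  p = contradiction p (0<ι m)
  ι-cancel-≤ {suc m} {suc n} p = ℕ.s≤s (ι-cancel-≤ (+-cancelˡ-≤ 1# p))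

  ι-injective : ∀ {m n} → ι m ≈ ι n → m ≡ n
  ι-injective p = ℕ.≤-antisym (ι-cancel-≤ (≤-reflexive p)) (ι-cancel-≤ (≤-reflexive (sym p)))

  sum-mono-≤ : ∀ {n} {f g : Vector Carrier n} → (∀ i → f i ≤ g i) → sum f ≤ sum g
  sum-mono-≤ {zero}  p = ≤-refl
  sum-mono-≤ {suc n} p = +-mono-≤ (p zero) (sum-mono-≤ (p ∘ suc))

  +-tightˡ : ∀ {x y u v} → u ≤ v → y + v ≤ x + u → y ≤ x
  +-tightˡ {x} {y} {u} {v} u≤v p = +-cancelʳ-≤ v (≤-trans p (+-monoʳ-≤ x u≤v))

  +-tightʳ : ∀ {x y u v} → x ≤ y → y + v ≤ x + u → v ≤ u
  +-tightʳ {x} {y} {u} {v} x≤y p = +-cancelˡ-≤ y (≤-trans p (+-monoˡ-≤ u x≤y))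

  sum-tight : ∀ {n} {f g : Vector Carrier n} → (∀ i → f i ≤ g i) → sum g ≤ sum f → ∀ i → g i ≤ f i
  sum-tight {suc n} p q zero    = +-tightˡ (sum-mono-≤ (p ∘ suc)) q
  sum-tight {suc n} p q (suc i) = sum-tight (p ∘ suc) (+-tightʳ (p zero) q) i

  -- Finite weighted sums, kept as lists of (weight, point).
  module _ {a} {A : Set a} where

    eval : List (Carrier × A) → (A → Carrier) → Carrier
    eval []            f = 0#
    eval ((w , x) ∷ L) f = w * f x + eval L f

    Positive : List (Carrier × A) → Set _
    Positive = All (λ p → 0# < proj₁ p)

    eval-cong : ∀ L {f g} → All (λ p → f (proj₂ p) ≈ g (proj₂ p)) L → eval L f ≈ eval L g
    eval-cong []      []       = refl
    eval-cong (_ ∷ L) (p ∷ ps) = +-cong (*-congˡ p) (eval-cong L ps)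

    eval-ext : ∀ L {f g} → (∀ x → f x ≈ g x) → eval L f ≈ eval L g
    eval-ext L p = eval-cong L (All.universal (λ q → p (proj₂ q)) L)

    eval-zero : ∀ L → eval L (const 0#) ≈ 0#
    eval-zero []            = refl
    eval-zero ((w , _) ∷ L) = trans (+-cong (zeroʳ w) (eval-zero L)) (+-identityˡ 0#)

    eval-+ : ∀ L f g → eval L (λ x → f x + g x) ≈ eval L f + eval L g
    eval-+ []            f g = sym (+-identityˡ 0#)
    eval-+ ((w , x) ∷ L) f g = trans (+-cong (distribˡ w (f x) (g x)) (eval-+ L f g)) (+-interchange _ _ _ _)

    eval-*ˡ : ∀ L k f → eval L (λ x → k * f x) ≈ k * eval L f
    eval-*ˡ []            k f = sym (zeroʳ k)
    eval-*ˡ ((w , x) ∷ L) k f = trans (+-cong (*-swap w k (f x)) (eval-*ˡ L k f)) (sym (distribˡ k _ _))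

    eval-const : ∀ L k → eval L (const k) ≈ k * eval L (const 1#)
    eval-const L k = trans (eval-ext L (λ _ → sym (*-identityʳ k))) (eval-*ˡ L k (const 1#))

    eval-sum : ∀ {n} L (f : Fin n → A → Carrier) → eval L (λ x → sum (λ i → f i x)) ≈ sum (λ i → eval L (f i))
    eval-sum {zero}  L f = eval-zero L
    eval-sum {suc n} L f = trans (eval-+ L (f zero) _) (+-congˡ (eval-sum L (f ∘ suc)))

    eval-++ : ∀ L L′ f → eval (L List.++ L′) f ≈ eval L f + eval L′ f
    eval-++ []      L′ f = sym (+-identityˡ _)
    eval-++ (_ ∷ L) L′ f = trans (+-congˡ (eval-++ L L′ f)) (sym (+-assoc _ _ _))

    eval-mono : ∀ {L f g} → Positive L → All (λ p → f (proj₂ p) ≤ g (proj₂ p)) L → eval L f ≤ eval L g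
    eval-mono []        []       = ≤-refl
    eval-mono (0<w ∷ P) (p ∷ ps) = +-mono-≤ (*-monoˡ-≤ (<⇒≤ 0<w) p) (eval-mono P ps)

    eval-tight : ∀ {L f g} → Positive L → All (λ p → f (proj₂ p) ≤ g (proj₂ p)) L →
                 eval L g ≤ eval L f → All (λ p → g (proj₂ p) ≤ f (proj₂ p)) L
    eval-tight []        []       q = []
    eval-tight (0<w ∷ P) (p ∷ ps) q =
      *-cancelˡ-≤ 0<w (+-tightˡ (eval-mono P ps) q) ∷
      eval-tight P ps (+-tightʳ (*-monoˡ-≤ (<⇒≤ 0<w) p) q)

-- Convex hulls of indicator vectors

module PolytopeProperties {c ℓ₁ ℓ₂} (K : OrderedField c ℓ₁ ℓ₂) where
  open OrderedFieldProperties K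
  open MatroidPolytopes K

  private variable
    q r : Level
    V W : Subset n → Set q
    x : Point n
    σ τ : Subset n
    C : Polytope n

  Combination : ℕ → Set c
  Combination n = List (Carrier × Subset n)

  -- Strict positivity of the weights lets a bound attained by the whole combination pass to every
  -- term. The terms are sets rather than points, so that predicates on sets can be carried along.
  record Hull (V : Subset n → Set q) (x : Point n) : Set (c ⊔ ℓ₁ ⊔ ℓ₂ ⊔ q) where
    constructor hull
    field
      comb     : Combination n
      positive : Positive comb
      inside   : All (V ∘ proj₂) comb
      mass     : eval comb (const 1#) ≈ 1#
      at       : ∀ i → x i ≈ eval comb (λ σ → indicator σ i)
  open Hull public

  infix 4 _∋_
  record _∋_ (C : Polytope n) (σ : Subset n) : Set (c ⊔ ℓ₁) where
    constructor listed
    field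
      position : Any (_≋ indicator σ) C
  open _∋_ public

  ≋-sym : {x y : Point n} → x ≋ y → y ≋ x
  ≋-sym p i = sym (p i)

  ≋-trans : {x y z : Point n} → x ≋ y → y ≋ z → x ≋ z
  ≋-trans p q i = trans (p i) (q i)

  _≋?_ : (x y : Point n) → Dec (x ≋ y)
  x ≋? y = Fin.all? (λ i → x i ≟ y i)

  _∋?_ : (C : Polytope n) (σ : Subset n) → Dec (C ∋ σ)
  C ∋? σ = map′ listed position (Any.any? (_≋? indicator σ) C)

  bool-injective : ∀ b b′ → (if b then 1# else 0#) ≈ (if b′ then 1# else 0#) → b ≡ b′
  bool-injective true  true  _ = ≡.refl
  bool-injective true  false p = contradiction (sym p) 0≉1
  bool-injective false true  p = contradiction p 0≉1
  bool-injective false false _ = ≡.refl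

  lookup-injective : ∀ (σ τ : Subset n) → (∀ i → Vec.lookup σ i ≡ Vec.lookup τ i) → σ ≡ τ
  lookup-injective []      []      p = ≡.refl
  lookup-injective (_ ∷ σ) (_ ∷ τ) p = ≡.cong₂ _∷_ (p zero) (lookup-injective σ τ (p ∘ suc))

  indicator-injective : indicator σ ≋ indicator τ → σ ≡ τ
  indicator-injective {σ = σ} {τ} p = lookup-injective σ τ λ i → bool-injective _ _ (p i)

  dot-congʳ : ∀ (a : Point n) {x y} → x ≋ y → dot a x ≈ dot a y
  dot-congʳ a p = sum-cong-≋ (λ i → *-congˡ (p i))

  dot-combination : ∀ (a : Point n) (h : Hull V x) → dot a x ≈ eval (comb h) (dot a ∘ indicator)
  dot-combination a h =
    trans (sum-cong-≋ λ i → trans (*-congˡ (at h i)) (sym (eval-*ˡ (comb h) (a i) _)))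
          (sym (eval-sum (comb h) λ i σ → a i * indicator σ i))

  ∋-map⁺ : ∀ {L : List (Subset n)} → σ ∈ L → List.map indicator L ∋ σ
  ∋-map⁺ σ∈ = listed (Any.map⁺ (Any.map (λ { ≡.refl _ → refl }) σ∈))

  -- Terms of weight zero are dropped.
  gather : ∀ {V : Subset n → Set q} C → All (λ p → ∃[ σ ] V σ × p ≋ indicator σ) C →
           (w : Vector Carrier (List.length C)) → (∀ k → 0# ≤ w k) →
           ∃[ L ] Positive L × All (V ∘ proj₂) L × eval L (const 1#) ≈ sum w ×
                  (∀ i → eval L (λ σ → indicator σ i) ≈ sum (λ k → w k * List.lookup C k i))
  gather []      []                  w 0≤w = [] , [] , [] , refl , λ _ → refl
  gather (p ∷ C) ((σ , t , p≋σ) ∷ A) w 0≤w with gather C A (w ∘ suc) (0≤w ∘ suc) | w zero ≤? 0#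
  ... | L , P , VL , m , e | no 0<w =
    (w zero , σ) ∷ L , 0<w ∷ P , t ∷ VL , +-cong (*-identityʳ _) m ,
    λ i → +-cong (*-congˡ (sym (p≋σ i))) (e i)
  ... | L , P , VL , m , e | yes w≤0 =
    L , P , VL , trans m (sym (trans (+-congʳ w≈0) (+-identityˡ _))) ,
    λ i → trans (e i) (sym (trans (+-congʳ (trans (*-congʳ w≈0) (zeroˡ _))) (+-identityˡ _)))
    where
    w≈0 : w zero ≈ 0#
    w≈0 = antisym w≤0 (0≤w zero)

  ⟦⟧⇒Hull : All (λ p → ∃[ σ ] V σ × p ≋ indicator σ) C → ⟦ C ⟧ x → Hull V x
  ⟦⟧⇒Hull {C = C} A (w , 0≤w , m , e) with gather C A w 0≤w
  ... | L , P , VL , m′ , e′ = hull L P VL (trans m′ m) (λ i → trans (e i) (sym (e′ i)))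

  concentrate : {R : Pred (Point n) r} {C : Polytope n} → Any R C → Carrier → Vector Carrier (List.length C)
  concentrate (here _)  w zero    = w
  concentrate (here _)  w (suc k) = 0#
  concentrate (there p) w zero    = 0#
  concentrate (there p) w (suc k) = concentrate p w k

  sum-0* : ∀ {m} (f : Vector Carrier m) → sum (λ k → 0# * f k) ≈ 0#
  sum-0* f = trans (sym (*-distribˡ-sum 0# f)) (zeroˡ _)

  sum-0 : ∀ m → sum {m} (λ k → 0#) ≈ 0#
  sum-0 zero    = refl
  sum-0 (suc m) = trans (+-identityˡ _) (sum-0 m)

  concentrate-nonNeg : {R : Pred (Point n) r} {C : Polytope n} (p : Any R C) {w : Carrier} → 0# ≤ w → ∀ k → 0# ≤ concentrate p w k
  concentrate-nonNeg (here _)  0≤w zero    = 0≤w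
  concentrate-nonNeg (here _)  0≤w (suc k) = ≤-refl
  concentrate-nonNeg (there p) 0≤w zero    = ≤-refl
  concentrate-nonNeg (there p) 0≤w (suc k) = concentrate-nonNeg p 0≤w k

  concentrate-sum : {R : Pred (Point n) r} {C : Polytope n} (p : Any R C) (w : Carrier) → sum (concentrate p w) ≈ w
  concentrate-sum {C = _ ∷ C} (here _)  w = trans (+-congˡ (sum-0 (List.length C))) (+-identityʳ w)
  concentrate-sum {C = _ ∷ C} (there p) w = trans (+-identityˡ _) (concentrate-sum p w)

  concentrate-at : {v : Point n} {C : Polytope n} (p : Any (_≋ v) C) (w : Carrier) (i : Fin n) →
                   sum (λ k → concentrate p w k * List.lookup C k i) ≈ w * v i
  concentrate-at {C = _ ∷ C} (here e) w i =
    trans (+-cong (*-congˡ (e i)) (sum-0* (λ k → List.lookup C k i))) (+-identityʳ _)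
  concentrate-at {C = _ ∷ C} (there p) w i =
    trans (+-cong (zeroˡ _) (concentrate-at p w i)) (+-identityˡ _)

  spread : ∀ (C : Polytope n) L → Positive L → All (λ p → C ∋ proj₂ p) L →
           Σ (Vector Carrier (List.length C)) λ w →
             (∀ k → 0# ≤ w k) × sum w ≈ eval L (const 1#) ×
             (∀ i → sum (λ k → w k * List.lookup C k i) ≈ eval L (λ σ → indicator σ i))
  spread C []            []        []       =
    (λ _ → 0#) , (λ _ → ≤-refl) , sum-0 (List.length C) , λ i → sum-0* (λ k → List.lookup C k i)
  spread C ((w , σ) ∷ L) (0<w ∷ P) (listed p ∷ ps) with spread C L P ps
  ... | v , 0≤v , m , e =
    (λ k → concentrate p w k + v k) ,
    (λ k → ≤-respˡ-≈ (+-identityˡ 0#) (+-mono-≤ (concentrate-nonNeg p (<⇒≤ 0<w) k) (0≤v k))) ,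
    trans (∑-distrib-+ (concentrate p w) v) (+-cong (trans (concentrate-sum p w) (sym (*-identityʳ w))) m) ,
    λ i → trans (sum-cong-≋ λ k → distribʳ (List.lookup C k i) (concentrate p w k) (v k))
            (trans (∑-distrib-+ (λ k → concentrate p w k * List.lookup C k i) (λ k → v k * List.lookup C k i))
                   (+-cong (concentrate-at p w i) (e i)))

  Hull⇒⟦⟧ : (∀ {σ} → V σ → C ∋ σ) → Hull V x → ⟦ C ⟧ x
  Hull⇒⟦⟧ {C = C} V⇒C h with spread C (comb h) (positive h) (All.map V⇒C (inside h))
  ... | w , 0≤w , m , e = w , 0≤w , trans m (mass h) , λ i → trans (at h i) (sym (e i))

  ∋⇒⟦⟧ : C ∋ σ → ⟦ C ⟧ (indicator σ)
  ∋⇒⟦⟧ {σ = σ} p = Hull⇒⟦⟧ {V = _≡ σ} (λ { ≡.refl → p })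
    (hull ((1# , σ) ∷ []) (0<1 ∷ []) (≡.refl ∷ []) (trans (+-identityʳ _) (*-identityʳ 1#))
          (λ i → sym (trans (+-identityʳ _) (*-identityˡ _))))

  Hull-map : (∀ {σ} → V σ → W σ) → Hull V x → Hull W x
  Hull-map f (hull L P VL m e) = hull L P (All.map f VL) m e

  Hull-resp-≋ : {x y : Point n} → x ≋ y → Hull V x → Hull V y
  Hull-resp-≋ p (hull L P VL m e) = hull L P VL m (λ i → trans (sym (p i)) (e i))

  restrict : (h : Hull V x) → All (W ∘ proj₂) (comb h) → Hull (λ σ → V σ × W σ) x
  restrict (hull L P VL m e) UL = hull L P (All.zip (VL , UL)) m e

  Hull⇒∃ : Hull V x → ∃ V
  Hull⇒∃ (hull []            _ _       m _) = contradiction m 0≉1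
  Hull⇒∃ (hull ((_ , σ) ∷ _) _ (t ∷ _) _ _) = σ , t

  eval-mass : (h : Hull V x) → ∀ k → eval (comb h) (const k) ≈ k
  eval-mass h k = trans (eval-const (comb h) k) (trans (*-congˡ (mass h)) (*-identityʳ k))

  Hull-above : (h : Hull V x) (f : Subset n → Carrier) {b : Carrier} →
               b ≤ eval (comb h) f → ∃[ σ ] V σ × b ≤ f σ
  Hull-above {V = V} h f {b} p with Any.any? (λ q → b ≤? f (proj₂ q)) (comb h)
  ... | yes b≤f = let (σ , t , ≤f) = locate (comb h) (inside h) b≤f in σ , t , ≤f
    where
    locate : ∀ L → All (V ∘ proj₂) L → Any (λ q → b ≤ f (proj₂ q)) L → ∃[ σ ] V σ × b ≤ f σ
    locate ((_ , σ) ∷ _) (t ∷ _)  (here ≤f) = σ , t , ≤f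
    locate (_ ∷ L)       (_ ∷ VL) (there a) = locate L VL a
  -- If every term stayed below `b`, the average could reach `b` only with equality at every term,
  -- and there is at least one term.
  ... | no ¬b≤f = let (σ , t , ≤f) = Hull⇒∃ (restrict {W = λ σ → b ≤ f σ} h tight) in σ , t , ≤f
    where
    tight : All (λ q → b ≤ f (proj₂ q)) (comb h)
    tight = eval-tight (positive h) (All.map <⇒≤ (All.¬Any⇒All¬ _ ¬b≤f)) (≤-respˡ-≈ (sym (eval-mass h b)) p)

  0≤indicator : ∀ (σ : Subset n) i → 0# ≤ indicator σ i
  0≤indicator σ i with Vec.lookup σ i
  ... | true  = 0≤1
  ... | false = ≤-refl

  indicator≤1 : ∀ (σ : Subset n) i → indicator σ i ≤ 1#
  indicator≤1 σ i with Vec.lookup σ i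
  ... | true  = ≤-refl
  ... | false = 0≤1

  -- A coordinate at which x attains the bound 0 or 1 is constant on the support of x.
  Hull-agree : (h : Hull V x) → ∀ i b → x i ≈ (if b then 1# else 0#) →
               All (λ q → Vec.lookup (proj₂ q) i ≡ b) (comb h)
  Hull-agree h i true p =
    All.map (λ {q} 1≤ → bool-injective _ true (antisym (indicator≤1 (proj₂ q) i) 1≤))
      (eval-tight (positive h) (All.universal (λ q → indicator≤1 (proj₂ q) i) (comb h))
        (≤-reflexive (trans (eval-mass h 1#) (trans (sym p) (at h i)))))
  Hull-agree h i false p =
    All.map (λ {q} ≤0 → bool-injective _ false (antisym ≤0 (0≤indicator (proj₂ q) i)))
      (eval-tight (positive h) (All.universal (λ q → 0≤indicator (proj₂ q) i) (comb h))
        (≤-reflexive (trans (sym (at h i)) (trans p (sym (eval-mass h 0#))))))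

  -- A vertex of the cube attains the bound 0 or 1 in every coordinate, so each term of the
  -- combination agrees with it everywhere.
  Hull-vertex : Hull V (indicator σ) → V σ
  Hull-vertex {V = V} {σ = σ} h = let (τ , t , τ≡σ) = Hull⇒∃ (restrict {W = _≡ σ} h same) in ≡.subst V τ≡σ t
    where
    same : All (λ q → proj₂ q ≡ σ) (comb h)
    same = All.tabulate λ {q} q∈ → lookup-injective _ σ λ i →
             All.lookup (Hull-agree h i (Vec.lookup σ i) refl) q∈

  Hull-tight : (h : Hull V x) (f g : Subset n → Carrier) → (∀ {σ} → V σ → f σ ≤ g σ) →
               eval (comb h) g ≤ eval (comb h) f → Hull (λ σ → V σ × f σ ≈ g σ) x
  Hull-tight {V = V} h f g f≤g p =
    Hull-map (λ (t , g≤f) → t , antisym (f≤g t) g≤f)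
      (restrict {W = λ σ → g σ ≤ f σ} h (eval-tight (positive h) (All.map f≤g (inside h)) p))

  Hull-face : (a : Point n) (b : Carrier) → (∀ {σ} → V σ → dot a (indicator σ) ≤ b) →
              Hull V x → dot a x ≈ b → Hull (λ σ → V σ × dot a (indicator σ) ≈ b) x
  Hull-face a b p h e = Hull-tight h (dot a ∘ indicator) (const b) p
    (≤-reflexive (trans (eval-mass h b) (trans (sym e) (dot-combination a h))))

  Hull-valid : (a : Point n) (b : Carrier) → (∀ {σ} → V σ → dot a (indicator σ) ≤ b) →
               Hull V x → dot a x ≤ b
  Hull-valid a b p h = ≤-respˡ-≈ (sym (dot-combination a h)) (≤-respʳ-≈ (eval-mass h b)
    (eval-mono (positive h) (All.map p (inside h))))

  Hull-dot : (a : Point n) (b : Carrier) → (∀ {σ} → V σ → dot a (indicator σ) ≈ b) →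
             Hull V x → dot a x ≈ b
  Hull-dot a b p h = trans (dot-combination a h) (trans (eval-cong (comb h) (All.map p (inside h))) (eval-mass h b))

-- Regular subdivisions

sublists : ∀ {a} {A : Set a} → List A → List (List A)
sublists []       = [] ∷ []
sublists (x ∷ xs) = List.map (x ∷_) (sublists xs) List.++ sublists xs

module RegularSubdivisions {c ℓ₁ ℓ₂} (K : OrderedField c ℓ₁ ℓ₂) where
  open OrderedFieldProperties K
  open MatroidPolytopes K
  open PolytopeProperties K
  open SemiringSolver commutativeSemiring using (solve; _:=_; _:+_; _:*_)

  private variable
    x : Point n
    σ τ : Subset n

  sub-≤ : ∀ {u v p q} → u + q ≤ p + v → u - v ≤ p - q
  sub-≤ {u} {v} {p} {q} le = +-cancelʳ-≤ (v + q) (≤-respˡ-≈ (sym eq₁) (≤-respʳ-≈ (sym eq₂) le))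
    where
    eq₁ : (u - v) + (v + q) ≈ u + q
    eq₁ = trans (sym (+-assoc _ _ _)) (+-congʳ ([x-y]+y≈x u v))
    eq₂ : (p - q) + (v + q) ≈ p + v
    eq₂ = trans (+-congˡ (+-comm v q)) (trans (sym (+-assoc _ _ _)) (+-congʳ ([x-y]+y≈x p q)))

  sub-≤⁻ : ∀ {u v p q} → u - v ≤ p - q → u + q ≤ p + v
  sub-≤⁻ {u} {v} {p} {q} le = ≤-respˡ-≈ eq₁ (≤-respʳ-≈ eq₂ (+-monoˡ-≤ (v + q) le))
    where
    eq₁ : (u - v) + (v + q) ≈ u + q
    eq₁ = trans (sym (+-assoc _ _ _)) (+-congʳ ([x-y]+y≈x u v))
    eq₂ : (p - q) + (v + q) ≈ p + v
    eq₂ = trans (+-congˡ (+-comm v q)) (trans (sym (+-assoc _ _ _)) (+-congʳ ([x-y]+y≈x p q)))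

  sub-≈ : ∀ {u v p q} → u + q ≈ p + v → u - v ≈ p - q
  sub-≈ {u} {v} {p} {q} eq = antisym (sub-≤ (≤-reflexive eq)) (sub-≤ (≤-reflexive (sym eq)))

  dot-+ : ∀ (a a′ x : Point n) → dot (λ i → a i + a′ i) x ≈ dot a x + dot a′ x
  dot-+ a a′ x = trans (sum-cong-≋ λ i → distribʳ (x i) (a i) (a′ i)) (∑-distrib-+ (λ i → a i * x i) (λ i → a′ i * x i))

  dot-*ˡ : ∀ t (a x : Point n) → dot (λ i → t * a i) x ≈ t * dot a x
  dot-*ˡ t a x = trans (sum-cong-≋ λ i → *-assoc t (a i) (x i)) (sym (*-distribˡ-sum t (λ i → a i * x i)))

  dot-sub : ∀ (a a′ x : Point n) → dot (λ i → a i - a′ i) x ≈ dot a x - dot a′ x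
  dot-sub a a′ x = trans (dot-+ a (λ i → - a′ i) x) (+-congˡ (trans
    (sum-cong-≋ λ i → trans (sym (-‿distribˡ-* (a′ i) (x i))) (trans (-‿cong (sym (*-identityˡ _))) (-‿distribˡ-* 1# _)))
    (trans (sym (*-distribˡ-sum (- 1#) (λ i → a′ i * x i))) (trans (sym (-‿distribˡ-* 1# _)) (-‿cong (*-identityˡ _))))))

  -- The functional with coefficients ±1 that is maximised over the cube at σ only.
  vertexFunctional : Subset n → Point n
  vertexFunctional σ i = if Vec.lookup σ i then 1# else - 1#

  private
    coordinate : ∀ (σ τ : Subset n) i → vertexFunctional σ i * indicator τ i ≤ vertexFunctional σ i * indicator σ i
    coordinate σ τ i with Vec.lookup σ i | Vec.lookup τ i
    ... | true  | true  = ≤-refl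
    ... | true  | false = *-monoˡ-≤ 0≤1 0≤1
    ... | false | true  = ≤-respˡ-≈ (sym (*-identityʳ _)) (≤-respʳ-≈ (sym (zeroʳ _))
                            (≤-respˡ-≈ (+-identityˡ _) (≤-respʳ-≈ (-‿inverseʳ 1#) (+-monoˡ-≤ (- 1#) 0≤1))))
    ... | false | false = ≤-refl

    coordinate-≡ : ∀ (σ τ : Subset n) i → vertexFunctional σ i * indicator σ i ≤ vertexFunctional σ i * indicator τ i →
                   Vec.lookup τ i ≡ Vec.lookup σ i
    coordinate-≡ σ τ i p with Vec.lookup σ i | Vec.lookup τ i
    ... | true  | true  = ≡.refl
    ... | true  | false = contradiction (*-cancelˡ-≤ 0<1 p) 0<1
    ... | false | true  = contradiction (≤-respʳ-≈ (-‿inverseˡ 1#) (+-monoˡ-≤ 1#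
                            (≤-respˡ-≈ (zeroʳ _) (≤-respʳ-≈ (*-identityʳ _) p)))) λ q → 0<1 (≤-respˡ-≈ (+-identityˡ 1#) q)
    ... | false | false = ≡.refl

  dot-vertexFunctional : ∀ (σ τ : Subset n) → dot (vertexFunctional σ) (indicator τ) ≤ dot (vertexFunctional σ) (indicator σ)
  dot-vertexFunctional σ τ = sum-mono-≤ (coordinate σ τ)

  dot-vertexFunctional-≡ : ∀ (σ τ : Subset n) →
    dot (vertexFunctional σ) (indicator σ) ≤ dot (vertexFunctional σ) (indicator τ) → τ ≡ σ
  dot-vertexFunctional-≡ σ τ p = lookup-injective τ σ λ i → coordinate-≡ σ τ i (sum-tight (coordinate σ τ) p i)

  Hull-≡ : Hull (_≡ σ) x → x ≋ indicator σ
  Hull-≡ {σ = σ} h i = trans (at h i) (trans (eval-cong (comb h) (All.map (λ { ≡.refl → refl }) (inside h))) (eval-mass h (indicator σ i)))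

  ⟦⟧-cong : {C C′ : Polytope n} → C ≡ C′ → ⟦ C ⟧ ≐ ⟦ C′ ⟧
  ⟦⟧-cong ≡.refl = (λ p → p) , λ p → p

  ⟦⟧⇒Hull-map : ∀ (L : List (Subset n)) → ⟦ List.map indicator L ⟧ x → Hull (_∈ L) x
  ⟦⟧⇒Hull-map L = ⟦⟧⇒Hull (All.map⁺ (All.tabulate λ {σ} σ∈ → σ , σ∈ , λ _ → refl))

  Hull⇒⟦⟧-map : ∀ {L : List (Subset n)} → Hull (_∈ L) x → ⟦ List.map indicator L ⟧ x
  Hull⇒⟦⟧-map = Hull⇒⟦⟧ ∋-map⁺

  indicator-∈ : ∀ {L : List (Subset n)} → σ ∈ L → ⟦ List.map indicator L ⟧ (indicator σ)
  indicator-∈ {σ = σ} {L = L} σ∈ = ∋⇒⟦⟧ {C = List.map indicator L} {σ = σ} (∋-map⁺ σ∈)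

  indicator-vertex : ∀ {L : List (Subset n)} → σ ∈ L → IsVertexOf (indicator σ) ⟦ List.map indicator L ⟧
  indicator-vertex {σ = σ} {L} σ∈ = a , b , valid , to , from
    where
    a = vertexFunctional σ
    b = dot a (indicator σ)
    valid : ∀ {x} → ⟦ List.map indicator L ⟧ x → dot a x ≤ b
    valid p = Hull-valid a b (λ {τ} _ → dot-vertexFunctional σ τ) (⟦⟧⇒Hull-map L p)
    to : ∀ {x} → indicator σ ≋ x → ⟦ List.map indicator L ⟧ x × dot a x ≈ b
    to p = Hull⇒⟦⟧-map (Hull-resp-≋ p (⟦⟧⇒Hull-map L (indicator-∈ σ∈))) , sym (dot-congʳ a p)
    from : ∀ {x} → ⟦ List.map indicator L ⟧ x × dot a x ≈ b → indicator σ ≋ x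
    from (p , e) = ≋-sym (Hull-≡ (Hull-map (λ {τ} (_ , eq) → dot-vertexFunctional-≡ σ τ (≤-reflexive (sym eq)))
      (Hull-face a b (λ {τ} _ → dot-vertexFunctional σ τ) (⟦⟧⇒Hull-map L p) e)))

  ∈-sublists-filter : ∀ {a p} {A : Set a} {P : Pred A p} (P? : ∀ x → Dec (P x)) xs → List.filter P? xs ∈ sublists xs
  ∈-sublists-filter P? []       = here ≡.refl
  ∈-sublists-filter P? (x ∷ xs) with P? x
  ... | yes _ = ∈-++⁺ˡ (∈-map⁺ (x ∷_) (∈-sublists-filter P? xs))
  ... | no  _ = ∈-++⁺ʳ (List.map (x ∷_) (sublists xs)) (∈-sublists-filter P? xs)

  x<y⇒0<y-x : ∀ {x y} → x < y → 0# < y - x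
  x<y⇒0<y-x {x} {y} x<y p = x<y (≤-respˡ-≈ ([x-y]+y≈x y x) (≤-respʳ-≈ (+-identityˡ x) (+-monoˡ-≤ x p)))

  -- A strict inequality survives small perturbations of both sides.
  perturb : ∀ {A H} A′ B′ → A < H → ∃[ t₀ ] 0# < t₀ × (∀ t → 0# < t → t ≤ t₀ → A + t * A′ < H + t * B′)
  perturb {A} {H} A′ B′ A<H with A′ ≤? B′
  ... | yes A′≤B′ = 1# , 0<1 , λ t 0<t _ p →
    A<H (+-cancelʳ-≤ (t * A′) (≤-trans (+-monoʳ-≤ H (*-monoˡ-≤ (<⇒≤ 0<t) A′≤B′)) p))
  ... | no B′<A′ with inverse-pos (0<+ (x<y⇒0<y-x B′<A′) (<⇒≤ (x<y⇒0<y-x A<H)))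
  ... | y , 0<y , [d+g]y≈1 = g * y , 0<* 0<g 0<y , λ t 0<t t≤gy p → td<g t t≤gy (+-cancelˡ-≤ (A + t * B′)
          (≤-respˡ-≈ (trans (+-congʳ (sym ([x-y]+y≈x H A))) (solve 3 (λ g A b → (g :+ A) :+ b := (A :+ b) :+ g) refl g A (t * B′)))
            (≤-respʳ-≈ (trans (+-congˡ (*-congˡ (sym ([x-y]+y≈x A′ B′))))
                         (solve 4 (λ A t d b → A :+ t :* (d :+ b) := (A :+ t :* b) :+ t :* d) refl A t d B′)) p)))
    where
    d = A′ - B′
    g = H - A
    0<g : 0# < g
    0<g = x<y⇒0<y-x A<H
    -- With s = g y one has s d + s g = g, so t d ≤ s d < g.
    td<g : ∀ t → t ≤ g * y → t * d < g
    td<g t t≤gy q = 0<* (0<* 0<g 0<y) 0<g (+-cancelˡ-≤ ((g * y) * d)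
      (≤-respˡ-≈ (trans (sym (*-identityʳ g)) (trans (*-congˡ (sym [d+g]y≈1))
                   (solve 3 (λ g d y → g :* ((d :+ g) :* y) := (g :* y) :* d :+ (g :* y) :* g) refl g d y)))
        (≤-respʳ-≈ (sym (+-identityʳ _)) (≤-trans q
          (≤-respˡ-≈ (*-comm d t) (≤-respʳ-≈ (*-comm d _) (*-monoˡ-≤ (<⇒≤ (x<y⇒0<y-x B′<A′)) t≤gy)))))))

  perturb-all : ∀ {a} {X : Set a} (L : List X) (A H A′ : X → Carrier) B′ →
                ∃[ t ] 0# < t × All (λ x → A x < H x → A x + t * A′ x < H x + t * B′) L
  perturb-all L A H A′ B′ = let (t , 0<t , all) = go L in t , 0<t , All.map (λ p → p t 0<t ≤-refl) all
    where
    -- Claiming the inequality for every smaller parameter allows the thresholds to be combined by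
    -- taking the minimum.
    go : ∀ L → ∃[ t₀ ] 0# < t₀ × All (λ x → ∀ t → 0# < t → t ≤ t₀ → A x < H x → A x + t * A′ x < H x + t * B′) L
    go []      = 1# , 0<1 , []
    go (x ∷ L) with go L | H x ≤? A x
    ... | t , 0<t , all | yes H≤A = t , 0<t , (λ _ _ _ A<H → contradiction H≤A A<H) ∷ all
    ... | t , 0<t , all | no A<H with perturb (A′ x) B′ A<H
    ...   | s , 0<s , p with total s t
    ...     | inj₁ s≤t = s , 0<s , (λ r 0<r r≤s _ → p r 0<r r≤s) ∷ All.map (λ q r 0<r r≤s → q r 0<r (≤-trans r≤s s≤t)) all
    ...     | inj₂ t≤s = t , 0<t , (λ r 0<r r≤t _ → p r 0<r (≤-trans r≤t t≤s)) ∷ all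

  module _ (M : Matroid n) (h : Subset n → ℕ) where
    open Matroid M using (bases)

    Below : Point n → Carrier → Set _
    Below a b = ∀ {σ} → σ ∈ bases → dot a (indicator σ) ≤ ι (h σ) + b

    Tight : Point n → Carrier → Subset n → Set _
    Tight a b σ = dot a (indicator σ) ≈ ι (h σ) + b

    tight : Point n → Carrier → List (Subset n)
    tight a b = List.filter (λ σ → dot a (indicator σ) ≟ ι (h σ) + b) bases

    tightPolytope : Point n → Carrier → Polytope n
    tightPolytope a b = List.map indicator (tight a b)

    ∈-tight⁺ : ∀ {a b} → σ ∈ bases → Tight a b σ → σ ∈ tight a b
    ∈-tight⁺ {a = a} {b} = ∈-filter⁺ (λ σ → dot a (indicator σ) ≟ ι (h σ) + b)

    ∈-tight⁻ : ∀ {a b} → σ ∈ tight a b → σ ∈ bases × Tight a b σ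
    ∈-tight⁻ {a = a} {b} = ∈-filter⁻ (λ σ → dot a (indicator σ) ≟ ι (h σ) + b)

    RegularCell : Pred (Polytope n) (c ⊔ ℓ₁ ⊔ ℓ₂)
    RegularCell C = Lift ℓ₁ (∃[ a ] ∃[ b ] Below a b × C ≡ tightPolytope a b)

    -- This is the union axiom for the lower faces of the lifting by `h`. It is a hypothesis because
    -- each height function below certifies it by a tree of hyperplane splits, which avoids a
    -- minimisation over `K`.
    LowerHullAttained : Set _
    LowerHullAttained = ∀ {x} → Hull (_∈ bases) x →
      ∃[ a ] ∃[ b ] Below a b × Hull (λ σ → σ ∈ bases × Tight a b σ) x

    ⟦tight⟧⇒Hull : ∀ {a b} → ⟦ tightPolytope a b ⟧ x → Hull (λ σ → σ ∈ bases × Tight a b σ) x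
    ⟦tight⟧⇒Hull {a = a} {b} p = Hull-map (∈-tight⁻ {a = a} {b}) (⟦⟧⇒Hull-map (tight a b) p)

    Hull⇒⟦tight⟧ : ∀ {a b} → Hull (λ σ → σ ∈ bases × Tight a b σ) x → ⟦ tightPolytope a b ⟧ x
    Hull⇒⟦tight⟧ {a = a} {b} p = Hull⇒⟦⟧-map (Hull-map (λ (σ∈ , t) → ∈-tight⁺ {a = a} {b} σ∈ t) p)

    private
      -- Adding a small multiple of the functional that exposes the face keeps exactly the face
      -- tight: on the other tight bases the added inequality is strict, and the bases that were not
      -- tight stay strictly below when the multiple is small.
      face : ∀ a b → Below a b → {Q : PointSet n} → IsFaceOf Q ⟦ tightPolytope a b ⟧ →
             ∃[ F ] RegularCell F × ⟦ F ⟧ ≐ Q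
      face a b below {Q} (a′ , b′ , valid , Q⇒ , ⇒Q)
        with perturb-all bases (dot a ∘ indicator) (λ σ → ι (h σ) + b) (dot a′ ∘ indicator) b′
      ... | t , 0<t , strict =
        tightPolytope a″ b″ , lift (a″ , b″ , below″ , ≡.refl) ,
        (λ p → ⇒Q (Hull⇒⟦tight⟧ (Hull-map (λ (σ∈ , e) → σ∈ , proj₁ (tight″⇒ σ∈ e)) (⟦tight⟧⇒Hull p)) ,
                   Hull-dot a′ b′ (λ (σ∈ , e) → proj₂ (tight″⇒ σ∈ e)) (⟦tight⟧⇒Hull p))) ,
        λ q → let (p , e) = Q⇒ q in Hull⇒⟦tight⟧ (Hull-map (λ ((σ∈ , e₁) , e₂) → σ∈ , ⇒tight″ e₁ e₂)
                (Hull-face a′ b′ (λ (σ∈ , e₁) → valid (indicator-∈ (∈-tight⁺ {a = a} {b} σ∈ e₁))) (⟦tight⟧⇒Hull p) e))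
        where
        a″ : Point n
        a″ i = a i + t * a′ i
        b″ : Carrier
        b″ = b + t * b′
        dot″ : ∀ σ → dot a″ (indicator σ) ≈ dot a (indicator σ) + t * dot a′ (indicator σ)
        dot″ σ = trans (dot-+ a (λ i → t * a′ i) (indicator σ)) (+-congˡ (dot-*ˡ t a′ (indicator σ)))
        ⇒tight″ : ∀ {σ} → Tight a b σ → dot a′ (indicator σ) ≈ b′ → Tight a″ b″ σ
        ⇒tight″ {σ} e₁ e₂ = trans (dot″ σ) (trans (+-cong e₁ (*-congˡ e₂)) (+-assoc _ _ _))
        below″ : Below a″ b″
        below″ {σ} σ∈ with dot a (indicator σ) ≟ ι (h σ) + b
        ... | yes e = ≤-respˡ-≈ (sym (dot″ σ)) (≤-respʳ-≈ (+-assoc _ _ _) (+-mono-≤ (≤-reflexive e)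
                (*-monoˡ-≤ (<⇒≤ 0<t) (valid (indicator-∈ (∈-tight⁺ {a = a} {b} σ∈ e))))))
        ... | no ¬e = ≤-respˡ-≈ (sym (dot″ σ)) (≤-respʳ-≈ (+-assoc _ _ _)
                (<⇒≤ (All.lookup strict σ∈ (≤∧≉⇒< (below σ∈) ¬e))))
        tight″⇒ : ∀ {σ} → σ ∈ bases → Tight a″ b″ σ → Tight a b σ × dot a′ (indicator σ) ≈ b′
        tight″⇒ {σ} σ∈ e with dot a (indicator σ) ≟ ι (h σ) + b
        ... | yes e₁ = e₁ , *-cancelˡ-≈ (0<⇒≉0 0<t) (antisym (+-cancelˡ-≤ _ (≤-reflexive eq)) (+-cancelˡ-≤ _ (≤-reflexive (sym eq))))
          where
          eq : (ι (h σ) + b) + t * dot a′ (indicator σ) ≈ (ι (h σ) + b) + t * b′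
          eq = trans (+-congʳ (sym e₁)) (trans (sym (dot″ σ)) (trans e (sym (+-assoc _ _ _))))
        ... | no ¬e₁ = contradiction (≤-reflexive (sym (trans (sym (dot″ σ)) (trans e (sym (+-assoc _ _ _))))))
                         (All.lookup strict σ∈ (≤∧≉⇒< (below σ∈) ¬e₁))

      -- On the bases tight for `(a , b)`, validity of `(a′ , b′)` is the inequality for the
      -- difference of the two, with equality exactly at the bases tight for both.
      meet : ∀ a b a′ b′ → Below a b → Below a′ b′ →
             IsFaceOf (⟦ tightPolytope a b ⟧ ∩ ⟦ tightPolytope a′ b′ ⟧) ⟦ tightPolytope a b ⟧
      meet a b a′ b′ below below′ = α , β , valid , to , from
        where
        α : Point n
        α i = a′ i - a i
        β : Carrier
        β = b′ - b
        le : ∀ {σ} → σ ∈ bases × Tight a b σ → dot α (indicator σ) ≤ β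
        le {σ} (σ∈ , e) = ≤-respˡ-≈ (sym (dot-sub a′ a (indicator σ))) (sub-≤
          (≤-respʳ-≈ (trans (solve 3 (λ p q r → p :+ q :+ r := q :+ (p :+ r)) refl (ι (h σ)) b′ b) (+-congˡ (sym e)))
                     (+-monoˡ-≤ b (below′ σ∈))))
        ge : ∀ {σ} → σ ∈ bases × Tight a′ b′ σ → dot (λ i → a i - a′ i) (indicator σ) ≤ b - b′
        ge {σ} (σ∈ , e) = ≤-respˡ-≈ (sym (dot-sub a a′ (indicator σ))) (sub-≤
          (≤-respʳ-≈ (trans (solve 3 (λ p q r → p :+ q :+ r := q :+ (p :+ r)) refl (ι (h σ)) b b′) (+-congˡ (sym e)))
                     (+-monoˡ-≤ b′ (below σ∈))))
        valid : ∀ {x} → ⟦ tightPolytope a b ⟧ x → dot α x ≤ β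
        valid p = Hull-valid α β le (⟦tight⟧⇒Hull p)
        to : ∀ {x} → (⟦ tightPolytope a b ⟧ ∩ ⟦ tightPolytope a′ b′ ⟧) x → ⟦ tightPolytope a b ⟧ x × dot α x ≈ β
        to {x} (p , p′) = p , antisym (valid p) (≤-respʳ-≈ (sym (dot-sub a′ a x)) (sub-≤
          (≤-respˡ-≈ (+-comm _ _) (≤-respʳ-≈ (+-comm _ _) (sub-≤⁻
            (≤-respˡ-≈ (dot-sub a a′ x) (Hull-valid _ _ ge (⟦tight⟧⇒Hull p′))))))))
        from : ∀ {x} → ⟦ tightPolytope a b ⟧ x × dot α x ≈ β → (⟦ tightPolytope a b ⟧ ∩ ⟦ tightPolytope a′ b′ ⟧) x
        from (p , e) = p , Hull⇒⟦tight⟧ (Hull-map tight′ (Hull-face α β le (⟦tight⟧⇒Hull p) e))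
          where
          tight′ : ∀ {σ} → (σ ∈ bases × Tight a b σ) × dot α (indicator σ) ≈ β → σ ∈ bases × Tight a′ b′ σ
          tight′ {σ} ((σ∈ , e₁) , e₂) = σ∈ , antisym (below′ σ∈) (+-cancelʳ-≤ b (≤-respˡ-≈
            (trans (+-congˡ e₁) (solve 3 (λ p q r → q :+ (p :+ r) := p :+ q :+ r) refl (ι (h σ)) b′ b))
            (sub-≤⁻ (≤-respʳ-≈ (dot-sub a′ a (indicator σ)) (≤-reflexive (sym e₂))))))

    regular : LowerHullAttained → Subdivision (matroidPolytope M)
    regular attained = record
      { Cell         = RegularCell
      ; vertices     = λ { (lift (a , b , _ , ≡.refl)) →
          All.map⁺ (All.tabulate λ σ∈ → indicator-vertex (proj₁ (∈-tight⁻ {a = a} {b} σ∈))) }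
      ; finite       = List.map (List.map indicator) (sublists bases) , λ { (lift (a , b , _ , ≡.refl)) →
          Any.map ⟦⟧-cong (∈-map⁺ (List.map indicator)
            (∈-sublists-filter (λ σ → dot a (indicator σ) ≟ ι (h σ) + b) bases)) }
      ; faces        = λ { (lift (a , b , below , ≡.refl)) Q → face a b below Q }
      ; intersection = λ { (lift (a , b , below , ≡.refl)) (lift (a′ , b′ , below′ , ≡.refl)) →
          meet a b a′ b′ below below′ ,
          (let (α , β , valid , to , from) = meet a′ b′ a b below′ below
           in α , β , valid , (to ∘ swap) , (swap ∘ from)) }
      ; union        = (λ p → let (a , b , below , h) = attained (⟦⟧⇒Hull-map bases p)
                              in tightPolytope a b , lift (a , b , below , ≡.refl) , Hull⇒⟦tight⟧ h) ,
                       λ { (_ , lift (a , b , _ , ≡.refl) , p) → Hull⇒⟦⟧-map (Hull-map proj₁ (⟦tight⟧⇒Hull p)) }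
      }

-- Exchanges and hyperplane splits

sameSumᵇ : Bool → Bool → Bool → Bool → Bool
sameSumᵇ true  true  c d = c ∧ d
sameSumᵇ true  false c d = c xor d
sameSumᵇ false true  c d = c xor d
sameSumᵇ false false c d = not (c ∨ d)

sameSum : (σ τ σ′ τ′ : Subset n) → Bool
sameSum []      []      []        []        = true
sameSum (a ∷ σ) (b ∷ τ) (c ∷ σ′) (d ∷ τ′) = sameSumᵇ a b c d ∧ sameSum σ τ σ′ τ′

-- SameSum σ τ σ′ τ′ says that e_σ + e_τ = e_σ′ + e_τ′.
record SameSum (σ τ σ′ τ′ : Subset n) : Set where
  constructor exchanged
  field
    proof : T (sameSum σ τ σ′ τ′)

-- The edge direction e_σ - e_τ = e_i - e_j, rearranged into an equality of sums.
Adjacent : (σ τ : Subset n) → Set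
Adjacent σ τ = ∃[ i ] ∃[ j ] i ≢ j × SameSum σ ⁅ j ⁆ τ ⁅ i ⁆

T-∧⁻ : ∀ {x y} → T (x ∧ y) → T x × T y
T-∧⁻ = Equivalence.to Bool.T-∧

module MatroidSubdivisions {c ℓ₁ ℓ₂} (K : OrderedField c ℓ₁ ℓ₂) where
  open OrderedFieldProperties K
  open MatroidPolytopes K
  open PolytopeProperties K
  open RegularSubdivisions K
  open SemiringSolver commutativeSemiring using (solve; _:=_; _:+_; _:*_)

  Modular : (Subset n → Carrier) → Set _
  Modular f = ∀ {σ τ σ′ τ′} → SameSum σ τ σ′ τ′ → f σ + f τ ≈ f σ′ + f τ′

  bit : Bool → Carrier
  bit b = if b then 1# else 0#

  bit-modular : ∀ a b c d → T (sameSumᵇ a b c d) → bit a + bit b ≈ bit c + bit d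
  bit-modular true  true  true  true  _ = refl
  bit-modular true  false true  false _ = refl
  bit-modular true  false false true  _ = +-comm _ _
  bit-modular false true  true  false _ = +-comm _ _
  bit-modular false true  false true  _ = refl
  bit-modular false false false false _ = refl

  indicator-modular : ∀ (i : Fin n) → Modular (λ σ → indicator σ i)
  indicator-modular zero    {a ∷ σ} {b ∷ τ} {c ∷ σ′} {d ∷ τ′} (exchanged s) = bit-modular a b c d (proj₁ (T-∧⁻ {sameSumᵇ a b c d} s))
  indicator-modular (suc i) {a ∷ σ} {b ∷ τ} {c ∷ σ′} {d ∷ τ′} (exchanged s) =
    indicator-modular i {σ} {τ} {σ′} {τ′} (exchanged (proj₂ (T-∧⁻ {sameSumᵇ a b c d} s)))

  dot-modular : ∀ (a : Point n) → Modular (dot a ∘ indicator)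
  dot-modular a {σ} {τ} {σ′} {τ′} s = trans (sym (dot-+ʳ σ τ)) (trans
    (sum-cong-≋ λ i → *-congˡ (indicator-modular i {σ} {τ} {σ′} {τ′} s)) (dot-+ʳ σ′ τ′))
    where
    dot-+ʳ : ∀ σ τ → sum (λ i → a i * (indicator σ i + indicator τ i)) ≈ dot a (indicator σ) + dot a (indicator τ)
    dot-+ʳ σ τ = trans (sum-cong-≋ λ i → distribˡ (a i) (indicator σ i) (indicator τ i))
                       (∑-distrib-+ (λ i → a i * indicator σ i) (λ i → a i * indicator τ i))

  -- Level 0 is one open side of a hyperplane, level 1 the hyperplane itself.  Moving
  -- weight from a pair on different sides to the exchanged pair uses up one side.
  module Splitting {n} {q} (P : Subset n → Set q) (level : Subset n → ℕ)
    (exchange : ∀ {σ τ m} → P σ → P τ → level σ ≡ 0 → level τ ≡ suc (suc m) →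
                ∃[ σ′ ] ∃[ τ′ ] P σ′ × P τ′ × SameSum σ τ σ′ τ′ × level σ′ ≡ 1 × level τ′ ≡ suc m) where

    private
      infix 4 _≈ᶜ_
      -- Testing against all modular functions covers the constant function and all coordinates at
      -- once, that is, the total mass and the represented point.
      _≈ᶜ_ : Combination n → Combination n → Set _
      L ≈ᶜ L′ = ∀ {f} → Modular f → eval L f ≈ eval L′ f

      Good : (ℕ → Set) → Carrier × Subset n → Set _
      Good R (w , σ) = 0# < w × P σ × R (level σ)

      -- Every exchange of `σ` with a term above the hyperplane consumes the smaller of the two
      -- weights. If the weight of `σ` runs out, nothing is left on its side; if it survives the
      -- whole list, nothing is left on the other side. The level of the head falls while the tail
      -- is fixed, which bounds the number of exchanges.
      absorb : ∀ {a σ} → 0# < a → P σ → level σ ≡ 0 → ∀ L → All (Good (1 ℕ.≤_)) L →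
               (∃[ L′ ] All (Good (1 ℕ.≤_)) L′ × (a , σ) ∷ L ≈ᶜ L′) ⊎
               (∃[ a′ ] ∃[ L′ ] 0# < a′ × All (Good (ℕ._≤ 1)) L′ × (a , σ) ∷ L ≈ᶜ (a′ , σ) ∷ L′)
      absorbHead : ∀ {a σ b τ} → 0# < a → P σ → level σ ≡ 0 → 0# < b → P τ → ∀ m → level τ ≡ suc m →
               ∀ L → All (Good (1 ℕ.≤_)) L →
               (∃[ L′ ] All (Good (1 ℕ.≤_)) L′ × (a , σ) ∷ (b , τ) ∷ L ≈ᶜ L′) ⊎
               (∃[ a′ ] ∃[ L′ ] 0# < a′ × All (Good (ℕ._≤ 1)) L′ × (a , σ) ∷ (b , τ) ∷ L ≈ᶜ (a′ , σ) ∷ L′)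

      absorb {a} 0<a p l [] [] = inj₂ (a , [] , 0<a , [] , λ _ → refl)
      absorb 0<a p l ((b , τ) ∷ L) ((0<b , t , 1≤) ∷ G) with level τ in eq
      ... | suc m = absorbHead 0<a p l 0<b t m eq L G

      absorbHead {a} {σ} {b} {τ} 0<a p l 0<b t zero eq L G with absorb 0<a p l L G
      ... | inj₁ (L′ , G′ , e) = inj₁ ((b , τ) ∷ L′ , (0<b , t , ℕ.≤-reflexive (≡.sym eq)) ∷ G′ ,
            λ {f} mod → trans (x∙yz≈y∙xz _ _ _) (+-congˡ (e mod)))
      ... | inj₂ (a′ , L′ , 0<a′ , G′ , e) = inj₂ (a′ , (b , τ) ∷ L′ , 0<a′ , (0<b , t , ℕ.≤-reflexive eq) ∷ G′ ,
            λ {f} mod → trans (x∙yz≈y∙xz _ _ _) (trans (+-congˡ (e mod)) (x∙yz≈y∙xz _ _ _)))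
      absorbHead {a} {σ} {b} {τ} 0<a p l 0<b t (suc m) eq L G with exchange p t l eq | b ≤? a | a ≤? b
      ... | σ′ , τ′ , p′ , t′ , s , eq₁ , eq₂ | no a<b | _ =
        inj₁ ((a , σ′) ∷ (a , τ′) ∷ (b - a , τ) ∷ L ,
              (0<a , p′ , ℕ.≤-reflexive (≡.sym eq₁)) ∷ (0<a , t′ , ≡.subst (1 ℕ.≤_) (≡.sym eq₂) (ℕ.s≤s ℕ.z≤n)) ∷
              (x<y⇒0<y-x a<b , t , ≡.subst (1 ℕ.≤_) (≡.sym eq) (ℕ.s≤s ℕ.z≤n)) ∷ G ,
              λ {f} mod → trans (+-congˡ (+-congʳ (*-congʳ (sym ([x-y]+y≈x b a)))))
                (trans (solve 5 (λ a d u v X → a :* u :+ ((d :+ a) :* v :+ X) := a :* (u :+ v) :+ (d :* v :+ X)) refl a (b - a) (f σ) (f τ) (eval L f))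
                (trans (+-congʳ (*-congˡ (mod s)))
                  (solve 6 (λ a d u v v₀ X → a :* (u :+ v) :+ (d :* v₀ :+ X) := a :* u :+ (a :* v :+ (d :* v₀ :+ X))) refl a (b - a) (f σ′) (f τ′) (f τ) (eval L f)))))
      -- Equal weights form a case of their own, since a remainder of weight zero would break
      -- positivity.
      ... | σ′ , τ′ , p′ , t′ , s , eq₁ , eq₂ | yes b≤a | yes a≤b =
        inj₁ ((a , σ′) ∷ (a , τ′) ∷ L ,
              (0<a , p′ , ℕ.≤-reflexive (≡.sym eq₁)) ∷ (0<a , t′ , ≡.subst (1 ℕ.≤_) (≡.sym eq₂) (ℕ.s≤s ℕ.z≤n)) ∷ G ,
              λ {f} mod → trans (+-congˡ (+-congʳ (*-congʳ (antisym b≤a a≤b))))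
                (trans (solve 4 (λ a u v X → a :* u :+ (a :* v :+ X) := a :* (u :+ v) :+ X) refl a (f σ) (f τ) (eval L f))
                (trans (+-congʳ (*-congˡ (mod s)))
                  (solve 4 (λ a u v X → a :* (u :+ v) :+ X := a :* u :+ (a :* v :+ X)) refl a (f σ′) (f τ′) (eval L f)))))
      -- All of `τ` is consumed. Its replacement `τ′` lies one level lower and becomes the new head,
      -- while `σ` keeps the weight `a - b`.
      ... | σ′ , τ′ , p′ , t′ , s , eq₁ , eq₂ | yes _ | no b<a with absorbHead (x<y⇒0<y-x b<a) p l 0<b t′ m eq₂ L G
      ...   | r = result r
        where
        step : ∀ {f} → Modular f → a * f σ + (b * f τ + eval L f) ≈ b * f σ′ + ((a - b) * f σ + (b * f τ′ + eval L f))
        step {f} mod = trans (+-congʳ (*-congʳ (sym ([x-y]+y≈x a b))))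
          (trans (solve 5 (λ b d u v X → (d :+ b) :* u :+ (b :* v :+ X) := b :* (u :+ v) :+ (d :* u :+ X)) refl b (a - b) (f σ) (f τ) (eval L f))
          (trans (+-congʳ (*-congˡ (mod s)))
            (solve 6 (λ b d u v u₀ X → b :* (u :+ v) :+ (d :* u₀ :+ X) := b :* u :+ (d :* u₀ :+ (b :* v :+ X))) refl b (a - b) (f σ′) (f τ′) (f σ) (eval L f))))
        result : (∃[ L′ ] All (Good (1 ℕ.≤_)) L′ × (a - b , σ) ∷ (b , τ′) ∷ L ≈ᶜ L′) ⊎
                 (∃[ a′ ] ∃[ L′ ] 0# < a′ × All (Good (ℕ._≤ 1)) L′ × (a - b , σ) ∷ (b , τ′) ∷ L ≈ᶜ (a′ , σ) ∷ L′) →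
                 (∃[ L′ ] All (Good (1 ℕ.≤_)) L′ × (a , σ) ∷ (b , τ) ∷ L ≈ᶜ L′) ⊎
                 (∃[ a′ ] ∃[ L′ ] 0# < a′ × All (Good (ℕ._≤ 1)) L′ × (a , σ) ∷ (b , τ) ∷ L ≈ᶜ (a′ , σ) ∷ L′)
        result (inj₁ (L′ , G′ , e)) = inj₁ ((b , σ′) ∷ L′ , (0<b , p′ , ℕ.≤-reflexive (≡.sym eq₁)) ∷ G′ ,
          λ mod → trans (step mod) (+-congˡ (e mod)))
        result (inj₂ (a′ , L′ , 0<a′ , G′ , e)) = inj₂ (a′ , (b , σ′) ∷ L′ , 0<a′ , (0<b , p′ , ℕ.≤-reflexive eq₁) ∷ G′ ,
          λ mod → trans (step mod) (trans (+-congˡ (e mod)) (x∙yz≈y∙xz _ _ _)))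

      merge : ∀ N L → All (Good (_≡ 0)) N → All (Good (1 ℕ.≤_)) L →
              ∃[ L′ ] (All (Good (1 ℕ.≤_)) L′ ⊎ All (Good (ℕ._≤ 1)) L′) × N List.++ L ≈ᶜ L′
      merge []            L []               G = L , inj₁ G , λ _ → refl
      merge ((a , σ) ∷ N) L ((0<a , p , l) ∷ B) G with absorb 0<a p l L G
      ... | inj₁ (L₁ , G₁ , e₁) with merge N L₁ B G₁
      ...   | L₂ , G₂ , e₂ = L₂ , G₂ , λ {f} mod →
              trans (+-congˡ (eval-++ N L f)) (trans (x∙yz≈y∙xz _ _ _) (trans (+-congˡ (e₁ mod)) (trans (sym (eval-++ N L₁ f)) (e₂ mod))))
      -- Nothing remains above level one, so the untouched terms of `N` at level zero can stay as
      -- they are.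
      merge ((a , σ) ∷ N) L ((0<a , p , l) ∷ B) G | inj₂ (a′ , L₁ , 0<a′ , G₁ , e₁) =
        (a′ , σ) ∷ N List.++ L₁ ,
        inj₂ ((0<a′ , p , ≡.subst (ℕ._≤ 1) (≡.sym l) ℕ.z≤n) ∷
              All.++⁺ (All.map (λ (0<w , p , l) → 0<w , p , ≡.subst (ℕ._≤ 1) (≡.sym l) ℕ.z≤n) B) G₁) ,
        λ {f} mod → trans (+-congˡ (eval-++ N L f)) (trans (x∙yz≈y∙xz _ _ _) (trans (+-congˡ (e₁ mod))
          (trans (x∙yz≈y∙xz _ _ _) (+-congˡ (sym (eval-++ N L₁ f))))))

      sides : ∀ L → Positive L → All (P ∘ proj₂) L →
              ∃[ N ] ∃[ L′ ] All (Good (_≡ 0)) N × All (Good (1 ℕ.≤_)) L′ × L ≈ᶜ N List.++ L′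
      sides []            []        []       = [] , [] , [] , [] , λ _ → refl
      sides ((w , σ) ∷ L) (0<w ∷ W) (p ∷ ps) with sides L W ps | level σ in eq
      ... | N , L′ , B , G , e | zero  = (w , σ) ∷ N , L′ , (0<w , p , eq) ∷ B , G , λ mod → +-congˡ (e mod)
      ... | N , L′ , B , G , e | suc _ = N , (w , σ) ∷ L′ , B , (0<w , p , ≡.subst (1 ℕ.≤_) (≡.sym eq) (ℕ.s≤s ℕ.z≤n)) ∷ G ,
        λ {f} mod → trans (+-congˡ (trans (e mod) (eval-++ N L′ f))) (trans (x∙yz≈y∙xz _ _ _) (sym (eval-++ N _ f)))

      assemble : ∀ R {x} (h : Hull P x) L → All (Good R) L → comb h ≈ᶜ L → Hull (λ σ → P σ × R (level σ)) x
      assemble R h L G e = hull L (All.map proj₁ G) (All.map proj₂ G)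
        (trans (sym (e {const 1#} (λ _ → refl))) (mass h))
        (λ i → trans (at h i) (e (λ {σ} {τ} {σ′} {τ′} → indicator-modular i {σ} {τ} {σ′} {τ′})))

    split : ∀ {x} → Hull P x → Hull (λ σ → P σ × level σ ℕ.≤ 1) x ⊎ Hull (λ σ → P σ × 1 ℕ.≤ level σ) x
    split h with sides (comb h) (positive h) (inside h)
    ... | N , L , B , G , e with merge N L B G
    ...   | L′ , inj₁ G′ , e′ = inj₂ (assemble (1 ℕ.≤_) h L′ G′ λ mod → trans (e mod) (e′ mod))
    ...   | L′ , inj₂ G′ , e′ = inj₁ (assemble (ℕ._≤ 1) h L′ G′ λ mod → trans (e mod) (e′ mod))

-- Finite certificates for lower hulls and for exchange convexity

_==_ : Subset n → Subset n → Bool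
[]      == []      = true
(a ∷ σ) == (b ∷ τ) = not (a xor b) ∧ (σ == τ)

==⇒≡ : ∀ (σ τ : Subset n) → T (σ == τ) → σ ≡ τ
==⇒≡ []          []          _ = ≡.refl
==⇒≡ (true ∷ σ)  (true ∷ τ)  p = ≡.cong (true ∷_) (==⇒≡ σ τ p)
==⇒≡ (false ∷ σ) (false ∷ τ) p = ≡.cong (false ∷_) (==⇒≡ σ τ p)

==-refl : ∀ (σ : Subset n) → T (σ == σ)
==-refl []          = tt
==-refl (true ∷ σ)  = ==-refl σ
==-refl (false ∷ σ) = ==-refl σ

not-==⇒≢ : ∀ (σ τ : Subset n) → T (not (σ == τ)) → σ ≢ τ
not-==⇒≢ σ .σ p ≡.refl with σ == σ | ==-refl σ
... | true | _ = p

differ : Subset n → Subset n → List (Fin n)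
differ []          []          = []
differ (true ∷ σ)  (false ∷ τ) = zero ∷ List.map suc (differ σ τ)
differ (_ ∷ σ)     (_ ∷ τ)     = List.map suc (differ σ τ)

infixr 6 _·_
_·_ : Fin n → Subset n → Subset n
i · σ = Vec.updateAt σ i not

exchanges : Subset n → Subset n → List (Subset n × Subset n)
exchanges σ τ = List.concatMap (λ i → List.map (λ j → i · j · σ , i · j · τ) (differ τ σ)) (differ σ τ)

shifts : Subset n → Subset n → Fin n → Fin n → Bool
shifts σ τ i j = isNo (i Fin.≟ j) ∧ sameSum σ ⁅ j ⁆ τ ⁅ i ⁆

adjacentᵇ : Subset n → Subset n → Bool
adjacentᵇ σ τ = any (λ i → any (shifts σ τ i) (differ τ σ)) (differ σ τ)

common : Subset n → Subset n → ℕ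
common []         []         = 0
common (true ∷ ρ) (true ∷ σ) = suc (common ρ σ)
common (_ ∷ ρ)    (_ ∷ σ)    = common ρ σ

-- A list of sets stands for the sum of their indicators. This gives the linear functionals with
-- natural coefficients, which can be evaluated on sets without reference to `K`.
weight : List (Subset n) → Subset n → ℕ
weight []      σ = 0
weight (ρ ∷ F) σ = common ρ σ ℕ.+ weight F σ

all-∈ : ∀ {a} {A : Set a} (p : A → Bool) {L x} → T (all p L) → x ∈ L → T (p x)
all-∈ p {L} t x∈ = All.lookup (All.all⁺ p L t) x∈

any-∃ : ∀ {a} {A : Set a} (p : A → Bool) L → T (any p L) → ∃[ x ] x ∈ L × T (p x)
any-∃ p L t = find (Any.any⁻ p L t)

T-∧⁺ : ∀ {x y} → T x → T y → T (x ∧ y)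
T-∧⁺ p q = Equivalence.from Bool.T-∧ (p , q)

T-∨⁻ : ∀ {x y} → T (x ∨ y) → T x ⊎ T y
T-∨⁻ = Equivalence.to Bool.T-∨

module _ {A : Set} (p : A → Bool) where

  ∈-filterᵇ⁺ : ∀ {x L} → x ∈ L → T (p x) → x ∈ List.filterᵇ p L
  ∈-filterᵇ⁺ {L = y ∷ L} (here ≡.refl) t with p y
  ... | true = here ≡.refl
  ∈-filterᵇ⁺ {L = y ∷ L} (there x∈) t with p y
  ... | true  = there (∈-filterᵇ⁺ x∈ t)
  ... | false = ∈-filterᵇ⁺ x∈ t

  ∈-filterᵇ⁻ : ∀ {x L} → x ∈ List.filterᵇ p L → x ∈ L × T (p x)
  ∈-filterᵇ⁻ {L = y ∷ L} x∈ with p y in eq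
  ∈-filterᵇ⁻ {L = y ∷ L} (here ≡.refl) | true = here ≡.refl , ≡.subst T (≡.sym eq) tt
  ∈-filterᵇ⁻ {L = y ∷ L} (there x∈)    | true = let (q , t) = ∈-filterᵇ⁻ x∈ in there q , t
  ∈-filterᵇ⁻ {L = y ∷ L} x∈            | false = let (q , t) = ∈-filterᵇ⁻ x∈ in there q , t

subsets : ∀ n → List (Subset n)
subsets zero    = [] ∷ []
subsets (suc n) = List.map (true ∷_) (subsets n) List.++ List.map (false ∷_) (subsets n)

∈-subsets : ∀ (σ : Subset n) → σ ∈ subsets n
∈-subsets []                  = here ≡.refl
∈-subsets {suc n} (true ∷ σ)  = ∈-++⁺ˡ (∈-map⁺ (true ∷_) (∈-subsets σ))
∈-subsets {suc n} (false ∷ σ) = ∈-++⁺ʳ (List.map (true ∷_) (subsets n)) (∈-map⁺ (false ∷_) (∈-subsets σ))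

members : (Subset n → Bool) → List (Subset n)
members {n} p = List.filterᵇ p (subsets n)

∈-members⁺ : ∀ (p : Subset n → Bool) {σ} → T (p σ) → σ ∈ members p
∈-members⁺ p {σ} = ∈-filterᵇ⁺ p (∈-subsets σ)

∈-members⁻ : ∀ (p : Subset n → Bool) {σ} → σ ∈ members p → T (p σ)
∈-members⁻ {n} p σ∈ = proj₂ (∈-filterᵇ⁻ p {L = subsets n} σ∈)

-- A record type is in normal form, so a completed check is not evaluated again.
record Check (b : Bool) : Set where
  constructor passed
  field
    holds : T b
open Check

everywhere : (p f : Subset n → Bool) → Bool
everywhere p f = all f (members p)

everywhere⁻ : ∀ (p f : Subset n → Bool) {σ} → Check (everywhere p f) → T (p σ) → T (f σ)
everywhere⁻ p f t pσ = all-∈ f (holds t) (∈-members⁺ p pσ)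

crosswise : (p q : Subset n → Bool) → (Subset n → Subset n → Bool) → Bool
crosswise p q f = go (members p) (members q)
  where
  go : List (Subset _) → List (Subset _) → Bool
  go L L′ = all (λ σ → all (f σ) L′) L

crosswise⁻ : ∀ (p q : Subset n → Bool) f {σ τ} → Check (crosswise p q f) → T (p σ) → T (q τ) → T (f σ τ)
crosswise⁻ p q f {σ} t pσ qτ = all-∈ (f σ) (all-∈ (λ σ → all (f σ) (members q)) (holds t) (∈-members⁺ p pσ)) (∈-members⁺ q qτ)

-- The nodes are hyperplanes  weight F = c + 1  and the leaves affine functions
-- weight F - c.
data SplitTree (n : ℕ) : Set where
  leaf : List (Subset n) → ℕ → SplitTree n
  node : List (Subset n) → ℕ → SplitTree n → SplitTree n → SplitTree n

module _ (h : Subset n → ℕ) (basis : Subset n → Bool) where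

  approaches : (Subset n → Bool) → (Subset n → ℕ) → Subset n → Subset n → Subset n × Subset n → Bool
  approaches p level σ τ (σ′ , τ′) =
    (level σ′ ℕ.≡ᵇ 1) ∧ (suc (level τ′) ℕ.≡ᵇ level τ) ∧ sameSum σ τ σ′ τ′ ∧ p σ′ ∧ p τ′

  splits : (Subset n → Bool) → (Subset n → ℕ) → Bool
  splits p level =
    crosswise (λ σ → p σ ∧ (level σ ℕ.≡ᵇ 0)) (λ τ → p τ ∧ (2 ℕ.≤ᵇ level τ)) λ σ τ →
      any (approaches p level σ τ) (exchanges σ τ)

  -- A leaf must lie below `h` on all bases and meet it on the bases that survive the splits leading
  -- there, so the hull of these is part of a lower face.
  validTree : SplitTree n → (Subset n → Bool) → Bool
  validTree (leaf F c) p =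
    everywhere basis (λ σ → weight F σ ℕ.≤ᵇ h σ ℕ.+ c) ∧ everywhere p (λ σ → weight F σ ℕ.≡ᵇ h σ ℕ.+ c)
  validTree (node F c lo hi) p =
    splits p level ∧ validTree lo (λ σ → p σ ∧ (level σ ℕ.≤ᵇ 1)) ∧ validTree hi (λ σ → p σ ∧ (1 ℕ.≤ᵇ level σ))
    where
    level : Subset n → ℕ
    level σ = weight F σ ℕ.∸ c

  improves : Subset n → Subset n → Subset n × Subset n → Bool
  improves σ τ (σ′ , τ′) = (h σ′ ℕ.+ h τ′ ℕ.≤ᵇ h σ ℕ.+ h τ) ∧ basis σ′ ∧ basis τ′ ∧
                           sameSum σ τ σ′ τ′ ∧ not (σ′ == σ) ∧ not (σ′ == τ)

  -- If `σ` and `τ` span a cell of the regular subdivision, the exchanged pair belongs to that cell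
  -- too. Hence only adjacent pairs can be edges.
  exchangeConvex : Bool
  exchangeConvex = crosswise basis basis λ σ τ →
    (σ == τ) ∨ adjacentᵇ σ τ ∨ any (improves σ τ) (exchanges σ τ)

module Heights {c ℓ₁ ℓ₂} (K : OrderedField c ℓ₁ ℓ₂) where
  open OrderedFieldProperties K
  open MatroidPolytopes K
  open PolytopeProperties K
  open RegularSubdivisions K
  open MatroidSubdivisions K
  open SemiringSolver commutativeSemiring using (solve; _:=_; _:+_; _:*_)

  functional : List (Subset n) → Point n
  functional []      i = 0#
  functional (ρ ∷ F) i = indicator ρ i + functional F i

  dot-indicator : ∀ (ρ σ : Subset n) → dot (indicator ρ) (indicator σ) ≈ ι (common ρ σ)
  dot-indicator []          []          = refl
  dot-indicator (true ∷ ρ)  (true ∷ σ)  = +-cong (*-identityˡ 1#) (dot-indicator ρ σ)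
  dot-indicator (true ∷ ρ)  (false ∷ σ) = trans (+-cong (zeroʳ _) (dot-indicator ρ σ)) (+-identityˡ _)
  dot-indicator (false ∷ ρ) (b ∷ σ)     = trans (+-cong (zeroˡ _) (dot-indicator ρ σ)) (+-identityˡ _)

  dot-functional : ∀ F (σ : Subset n) → dot (functional F) (indicator σ) ≈ ι (weight F σ)
  dot-functional []      σ = sum-0* (indicator σ)
  dot-functional (ρ ∷ F) σ = trans (dot-+ (indicator ρ) (functional F) (indicator σ))
    (trans (+-cong (dot-indicator ρ σ) (dot-functional F σ)) (sym (ι-+ (common ρ σ) (weight F σ))))

  module _ (M : Matroid n) (h : Subset n → ℕ) where
    open Matroid M using (bases)

    ExchangeConvex : Set
    ExchangeConvex = ∀ {σ τ} → σ ∈ bases → τ ∈ bases → σ ≢ τ → Adjacent σ τ ⊎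
      ∃[ σ′ ] ∃[ τ′ ] σ′ ∈ bases × τ′ ∈ bases × SameSum σ τ σ′ τ′ × σ′ ≢ σ × σ′ ≢ τ × h σ′ ℕ.+ h τ′ ℕ.≤ h σ ℕ.+ h τ

    -- Both pairs have the same sum under the affine function, which equals `h` on the first pair
    -- and lies below `h` on the second.
    tight-sum-≤ : ∀ {a b} → Below M h a b → ∀ {σ τ σ′ τ′} → σ′ ∈ bases → τ′ ∈ bases → SameSum σ τ σ′ τ′ →
      Tight M h a b σ → Tight M h a b τ → h σ ℕ.+ h τ ℕ.≤ h σ′ ℕ.+ h τ′
    tight-sum-≤ {a} {b} below {σ} {τ} {σ′} {τ′} σ′∈ τ′∈ s tσ tτ =
      ι-cancel-≤ (≤-respˡ-≈ (sym (ι-+ (h σ) (h τ))) (≤-respʳ-≈ (sym (ι-+ (h σ′) (h τ′))) (+-cancelʳ-≤ (b + b)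
        (≤-respˡ-≈ (+-interchange _ _ _ _) (≤-respʳ-≈ (+-interchange _ _ _ _)
          (≤-respˡ-≈ (trans (sym (dot-modular a s)) (+-cong tσ tτ)) (+-mono-≤ (below σ′∈) (below τ′∈))))))))

    -- The slacks at `σ′` and `τ′` are nonnegative, and their sum is at most zero.
    tight-exchange : ∀ {a b σ τ σ′ τ′} → Below M h a b → σ′ ∈ bases → τ′ ∈ bases → SameSum σ τ σ′ τ′ →
      h σ′ ℕ.+ h τ′ ℕ.≤ h σ ℕ.+ h τ → Tight M h a b σ → Tight M h a b τ → Tight M h a b σ′ × Tight M h a b τ′
    tight-exchange {a} {b} {σ} {τ} {σ′} {τ′} below σ′∈ τ′∈ s le tσ tτ =
      antisym (below σ′∈) (+-tightˡ (below τ′∈) total≤) , antisym (below τ′∈) (+-tightʳ (below σ′∈) total≤)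
      where
      total≤ : (ι (h σ′) + b) + (ι (h τ′) + b) ≤ dot a (indicator σ′) + dot a (indicator τ′)
      total≤ = ≤-respʳ-≈ (trans (sym (+-cong tσ tτ)) (dot-modular a s))
        (≤-respˡ-≈ (sym (+-interchange _ _ _ _)) (≤-respʳ-≈ (sym (+-interchange _ _ _ _))
          (+-monoˡ-≤ (b + b) (≤-respˡ-≈ (ι-+ (h σ′) (h τ′)) (≤-respʳ-≈ (ι-+ (h σ) (h τ)) (ι-mono-≤ le))))))

  module _ (M : Matroid n) (h : Subset n → ℕ) (basis : Subset n → Bool) (M-basis : Matroid.bases M ≡ members basis) where
    open Matroid M using (bases)

    basis⇒∈ : ∀ {σ} → T (basis σ) → σ ∈ bases
    basis⇒∈ {σ} t = ≡.subst (σ ∈_) (≡.sym M-basis) (∈-members⁺ basis t)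

    ∈⇒basis : ∀ {σ} → σ ∈ bases → T (basis σ)
    ∈⇒basis {σ} σ∈ = ∈-members⁻ basis (≡.subst (σ ∈_) M-basis σ∈)

    validTree-attained : ∀ t p → (∀ {σ} → T (p σ) → T (basis σ)) → T (validTree h basis t p) → ∀ {x} → Hull (T ∘ p) x →
      ∃[ a ] ∃[ b ] Below M h a b × Hull (λ σ → σ ∈ bases × Tight M h a b σ) x
    validTree-attained (leaf F c) p sub v H =
      functional F , ι c ,
      (λ {σ} σ∈ → ≤-respˡ-≈ (sym (dot-functional F σ)) (≤-respʳ-≈ (ι-+ (h σ) c)
        (ι-mono-≤ (ℕ.≤ᵇ⇒≤ (weight F σ) (h σ ℕ.+ c) (everywhere⁻ basis (λ σ → weight F σ ℕ.≤ᵇ h σ ℕ.+ c) (passed (proj₁ (T-∧⁻ v))) (∈⇒basis σ∈)))))) ,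
      Hull-map (λ {σ} pσ → basis⇒∈ (sub pσ) , trans (dot-functional F σ) (trans (reflexive (≡.cong ι
        (ℕ.≡ᵇ⇒≡ (weight F σ) (h σ ℕ.+ c) (everywhere⁻ p (λ σ → weight F σ ℕ.≡ᵇ h σ ℕ.+ c) (passed (proj₂ (T-∧⁻ {everywhere basis _} v))) pσ)))) (ι-+ (h σ) c))) H
    validTree-attained (node F c lo hi) p sub v H =
      [ (λ H → validTree-attained lo _ (sub ∘ proj₁ ∘ T-∧⁻) (proj₁ (T-∧⁻ v₂))
                 (Hull-map (λ (pσ , le) → T-∧⁺ pσ (ℕ.≤⇒≤ᵇ le)) H))
      , (λ H → validTree-attained hi _ (sub ∘ proj₁ ∘ T-∧⁻) (proj₂ (T-∧⁻ {validTree h basis lo _} v₂))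
                 (Hull-map (λ (pσ , le) → T-∧⁺ pσ (ℕ.≤⇒≤ᵇ le)) H))
      ]′ (split H)
      where
      level : Subset _ → ℕ
      level σ = weight F σ ℕ.∸ c
      v₁ : T (splits h basis p level)
      v₁ = proj₁ (T-∧⁻ v)
      v₂ = proj₂ (T-∧⁻ {splits h basis p level} v)
      exchange : ∀ {σ τ m} → T (p σ) → T (p τ) → level σ ≡ 0 → level τ ≡ suc (suc m) →
                 ∃[ σ′ ] ∃[ τ′ ] T (p σ′) × T (p τ′) × SameSum σ τ σ′ τ′ × level σ′ ≡ 1 × level τ′ ≡ suc m
      exchange {σ} {τ} {m} pσ pτ l₀ l₂ =
        let ((σ′ , τ′) , _ , t₀) = any-∃ (approaches h basis p level σ τ) (exchanges σ τ)
              (crosswise⁻ (λ σ → p σ ∧ (level σ ℕ.≡ᵇ 0)) (λ τ → p τ ∧ (2 ℕ.≤ᵇ level τ)) _ (passed v₁) (T-∧⁺ pσ (ℕ.≡⇒≡ᵇ _ _ l₀))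
                (T-∧⁺ pτ (ℕ.≤⇒≤ᵇ (ℕ.≤-trans (ℕ.s≤s (ℕ.s≤s ℕ.z≤n)) (ℕ.≤-reflexive (≡.sym l₂))))))
            (p₁ , t₁) = T-∧⁻ {level σ′ ℕ.≡ᵇ 1} t₀
            (p₂ , t₂) = T-∧⁻ {suc (level τ′) ℕ.≡ᵇ level τ} t₁
            (p₃ , t₃) = T-∧⁻ {sameSum σ τ σ′ τ′} t₂
            (p₄ , p₅) = T-∧⁻ {p σ′} {p τ′} t₃
        in σ′ , τ′ , p₄ , p₅ , exchanged p₃ , ℕ.≡ᵇ⇒≡ _ _ p₁ ,
           ℕ.suc-injective (≡.trans (ℕ.≡ᵇ⇒≡ (suc (level τ′)) (level τ) p₂) l₂)
      open Splitting (T ∘ p) level exchange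

    attained : ∀ t → Check (validTree h basis t basis) → LowerHullAttained M h
    attained t v H = validTree-attained t basis id (holds v) (Hull-map ∈⇒basis H)

    exchangeConvex-sound : Check (exchangeConvex h basis) → ExchangeConvex M h
    exchangeConvex-sound t {σ} {τ} σ∈ τ∈ σ≢τ with T-∨⁻ {σ == τ} (crosswise⁻ basis basis _ t (∈⇒basis σ∈) (∈⇒basis τ∈))
    ... | inj₁ eq = contradiction (==⇒≡ σ τ eq) σ≢τ
    ... | inj₂ t′ with T-∨⁻ {adjacentᵇ σ τ} t′
    ...   | inj₁ adj =
      let (i , _ , s)  = any-∃ (λ i → any (shifts σ τ i) (differ τ σ)) (differ σ τ) adj
          (j , _ , s′) = any-∃ (shifts σ τ i) (differ τ σ) s
          (p , q) = T-∧⁻ {isNo (i Fin.≟ j)} s′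
      in inj₁ (i , j , toWitnessFalse {a? = i Fin.≟ j} p , exchanged q)
    ...   | inj₂ t″ =
      let ((σ′ , τ′) , _ , t₀) = any-∃ (improves h basis σ τ) (exchanges σ τ) t″
          (p₁ , t₁) = T-∧⁻ {h σ′ ℕ.+ h τ′ ℕ.≤ᵇ h σ ℕ.+ h τ} t₀
          (p₂ , t₂) = T-∧⁻ {basis σ′} t₁
          (p₃ , t₃) = T-∧⁻ {basis τ′} t₂
          (p₄ , t₄) = T-∧⁻ {sameSum σ τ σ′ τ′} t₃
          (p₅ , p₆) = T-∧⁻ {not (σ′ == σ)} {not (σ′ == τ)} t₄
      in inj₂ (σ′ , τ′ , basis⇒∈ p₂ , basis⇒∈ p₃ , exchanged p₄ , not-==⇒≢ σ′ σ p₅ , not-==⇒≢ σ′ τ p₆ , ℕ.≤ᵇ⇒≤ _ _ p₁)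

  OnSegment : (u v z : Point n) → Carrier → Set _
  OnSegment u v z s = ∀ i → z i ≈ v i + s * (u i - v i)

  onSegment : ∀ {u v z : Point n} → ⟦ u ∷ v ∷ [] ⟧ z → ∃[ s ] OnSegment u v z s
  onSegment {u = u} {v} {z} (w , _ , m , e) = s , λ i → trans (e i) (trans (+-congˡ (+-identityʳ _))
    (sym (trans (+-congʳ (trans (sym (*-identityˡ (v i))) (*-congʳ (sym m′))))
      (trans (solve 4 (λ s t d v → (s :+ t) :* v :+ s :* d := s :* (d :+ v) :+ t :* v) refl s t (u i - v i) (v i))
             (+-congʳ (*-congˡ ([x-y]+y≈x (u i) (v i))))))))
    where
    s = w zero
    t = w (suc zero)
    m′ : s + t ≈ 1#
    m′ = trans (+-congˡ (sym (+-identityʳ t))) m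

  collinear : ∀ {u v : Point n} {σ τ ρ s t r} → OnSegment u v (indicator σ) s → OnSegment u v (indicator τ) t →
              OnSegment u v (indicator ρ) r → σ ≢ τ →
              ∀ k → Vec.lookup σ k ≡ Vec.lookup τ k → Vec.lookup ρ k ≡ Vec.lookup σ k
  collinear {u = u} {v} {σ} {τ} {ρ} {s} {t} {r} eσ eτ eρ σ≢τ k eq with (u k - v k) ≟ 0#
  ... | yes d≈0 = bool-injective _ _ (trans (eρ k) (trans (+-congˡ (trans (*-congˡ d≈0) (trans (zeroʳ r) (sym (trans (*-congˡ d≈0) (zeroʳ s)))))) (sym (eσ k))))
  ... | no d≉0 = ⊥-elim (σ≢τ (indicator-injective λ i → trans (eσ i) (trans (+-congˡ (*-congʳ s≈t)) (sym (eτ i)))))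
    where
    sd≈td : s * (u k - v k) ≈ t * (u k - v k)
    sd≈td = trans (sym (x+y-x≈y (v k) _)) (trans (+-congʳ (trans (sym (eσ k)) (trans (reflexive (≡.cong bit eq)) (eτ k)))) (x+y-x≈y (v k) _))
    s≈t : s ≈ t
    s≈t = *-cancelˡ-≈ d≉0 (trans (*-comm _ s) (trans sd≈td (*-comm t _)))

  -- At each coordinate two of three 0/1 vectors agree. As distinct points of a line agree only
  -- where its direction vanishes, the third agrees there as well.
  no-third : ∀ {u v : Point n} {σ τ ρ s t r} → OnSegment u v (indicator σ) s → OnSegment u v (indicator τ) t →
             OnSegment u v (indicator ρ) r → σ ≢ τ → ρ ≢ σ → ¬ ρ ≢ τ
  no-third {σ = σ} {τ} {ρ} eσ eτ eρ σ≢τ ρ≢σ ρ≢τ = σ≢τ (lookup-injective σ τ agree)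
    where
    agree : ∀ k → Vec.lookup σ k ≡ Vec.lookup τ k
    agree k with Vec.lookup σ k Bool.≟ Vec.lookup τ k | Vec.lookup ρ k Bool.≟ Vec.lookup σ k
    ... | yes eq | _      = eq
    ... | no _   | yes eq = ≡.sym (≡.trans (collinear {ρ = τ} eρ eσ eτ ρ≢σ k eq) eq)
    ... | no neq | no neq′ = ≡.trans (collinear {ρ = σ} eρ eτ eσ ρ≢τ k eq) eq
      where
      third : ∀ a b c → a ≢ b → c ≢ a → c ≡ b
      third true  true  _     p _ = contradiction ≡.refl p
      third true  false true  _ q = contradiction ≡.refl q
      third true  false false _ _ = ≡.refl
      third false true  true  _ _ = ≡.refl
      third false true  false _ q = contradiction ≡.refl q
      third false false _     p _ = contradiction ≡.refl p
      eq : Vec.lookup ρ k ≡ Vec.lookup τ k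
      eq = third _ _ _ neq neq′

  segment-direction : ∀ {u v : Point n} {σ τ s t} → OnSegment u v (indicator σ) s → OnSegment u v (indicator τ) t → σ ≢ τ →
    Adjacent σ τ → ∃[ i ] ∃[ j ] i ≢ j × ∃[ r ] (∀ k → u k - v k ≈ r * (e i k - e j k))
  segment-direction {u = u} {v} {σ} {τ} {s} {t} eσ eτ σ≢τ (i , j , i≢j , sum) with inverse s-t≉0
    where
    s-t≉0 : ¬ s - t ≈ 0#
    s-t≉0 p = σ≢τ (indicator-injective λ k → trans (eσ k) (trans (+-congˡ (*-congʳ
      (trans (sym ([x-y]+y≈x s t)) (trans (+-congʳ p) (+-identityˡ t))))) (sym (eτ k))))
  ... | r , inv = i , j , i≢j , r , λ k →
    trans (sym (*-identityˡ _)) (trans (*-congʳ (trans (sym inv) (*-comm _ r)))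
      (trans (*-assoc r _ _) (*-congˡ (trans (sym (scaled k)) (sub-≈
        (trans (indicator-modular k sum) (+-comm _ _)))))))
    where
    scaled : ∀ k → indicator σ k - indicator τ k ≈ (s - t) * (u k - v k)
    scaled k = trans (sub-≈ (trans (+-congʳ (eσ k)) (trans
        (solve 3 (λ v x y → v :+ x :+ y := x :+ (v :+ y)) refl (v k) (s * (u k - v k)) (t * (u k - v k)))
        (+-congˡ (sym (eτ k))))))
      (trans (+-congˡ (-‿distribˡ-* t _)) (sym (distribʳ _ s (- t))))

  -- An edge contains two distinct tight bases, as its two ends would otherwise coincide. If these
  -- were not adjacent, exchange convexity would put a third 0/1 vector on their line.
  regular-matroidal : ∀ (M : Matroid n) h (att : LowerHullAttained M h) → ExchangeConvex M h → IsMatroidal (regular M h att)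
  regular-matroidal {n} M h att convex (lift (a , b , below , ≡.refl)) {u} {v} u≇v (C⊆uv , uv⊆C) =
    conclude (Any.any? (λ τ → T? (not (σ₀ == τ))) (tight M h a b))
    where
    open Matroid M using (bases)
    Hu = ⟦⟧⇒Hull-map (tight M h a b) (uv⊆C {u} (end u v))
      where
      end : ∀ u v → ⟦ u ∷ v ∷ [] ⟧ u
      end u v = (λ { zero → 1# ; (suc _) → 0# }) , (λ { zero → 0≤1 ; (suc _) → ≤-refl }) ,
        trans (+-congˡ (+-identityʳ _)) (+-identityʳ _) ,
        λ i → sym (trans (+-cong (*-identityˡ _) (trans (+-identityʳ _) (zeroˡ _))) (+-identityʳ _))
    Hv = ⟦⟧⇒Hull-map (tight M h a b) (uv⊆C {v} (end u v))
      where
      end : ∀ u v → ⟦ u ∷ v ∷ [] ⟧ v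
      end u v = (λ { zero → 0# ; (suc _) → 1# }) , (λ { zero → ≤-refl ; (suc _) → 0≤1 }) ,
        trans (+-congˡ (+-identityʳ _)) (+-identityˡ _) ,
        λ i → sym (trans (+-cong (zeroˡ _) (trans (+-identityʳ _) (*-identityˡ _))) (+-identityˡ _))
    σ₀ : Subset n
    σ₀ = proj₁ (Hull⇒∃ Hu)
    segment : ∀ {σ} → σ ∈ tight M h a b → ∃[ s ] OnSegment u v (indicator σ) s
    segment σ∈ = onSegment (C⊆uv (indicator-∈ σ∈))
    conclude : Dec (Any (λ τ → T (not (σ₀ == τ))) (tight M h a b)) → _
    conclude (no all-equal) = contradiction (≋-trans (toσ₀ Hu) (≋-sym (toσ₀ Hv))) u≇v
      where
      toσ₀ : ∀ {x} → Hull (_∈ tight M h a b) x → x ≋ indicator σ₀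
      toσ₀ H = Hull-≡ (Hull-map (λ {τ} τ∈ → ≡.sym (==⇒≡ σ₀ τ (decide (σ₀ == τ) λ p → all-equal (lose τ∈ p)))) H)
        where
        decide : ∀ x → ¬ T (not x) → T x
        decide true  _ = tt
        decide false p = p tt
    conclude (yes some) =
      let (τ , τ∈ , t) = find some
          σ∈  = proj₂ (Hull⇒∃ Hu)
          σ≢τ = not-==⇒≢ σ₀ τ t
          (σ∈B , tσ) = ∈-tight⁻ M h {a = a} {b} σ∈
          (τ∈B , tτ) = ∈-tight⁻ M h {a = a} {b} τ∈
      in [ segment-direction (proj₂ (segment σ∈)) (proj₂ (segment τ∈)) σ≢τ
         , (λ (σ′ , τ′ , σ′∈ , τ′∈ , sum , σ′≢σ , σ′≢τ , le) →
             ⊥-elim (no-third (proj₂ (segment σ∈)) (proj₂ (segment τ∈))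
               (proj₂ (segment (∈-tight⁺ M h {a = a} {b} σ′∈ (proj₁ (tight-exchange M h {a} {b} below σ′∈ τ′∈ sum le tσ tτ)))))
               σ≢τ σ′≢σ σ′≢τ))
         ]′ (convex σ∈B τ∈B σ≢τ)

-- Matroids from a finite check of the exchange axiom

exchangesInto : (Subset n → Bool) → Subset n → Subset n → Fin n → Fin n → Bool
exchangesInto p σ τ i j = p ((σ Subset.- i) ∪ ⁅ j ⁆)

isMatroid : ℕ → (Subset n → Bool) → Bool
isMatroid r p = everywhere p (λ σ → ∣ σ ∣ ℕ.≡ᵇ r) ∧
  crosswise p p λ σ τ → all (λ i → any (exchangesInto p σ τ i) (differ τ σ)) (differ σ τ)

∈-differ⁺ : ∀ {σ τ : Subset n} {i} → i Subset.∈ σ → i Subset.∉ τ → i ∈ differ σ τ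
∈-differ⁺ {σ = true ∷ σ} {false ∷ τ} Vec.here        i∉ = here ≡.refl
∈-differ⁺ {σ = true ∷ σ} {true ∷ τ}  Vec.here        i∉ = contradiction Vec.here i∉
∈-differ⁺ {σ = true ∷ σ} {false ∷ τ} (Vec.there i∈) i∉ = there (∈-map⁺ suc (∈-differ⁺ i∈ λ p → i∉ (Vec.there p)))
∈-differ⁺ {σ = true ∷ σ} {true ∷ τ}  (Vec.there i∈) i∉ = ∈-map⁺ suc (∈-differ⁺ i∈ λ p → i∉ (Vec.there p))
∈-differ⁺ {σ = false ∷ σ} {_ ∷ τ}    (Vec.there i∈) i∉ = ∈-map⁺ suc (∈-differ⁺ i∈ λ p → i∉ (Vec.there p))

∈-differ⁻ : ∀ {σ τ : Subset n} {i} → i ∈ differ σ τ → i Subset.∈ σ × i Subset.∉ τ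
∈-differ⁻ {σ = true ∷ σ} {false ∷ τ} (here ≡.refl) = Vec.here , λ ()
∈-differ⁻ {σ = true ∷ σ} {false ∷ τ} (there p) with ∈-map⁻ suc p
... | _ , q , ≡.refl = let (i∈ , i∉) = ∈-differ⁻ q in Vec.there i∈ , λ { (Vec.there r) → i∉ r }
∈-differ⁻ {σ = true ∷ σ} {true ∷ τ} p with ∈-map⁻ suc p
... | _ , q , ≡.refl = let (i∈ , i∉) = ∈-differ⁻ q in Vec.there i∈ , λ { (Vec.there r) → i∉ r }
∈-differ⁻ {σ = false ∷ σ} {_ ∷ τ} p with ∈-map⁻ suc p
... | _ , q , ≡.refl = let (i∈ , i∉) = ∈-differ⁻ q in Vec.there i∈ , λ { (Vec.there r) → i∉ r }

matroid : ∀ r (p : Subset n → Bool) → (∃[ σ ] T (p σ)) → Check (isMatroid r p) → Matroid n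
matroid r p (ρ , pρ) (passed t) = record
  { rank     = r
  ; bases    = members p
  ; nonempty = ρ , ∈-members⁺ p pρ
  ; size     = λ σ∈ → ℕ.≡ᵇ⇒≡ _ r (everywhere⁻ p (λ σ → ∣ σ ∣ ℕ.≡ᵇ r) (passed (proj₁ (T-∧⁻ t))) (∈-members⁻ p σ∈))
  ; exchange = λ {σ} {τ} σ∈ τ∈ {i} i∈ i∉ →
      let (j , j∈ , q) = any-∃ (exchangesInto p σ τ i) (differ τ σ)
            (all-∈ (λ i → any (exchangesInto p σ τ i) (differ τ σ))
              (crosswise⁻ p p _ (passed (proj₂ (T-∧⁻ {everywhere p _} t))) (∈-members⁻ p σ∈) (∈-members⁻ p τ∈))
              (∈-differ⁺ i∈ i∉))
          (j∈τ , j∉σ) = ∈-differ⁻ j∈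
      in j , j∈τ , j∉σ , ∈-members⁺ p q
  }

-- Cells of an arbitrary matroid subdivision

infix 4 _∈ᵇ_
_∈ᵇ_ : Subset n → List (Subset n) → Bool
σ ∈ᵇ L = any (σ ==_) L

∈ᵇ⇒∈ : ∀ {σ : Subset n} {L} → T (σ ∈ᵇ L) → σ ∈ L
∈ᵇ⇒∈ {σ = σ} {L} p = Any.map (λ {τ} → ==⇒≡ σ τ) (Any.any⁻ (σ ==_) L p)

between : (lo hi σ : Subset n) → Bool
between []           []           []          = true
between (true  ∷ lo) (_     ∷ hi) (s ∷ σ) = s ∧ between lo hi σ
between (false ∷ lo) (true  ∷ hi) (_ ∷ σ) = between lo hi σ
between (false ∷ lo) (false ∷ hi) (s ∷ σ) = not s ∧ between lo hi σ

between⁺ : ∀ (lo hi σ : Subset n) → (∀ i → Vec.lookup lo i ≡ true → Vec.lookup σ i ≡ true) →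
           (∀ i → Vec.lookup hi i ≡ false → Vec.lookup σ i ≡ false) → T (between lo hi σ)
between⁺ []           []           []      p q = tt
between⁺ (true  ∷ lo) (_     ∷ hi) (s ∷ σ) p q with s | p zero ≡.refl
... | true | _ = between⁺ lo hi σ (p ∘ suc) (q ∘ suc)
between⁺ (false ∷ lo) (true  ∷ hi) (s ∷ σ) p q = between⁺ lo hi σ (p ∘ suc) (q ∘ suc)
between⁺ (false ∷ lo) (false ∷ hi) (s ∷ σ) p q with s | q zero ≡.refl
... | false | _ = between⁺ lo hi σ (p ∘ suc) (q ∘ suc)

meet join : Subset n → List (Subset n) → Subset n
meet σ []      = σ
meet σ (τ ∷ X) = σ ⋂ meet τ X
join σ []      = σ
join σ (τ ∷ X) = σ ∪ join τ X

meet-all : ∀ (σ : Subset n) X i → Vec.lookup (meet σ X) i ≡ true → All (λ τ → Vec.lookup τ i ≡ true) (σ ∷ X)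
meet-all σ []      i p = p ∷ []
meet-all σ (τ ∷ X) i p with Vec.lookup σ i in eq | ≡.trans (≡.sym (Vec.lookup-zipWith _∧_ i σ (meet τ X))) p
... | true | q = eq ∷ meet-all τ X i q

join-all : ∀ (σ : Subset n) X i → Vec.lookup (join σ X) i ≡ false → All (λ τ → Vec.lookup τ i ≡ false) (σ ∷ X)
join-all σ []      i p = p ∷ []
join-all σ (τ ∷ X) i p with Vec.lookup σ i in eq | ≡.trans (≡.sym (Vec.lookup-zipWith _∨_ i σ (join τ X))) p
... | false | q = eq ∷ join-all τ X i q

totalWeight : List (Subset n) → List (Subset n) → ℕ
totalWeight X F = List.foldr (λ ρ m → weight F ρ ℕ.+ m) 0 X

separates : Subset n → Subset n → Fin n → Fin n → Bool
separates σ τ i k = isNo (i Fin.≟ k) ∧ (Vec.lookup σ k xor Vec.lookup τ k)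

separates⁻ : ∀ (σ τ : Subset n) i k → T (separates σ τ i k) → i ≢ k × Vec.lookup σ k ≢ Vec.lookup τ k
separates⁻ σ τ i k t = let (p , q) = T-∧⁻ {isNo (i Fin.≟ k)} t in toWitnessFalse {a? = i Fin.≟ k} p , different _ _ q
  where
  different : ∀ x y → T (x xor y) → x ≢ y
  different true  false _ ()
  different false true  _ ()

-- Three coordinates at which `σ` and `τ` differ exclude the direction e_a - e_b, which has only two
-- nonzero coordinates. The cyclic use of `separates` records both the distinctness of the three and
-- the difference at each.
threeApart : Subset n → Subset n → List (Fin n) → List (Fin n) → Bool
threeApart σ τ (i ∷ j ∷ _) (k ∷ _) = separates σ τ i j ∧ separates σ τ j k ∧ separates σ τ k i
threeApart σ τ _           _       = false

farApart : Subset n → Subset n → Bool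
farApart σ τ = threeApart σ τ (differ σ τ) (differ τ σ)

farApart⁻ : ∀ (σ τ : Subset n) → T (farApart σ τ) → ∃[ i ] ∃[ j ] ∃[ k ] T (separates σ τ i j) × T (separates σ τ j k) × T (separates σ τ k i)
farApart⁻ σ τ t with differ σ τ | differ τ σ
... | i ∷ j ∷ _ | k ∷ _ = let (p , q) = T-∧⁻ {separates σ τ i j} t ; (q , r) = T-∧⁻ {separates σ τ j k} q in i , j , k , p , q , r

lookup-⁅⁆ : ∀ {i k : Fin n} → i ≢ k → Vec.lookup ⁅ i ⁆ k ≡ false
lookup-⁅⁆ {i = zero}  {zero}  i≢k = contradiction ≡.refl i≢k
lookup-⁅⁆ {i = zero}  {suc k} i≢k = Vec.lookup-replicate k false
lookup-⁅⁆ {i = suc i} {zero}  i≢k = ≡.refl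
lookup-⁅⁆ {i = suc i} {suc k} i≢k = lookup-⁅⁆ (i≢k ∘ ≡.cong suc)

-- For sets at distance two there are four exchanges. The last two repeat the first two with
-- components swapped, so two entries give the other diagonals of the octahedron.
opposite : Subset n → Subset n → List (Subset n × Subset n)
opposite σ τ = List.take 2 (exchanges σ τ)

-- If a cell misses α and β, one from each of two opposite pairs with the midpoint
-- of σ and τ, then the functional e_α + e_β exposes the segment from σ to τ.
isolates : List (Subset n) → (σ τ α β : Subset n) → Bool
isolates L σ τ α β = (f σ ℕ.≡ᵇ f τ) ∧
  all (λ ρ → (ρ == σ) ∨ (ρ == τ) ∨ (ρ == α) ∨ (ρ == β) ∨ (f ρ ℕ.<ᵇ f σ)) L
  where
  f = weight (α ∷ β ∷ [])

module _ (L : List (Subset n)) (σ τ α β : Subset n) (iso : T (isolates L σ τ α β)) where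

  private
    f : Subset n → ℕ
    f = weight (α ∷ β ∷ [])

    classify : ∀ {ρ} → ρ ∈ L → ρ ≢ α → ρ ≢ β → (ρ ≡ σ ⊎ ρ ≡ τ) ⊎ f ρ ℕ.< f σ
    classify {ρ} ρ∈ ρ≢α ρ≢β with T-∨⁻ {ρ == σ} (all-∈ (λ ρ → (ρ == σ) ∨ (ρ == τ) ∨ (ρ == α) ∨ (ρ == β) ∨ (f ρ ℕ.<ᵇ f σ))
                                   (proj₂ (T-∧⁻ {f σ ℕ.≡ᵇ f τ} iso)) ρ∈)
    ... | inj₁ p = inj₁ (inj₁ (==⇒≡ ρ σ p))
    ... | inj₂ t with T-∨⁻ {ρ == τ} t
    ...   | inj₁ p = inj₁ (inj₂ (==⇒≡ ρ τ p))
    ...   | inj₂ t with T-∨⁻ {ρ == α} t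
    ...     | inj₁ p = contradiction (==⇒≡ ρ α p) ρ≢α
    ...     | inj₂ t with T-∨⁻ {ρ == β} t
    ...       | inj₁ p = contradiction (==⇒≡ ρ β p) ρ≢β
    ...       | inj₂ t = inj₂ (ℕ.<ᵇ⇒< (f ρ) (f σ) t)

  isolates-≡ : f σ ≡ f τ
  isolates-≡ = ℕ.≡ᵇ⇒≡ _ _ (proj₁ (T-∧⁻ {f σ ℕ.≡ᵇ f τ} iso))

  isolates-max : ∀ {ρ} → ρ ∈ L → ρ ≢ α → ρ ≢ β → f ρ ℕ.≤ f σ
  isolates-max ρ∈ ρ≢α ρ≢β with classify ρ∈ ρ≢α ρ≢β
  ... | inj₁ (inj₁ ≡.refl) = ℕ.≤-refl
  ... | inj₁ (inj₂ ≡.refl) = ℕ.≤-reflexive (≡.sym isolates-≡)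
  ... | inj₂ lt            = ℕ.<⇒≤ lt

  isolates-only : ∀ {ρ} → ρ ∈ L → ρ ≢ α → ρ ≢ β → f ρ ≡ f σ → ρ ≡ σ ⊎ ρ ≡ τ
  isolates-only ρ∈ ρ≢α ρ≢β eq with classify ρ∈ ρ≢α ρ≢β
  ... | inj₁ q  = q
  ... | inj₂ lt = contradiction eq (ℕ.<⇒≢ lt)

isolatesAll : List (Subset n) → (σ τ : Subset n) → List (Subset n × Subset n) → Bool
isolatesAll L σ τ ((α , α′) ∷ (β , β′) ∷ []) =
  isolates L σ τ α β ∧ isolates L σ τ α β′ ∧ isolates L σ τ α′ β ∧ isolates L σ τ α′ β′
isolatesAll L σ τ _ = false

isSquare : List (Subset n) → (σ τ : Subset n) → Bool
isSquare L σ τ = farApart σ τ ∧ isolatesAll (List.filterᵇ (between (σ ⋂ τ) (σ ∪ τ)) L) σ τ (opposite σ τ)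

module Cells {c ℓ₁ ℓ₂} (K : OrderedField c ℓ₁ ℓ₂) where
  open OrderedFieldProperties K
  open MatroidPolytopes K
  open PolytopeProperties K
  open RegularSubdivisions K
  open MatroidSubdivisions K
  open Heights K

  uniform : Carrier → List (Subset n) → Combination n
  uniform w = List.map (w ,_)

  module _ {n : ℕ} (ρ : Subset n) (X : List (Subset n)) where

    private
      size : ℕ
      size = suc (List.length X)
      reciprocal : ∃[ w ] 0# < w × ι size * w ≈ 1#
      reciprocal = inverse-pos (0<ι (List.length X))
      w : Carrier
      w = proj₁ reciprocal

    barycentre : Point n
    barycentre i = eval (uniform w (ρ ∷ X)) (λ σ → indicator σ i)

    private
      eval-uniform : ∀ (Y : List (Subset n)) (f : Subset n → ℕ) → eval (uniform w Y) (ι ∘ f) ≈ w * ι (List.foldr (λ σ m → f σ ℕ.+ m) 0 Y)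
      eval-uniform []      f = sym (zeroʳ w)
      eval-uniform (σ ∷ Y) f = trans (+-congˡ (eval-uniform Y f)) (trans (sym (distribˡ w _ _)) (*-congˡ (sym (ι-+ (f σ) _))))

      eval-count : ∀ (Y : List (Subset n)) → eval (uniform w Y) (const 1#) ≈ w * ι (List.length Y)
      eval-count []      = sym (zeroʳ w)
      eval-count (σ ∷ Y) = trans (+-congˡ (eval-count Y)) (sym (distribˡ w _ _))

      uniform-mass : eval (uniform w (ρ ∷ X)) (const 1#) ≈ 1#
      uniform-mass = trans (eval-count (ρ ∷ X)) (trans (*-comm w _) (proj₂ (proj₂ reciprocal)))

      uniform-All : ∀ {q} {P : Subset n → Set q} {Y} → All P Y → All (P ∘ proj₂) (uniform w Y)
      uniform-All = All.map⁺

    barycentre-Hull : ∀ {q} {P : Subset n → Set q} → All P (ρ ∷ X) → Hull P barycentre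
    barycentre-Hull ps = hull (uniform w (ρ ∷ X)) (All.map⁺ (All.universal (λ _ → proj₁ (proj₂ reciprocal)) (ρ ∷ X)))
      (uniform-All ps) uniform-mass (λ i → refl)

    barycentre-face : ∀ a b → All (λ σ → dot a (indicator σ) ≤ b) (ρ ∷ X) → dot a barycentre ≈ b →
                      All (λ σ → dot a (indicator σ) ≈ b) (ρ ∷ X)
    barycentre-face a b ps eq = All.zipWith (λ (p , q) → antisym p q) (ps , All.map⁻
      (eval-tight {f = dot a ∘ indicator} {const b} (positive H) (uniform-All ps)
        (≤-reflexive (trans (eval-mass H b) (trans (sym eq) (dot-combination a H))))))
      where
      H = barycentre-Hull ps

    -- A coordinate that is constant on `ρ ∷ X` has the value 0 or 1 at the barycentre, hence is
    -- constant on every support of it. This keeps the lists of candidates short.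
    barycentre-between : ∀ {q} {P : Subset n → Set q} → Hull P barycentre →
      Hull (λ σ → P σ × T (between (meet ρ X) (join ρ X) σ)) barycentre
    barycentre-between H = restrict H (All.tabulate λ {q} q∈ → between⁺ (meet ρ X) (join ρ X) (proj₂ q)
      (λ i p → All.lookup (Hull-agree H i true  (agree true  i (meet-all ρ X i p))) q∈)
      (λ i p → All.lookup (Hull-agree H i false (agree false i (join-all ρ X i p))) q∈))
      where
      agree : ∀ b i → All (λ τ → Vec.lookup τ i ≡ b) (ρ ∷ X) → barycentre i ≈ (if b then 1# else 0#)
      agree b i ps = trans (eval-cong (uniform w (ρ ∷ X)) (uniform-All (All.map (λ p → reflexive (≡.cong bit p)) ps)))
        (trans (eval-const (uniform w (ρ ∷ X)) (bit b)) (trans (*-congˡ uniform-mass) (*-identityʳ _)))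

    -- The value at the barycentre is the average over `ρ ∷ X`, and in any other convex
    -- representation of the same point some vertex reaches it. Multiplying by the number of points
    -- brings the inequality back to natural numbers.
    barycentre-above : ∀ {q} {P : Subset n → Set q} F → Hull P barycentre →
      ∃[ σ ] P σ × totalWeight (ρ ∷ X) F ℕ.≤ size ℕ.* weight F σ
    barycentre-above F H =
      let (σ , pσ , le) = Hull-above H (ι ∘ weight F) {w * ι (totalWeight (ρ ∷ X) F)} (≤-reflexive same)
      in σ , pσ , ι-cancel-≤ (≤-respˡ-≈ (trans (sym (*-assoc _ w _)) (trans (*-congʳ (proj₂ (proj₂ reciprocal))) (*-identityˡ _)))
           (≤-respʳ-≈ (sym (ι-* size (weight F σ))) (*-monoˡ-≤ (0≤ι size) le)))
      where
      B = barycentre-Hull {P = λ _ → ⊤} (All.universal (λ _ → tt) (ρ ∷ X))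
      same : w * ι (totalWeight (ρ ∷ X) F) ≈ eval (comb H) (ι ∘ weight F)
      same = trans (sym (eval-uniform (ρ ∷ X) (weight F)))
        (trans (eval-ext (uniform w (ρ ∷ X)) λ σ → sym (dot-functional F σ))
        (trans (sym (dot-combination (functional F) B))
        (trans (dot-combination (functional F) H) (eval-ext (comb H) (dot-functional F)))))

  barycentre-cong : ∀ {σ τ σ′ τ′ : Subset n} → SameSum σ τ σ′ τ′ → barycentre σ (τ ∷ []) ≋ barycentre σ′ (τ′ ∷ [])
  barycentre-cong {σ = σ} {τ} {σ′} {τ′} s i = trans (factor σ τ) (trans (*-congˡ (indicator-modular i {σ} {τ} {σ′} {τ′} s)) (sym (factor σ′ τ′)))
    where
    w : Carrier
    w = proj₁ (inverse-pos (0<ι 1))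
    factor : ∀ σ τ → barycentre σ (τ ∷ []) i ≈ w * (indicator σ i + indicator τ i)
    factor σ τ = trans (+-congˡ (+-identityʳ _)) (sym (distribˡ w _ _))

  ⟦⟧-resp-≋ : ∀ {C : Polytope n} {x y} → x ≋ y → ⟦ C ⟧ x → ⟦ C ⟧ y
  ⟦⟧-resp-≋ p (w , 0≤w , m , e) = w , 0≤w , m , λ i → trans (sym (p i)) (e i)

  -- The functional with coefficient σ i + τ i - 1 is maximised over the cube
  -- exactly between σ ∩ τ and σ ∪ τ.
  intervalFunctional : Subset n → Subset n → Point n
  intervalFunctional σ τ i =
    if Vec.lookup σ i then (if Vec.lookup τ i then 1# else 0#) else (if Vec.lookup τ i then 0# else - 1#)

  private
    -1*1≤-1*0 : - 1# * 1# ≤ - 1# * 0#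
    -1*1≤-1*0 = ≤-respˡ-≈ (sym (*-identityʳ _)) (≤-respʳ-≈ (sym (zeroʳ _))
                  (≤-respˡ-≈ (+-identityˡ _) (≤-respʳ-≈ (-‿inverseʳ 1#) (+-monoˡ-≤ (- 1#) 0≤1))))

    0≰-1 : ¬ - 1# * 0# ≤ - 1# * 1#
    0≰-1 p = 0<1 (≤-respˡ-≈ (+-identityˡ 1#) (≤-respʳ-≈ (-‿inverseˡ 1#) (+-monoˡ-≤ 1#
                (≤-respˡ-≈ (zeroʳ _) (≤-respʳ-≈ (*-identityʳ _) p)))))

    interval-≤ : ∀ (σ τ ρ : Subset n) i → intervalFunctional σ τ i * indicator ρ i ≤ intervalFunctional σ τ i * indicator σ i
    interval-≤ σ τ ρ i with Vec.lookup σ i | Vec.lookup τ i | Vec.lookup ρ i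
    ... | true  | true  | true  = ≤-refl
    ... | true  | true  | false = *-monoˡ-≤ 0≤1 0≤1
    ... | true  | false | r     = ≤-reflexive (trans (zeroˡ _) (sym (zeroˡ _)))
    ... | false | true  | r     = ≤-reflexive (trans (zeroˡ _) (sym (zeroˡ _)))
    ... | false | false | true  = -1*1≤-1*0
    ... | false | false | false = ≤-refl

    interval-τ : ∀ (σ τ : Subset n) i → intervalFunctional σ τ i * indicator τ i ≈ intervalFunctional σ τ i * indicator σ i
    interval-τ σ τ i with Vec.lookup σ i | Vec.lookup τ i
    ... | true  | true  = refl
    ... | true  | false = trans (zeroˡ _) (sym (zeroˡ _))
    ... | false | true  = trans (zeroˡ _) (sym (zeroˡ _))
    ... | false | false = refl

    interval-inside : ∀ (σ τ ρ : Subset n) i → intervalFunctional σ τ i * indicator σ i ≤ intervalFunctional σ τ i * indicator ρ i →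
      (Vec.lookup σ i ∧ Vec.lookup τ i ≡ true → Vec.lookup ρ i ≡ true) × (Vec.lookup σ i ∨ Vec.lookup τ i ≡ false → Vec.lookup ρ i ≡ false)
    interval-inside σ τ ρ i p with Vec.lookup σ i | Vec.lookup τ i | Vec.lookup ρ i
    ... | true  | true  | true  = (λ _ → ≡.refl) , λ ()
    ... | true  | true  | false = contradiction (*-cancelˡ-≤ 0<1 p) 0<1
    ... | true  | false | r     = (λ ()) , λ ()
    ... | false | true  | r     = (λ ()) , λ ()
    ... | false | false | true  = contradiction p 0≰-1
    ... | false | false | false = (λ ()) , λ _ → ≡.refl

  module MatroidalSubdivision (M : Matroid n) (D : Subdivision (matroidPolytope M)) (matroidal : IsMatroidal D) where
    open Matroid M using (bases)
    open Subdivision D using (vertices; faces; intersection; union)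

    -- The functional exposing the vertex attains its bound at some basis in the support of the
    -- vertex, and only the vertex itself attains it.
    vertex⇒basis : ∀ {v} → IsVertexOf v ⟦ matroidPolytope M ⟧ → ∃[ σ ] σ ∈ bases × v ≋ indicator σ
    vertex⇒basis {v} (a , b , valid , to , from) =
      let (Pv , eq) = to {v} (λ _ → refl)
          (σ , σ∈ , e) = Hull⇒∃ (Hull-face a b (λ σ∈ → valid (indicator-∈ σ∈)) (⟦⟧⇒Hull-map bases Pv) eq)
      in σ , σ∈ , from (indicator-∈ σ∈ , e)

    cell-basis : ∀ {C σ} → Cell D C → C ∋ σ → σ ∈ bases
    cell-basis {C} {σ} cell C∋σ =
      let (p , p∈ , p≋σ) = find (position C∋σ)
          (τ , τ∈ , p≋τ) = vertex⇒basis (All.lookup (vertices cell) p∈)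
      in ≡.subst (_∈ bases) (indicator-injective (≋-trans (≋-sym p≋τ) p≋σ)) τ∈

    cell-Hull : ∀ {C x} → Cell D C → ⟦ C ⟧ x → Hull (C ∋_) x
    cell-Hull {C} cell = ⟦⟧⇒Hull (All.tabulate λ p∈ →
      let (σ , _ , p≋σ) = vertex⇒basis (All.lookup (vertices cell) p∈)
      in σ , listed (Any.map (λ { ≡.refl → p≋σ }) p∈) , p≋σ)

    cell-∋ : ∀ {C σ} → Cell D C → ⟦ C ⟧ (indicator σ) → C ∋ σ
    cell-∋ {C} {σ} cell p = Hull-vertex {V = C ∋_} {σ = σ} (cell-Hull cell p)

    barycentre-∈ : ∀ {C : Polytope n} {ρ X} → All (C ∋_) (ρ ∷ X) → ⟦ C ⟧ (barycentre ρ X)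
    barycentre-∈ {C} {ρ} {X} ps = Hull⇒⟦⟧ {V = C ∋_} {C = C} (λ p → p) (barycentre-Hull ρ X ps)

    cellAt : ∀ ρ X → All (_∈ bases) (ρ ∷ X) → ∃[ C ] Cell D C × ⟦ C ⟧ (barycentre ρ X)
    cellAt ρ X ps = proj₁ union (Hull⇒⟦⟧-map (barycentre-Hull ρ X ps))

    Together : Subset n → Subset n → Set _
    Together σ τ = ∃[ C ] Cell D C × C ∋ σ × C ∋ τ

    -- The intersection of two cells is a face of each, and a face containing
    -- the midpoint of two vertices contains the vertices.
    closure : ∀ {C : Polytope n} {σ τ σ′ τ′} → Cell D C → C ∋ σ → C ∋ τ → Together σ′ τ′ → SameSum σ τ σ′ τ′ → C ∋ σ′ × C ∋ τ′
    closure {C} {σ} {τ} {σ′} {τ′} cell σ∈ τ∈ (C′ , cell′ , σ′∈ , τ′∈) s = conclude (proj₂ (intersection cell cell′))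
      where
      conclude : IsFaceOf (⟦ C ⟧ ∩ ⟦ C′ ⟧) ⟦ C′ ⟧ → C ∋ σ′ × C ∋ τ′
      conclude (a , b , valid , to , from) = pair (barycentre-face σ′ (τ′ ∷ []) a b
        (valid (∋⇒⟦⟧ {C = C′} {σ = σ′} σ′∈) ∷ valid (∋⇒⟦⟧ {C = C′} {σ = τ′} τ′∈) ∷ [])
        (proj₂ (to (⟦⟧-resp-≋ {C = C} (barycentre-cong s) (barycentre-∈ {C} (σ∈ ∷ τ∈ ∷ [])) , barycentre-∈ {C′} (σ′∈ ∷ τ′∈ ∷ [])))))
        where
        pair : All (λ ρ → dot a (indicator ρ) ≈ b) (σ′ ∷ τ′ ∷ []) → C ∋ σ′ × C ∋ τ′
        pair (p ∷ q ∷ []) = cell-∋ cell (proj₁ (from (∋⇒⟦⟧ {C = C′} {σ = σ′} σ′∈ , p))) ,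
                            cell-∋ cell (proj₁ (from (∋⇒⟦⟧ {C = C′} {σ = τ′} τ′∈ , q)))

    cell-face : ∀ {C} → Cell D C → ∀ a b → (∀ {ρ} → C ∋ ρ → dot a (indicator ρ) ≤ b) →
      ∃[ F ] Cell D F × (∀ {ρ} → F ∋ ρ → C ∋ ρ × dot a (indicator ρ) ≈ b) × (∀ {ρ} → C ∋ ρ → dot a (indicator ρ) ≈ b → F ∋ ρ)
    cell-face {C} cell a b valid =
      let (F , cellF , to , from) = faces cell {λ x → ⟦ C ⟧ x × dot a x ≈ b}
            (a , b , (λ p → Hull-valid a b valid (cell-Hull cell p)) , (λ p → p) , λ p → p)
      in F , cellF , (λ {ρ} F∋ρ → let (p , q) = to (∋⇒⟦⟧ {C = F} {σ = ρ} F∋ρ) in cell-∋ cell p , q) ,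
         λ {ρ} C∋ρ eq → cell-∋ cellF (from (∋⇒⟦⟧ {C = C} {σ = ρ} C∋ρ , eq))

    interval-face : ∀ {C σ τ} → Cell D C → C ∋ σ → C ∋ τ →
      ∃[ F ] Cell D F × F ∋ σ × F ∋ τ × (∀ {ρ} → F ∋ ρ → C ∋ ρ × T (between (σ ⋂ τ) (σ ∪ τ) ρ))
    interval-face {C} {σ} {τ} cell σ∈ τ∈ =
      let (F , cellF , to , from) = cell-face cell a (dot a (indicator σ)) (λ {ρ} _ → sum-mono-≤ (interval-≤ σ τ ρ))
      in F , cellF , from σ∈ refl , from τ∈ (sum-cong-≋ (interval-τ σ τ)) , λ {ρ} F∋ρ →
      let (C∋ρ , eq) = to F∋ρ
          inside = λ i → interval-inside σ τ ρ i (sum-tight (interval-≤ σ τ ρ) (≤-reflexive (sym eq)) i)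
      in C∋ρ , between⁺ (σ ⋂ τ) (σ ∪ τ) ρ
           (λ i p → proj₁ (inside i) (≡.trans (≡.sym (Vec.lookup-zipWith _∧_ i σ τ)) p))
           (λ i p → proj₂ (inside i) (≡.trans (≡.sym (Vec.lookup-zipWith _∨_ i σ τ)) p))
      where
      a : Point n
      a = intervalFunctional σ τ

    -- Here the edge condition on `D` is used: two coordinates of a multiple of e_a - e_b cannot
    -- account for three differences.
    edge-close : ∀ {C σ τ} → Cell D C → C ∋ σ → C ∋ τ → (∀ {ρ} → C ∋ ρ → ρ ≡ σ ⊎ ρ ≡ τ) → ¬ T (farApart σ τ)
    edge-close {C} {σ} {τ} cell σ∈ τ∈ only far =
      let (i , j , k , tj , tk , ti) = farApart⁻ σ τ far
          (i≢j , dj) = separates⁻ σ τ i j tj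
          (j≢k , dk) = separates⁻ σ τ j k tk
          (k≢i , di) = separates⁻ σ τ k i ti
          (a , b , _ , r , eq) = matroidal {C} cell {indicator σ} {indicator τ}
            (λ p → di (≡.cong (λ ρ → Vec.lookup ρ i) (indicator-injective {σ = σ} {τ = τ} p))) (to , from)
      in pigeonhole i≢j j≢k k≢i (endpoint {a} {b} r eq di) (endpoint {a} {b} r eq dj) (endpoint {a} {b} r eq dk)
      where
      to : ∀ {x} → ⟦ C ⟧ x → ⟦ indicator σ ∷ indicator τ ∷ [] ⟧ x
      to p = Hull⇒⟦⟧ {V = λ ρ → ρ ≡ σ ⊎ ρ ≡ τ} {C = indicator σ ∷ indicator τ ∷ []} (λ { (inj₁ ≡.refl) → listed (here λ _ → refl) ; (inj₂ ≡.refl) → listed (there (here λ _ → refl)) })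
        (Hull-map only (cell-Hull cell p))
      from : ∀ {x} → ⟦ indicator σ ∷ indicator τ ∷ [] ⟧ x → ⟦ C ⟧ x
      from p = Hull⇒⟦⟧ {V = C ∋_} (λ p → p) (⟦⟧⇒Hull {V = C ∋_} {C = indicator σ ∷ indicator τ ∷ []} ((σ , σ∈ , λ _ → refl) ∷ (τ , τ∈ , λ _ → refl) ∷ []) p)
      endpoint : ∀ {a b k} r → (∀ k → indicator σ k - indicator τ k ≈ r * (e a k - e b k)) →
                 Vec.lookup σ k ≢ Vec.lookup τ k → a ≡ k ⊎ b ≡ k
      endpoint {a} {b} {k} r eq d with a Fin.≟ k | b Fin.≟ k
      ... | yes p | _     = inj₁ p
      ... | no _  | yes p = inj₂ p
      ... | no p  | no q  = contradiction (bool-injective _ _ (trans (sym ([x-y]+y≈x _ _)) (trans (+-congʳ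
        (trans (eq k) (trans (*-congˡ (trans (+-cong (zeroAt p) (-‿cong (zeroAt q))) (-‿inverseʳ 0#))) (zeroʳ r)))) (+-identityˡ _)))) d
        where
        zeroAt : ∀ {a} → a ≢ k → e a k ≈ 0#
        zeroAt p = reflexive (≡.cong bit (lookup-⁅⁆ p))
      pigeonhole : ∀ {a b i j k : Fin n} → i ≢ j → j ≢ k → k ≢ i → a ≡ i ⊎ b ≡ i → a ≡ j ⊎ b ≡ j → ¬ (a ≡ k ⊎ b ≡ k)
      pigeonhole i≢j j≢k k≢i (inj₁ ≡.refl) (inj₁ q) _        = i≢j q
      pigeonhole i≢j j≢k k≢i (inj₁ ≡.refl) (inj₂ q) (inj₁ r) = k≢i (≡.sym r)
      pigeonhole i≢j j≢k k≢i (inj₁ ≡.refl) (inj₂ ≡.refl) (inj₂ r) = j≢k r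
      pigeonhole i≢j j≢k k≢i (inj₂ ≡.refl) (inj₂ q) _        = i≢j q
      pigeonhole i≢j j≢k k≢i (inj₂ ≡.refl) (inj₁ ≡.refl) (inj₁ r) = j≢k r
      pigeonhole i≢j j≢k k≢i (inj₂ ≡.refl) (inj₁ q) (inj₂ r) = k≢i (≡.sym r)

    isolated : ∀ {C σ τ} → Cell D C → C ∋ σ → C ∋ τ → T (farApart σ τ) → ∀ α β → ¬ C ∋ α → ¬ C ∋ β →
               ¬ T (isolates (List.filterᵇ (between (σ ⋂ τ) (σ ∪ τ)) bases) σ τ α β)
    isolated {C} {σ} {τ} cell σ∈ τ∈ far α β ∌α ∌β iso = inFace (interval-face cell σ∈ τ∈)
      where
      f : List (Subset n)
      f = α ∷ β ∷ []
      L : List (Subset n)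
      L = List.filterᵇ (between (σ ⋂ τ) (σ ∪ τ)) bases
      listing : ∀ {ρ} → C ∋ ρ × T (between (σ ⋂ τ) (σ ∪ τ) ρ) → ρ ∈ L
      listing (C∋ρ , btw) = ∈-filterᵇ⁺ (between (σ ⋂ τ) (σ ∪ τ)) (cell-basis cell C∋ρ) btw
      ∋⇒≢ : ∀ {ρ γ} → ¬ C ∋ γ → C ∋ ρ → ρ ≢ γ
      ∋⇒≢ ∌γ ∋ρ ≡.refl = ∌γ ∋ρ
      inFace : (∃[ F ] Cell D F × F ∋ σ × F ∋ τ × (∀ {ρ} → F ∋ ρ → C ∋ ρ × T (between (σ ⋂ τ) (σ ∪ τ) ρ))) → ⊥
      inFace (F , cellF , F∋σ , F∋τ , F⊆) = inEdge (cell-face cellF (functional f) (ι (weight f σ)) valid)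
        where
        valid : ∀ {ρ} → F ∋ ρ → dot (functional f) (indicator ρ) ≤ ι (weight f σ)
        valid {ρ} F∋ρ = ≤-respˡ-≈ (sym (dot-functional f ρ)) (ι-mono-≤
          (isolates-max L σ τ α β iso (listing (F⊆ F∋ρ)) (∋⇒≢ ∌α (proj₁ (F⊆ F∋ρ))) (∋⇒≢ ∌β (proj₁ (F⊆ F∋ρ)))))
        inEdge : (∃[ G ] Cell D G × (∀ {ρ} → G ∋ ρ → F ∋ ρ × dot (functional f) (indicator ρ) ≈ ι (weight f σ)) ×
                   (∀ {ρ} → F ∋ ρ → dot (functional f) (indicator ρ) ≈ ι (weight f σ) → G ∋ ρ)) → ⊥
        inEdge (G , cellG , G⊆ , ⊆G) = edge-close cellG (⊆G F∋σ (dot-functional f σ))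
          (⊆G F∋τ (trans (dot-functional f τ) (reflexive (≡.cong ι (≡.sym (isolates-≡ L σ τ α β iso))))))
          (λ {ρ} G∋ρ → isolates-only L σ τ α β iso (listing (F⊆ (proj₁ (G⊆ G∋ρ))))
            (∋⇒≢ ∌α (proj₁ (F⊆ (proj₁ (G⊆ G∋ρ))))) (∋⇒≢ ∌β (proj₁ (F⊆ (proj₁ (G⊆ G∋ρ)))))
            (ι-injective (trans (sym (dot-functional f ρ)) (proj₂ (G⊆ G∋ρ))))) far

    -- Otherwise σ and τ, at distance two, would span an edge of a cell.
    square : ∀ {C σ τ} → Cell D C → C ∋ σ → C ∋ τ → T (isSquare bases σ τ) →
             Any (λ (α , β) → C ∋ α × C ∋ β) (opposite σ τ)
    square {C} {σ} {τ} cell σ∈ τ∈ t = go (opposite σ τ) (proj₂ (T-∧⁻ {farApart σ τ} t))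
      where
      far = proj₁ (T-∧⁻ {farApart σ τ} t)
      L = List.filterᵇ (between (σ ⋂ τ) (σ ∪ τ)) bases
      go : ∀ O → T (isolatesAll L σ τ O) → Any (λ (α , β) → C ∋ α × C ∋ β) O
      go ((α , α′) ∷ (β , β′) ∷ []) t =
        let (t₁ , r₁) = T-∧⁻ {isolates L σ τ α β} t
            (t₂ , r₂) = T-∧⁻ {isolates L σ τ α β′} r₁
            (t₃ , t₄) = T-∧⁻ {isolates L σ τ α′ β} r₂
        in decide t₁ t₂ t₃ t₄ (C ∋? α) (C ∋? α′) (C ∋? β) (C ∋? β′)
        where
        out : ∀ α β → ¬ C ∋ α → ¬ C ∋ β → ¬ T (isolates L σ τ α β)
        out = isolated cell σ∈ τ∈ far
        decide : T (isolates L σ τ α β) → T (isolates L σ τ α β′) → T (isolates L σ τ α′ β) → T (isolates L σ τ α′ β′) →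
          Dec (C ∋ α) → Dec (C ∋ α′) → Dec (C ∋ β) → Dec (C ∋ β′) → Any (λ (α , β) → C ∋ α × C ∋ β) ((α , α′) ∷ (β , β′) ∷ [])
        decide t₁ t₂ t₃ t₄ (yes p) (yes p′) _       _        = here (p , p′)
        decide t₁ t₂ t₃ t₄ _       _        (yes q) (yes q′) = there (here (q , q′))
        decide t₁ t₂ t₃ t₄ (no p)  _        (no q)  _        = ⊥-elim (out α β p q t₁)
        decide t₁ t₂ t₃ t₄ (no p)  _        _       (no q′)  = ⊥-elim (out α β′ p q′ t₂)
        decide t₁ t₂ t₃ t₄ _       (no p′)  (no q)  _        = ⊥-elim (out α′ β p′ q t₃)
        decide t₁ t₂ t₃ t₄ _       (no p′)  _       (no q′)  = ⊥-elim (out α′ β′ p′ q′ t₄)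

-- Propagation of diagonals along parallel elements

∈⇒∈ᵇ : ∀ {σ : Subset n} {L} → σ ∈ L → T (σ ∈ᵇ L)
∈⇒∈ᵇ {σ = σ} σ∈ = Any.any⁺ (σ ==_) (Any.map (λ { ≡.refl → ==-refl σ }) σ∈)

not⁻ : ∀ {b} → T (not b) → ¬ T b
not⁻ {true} ()

Pair : ℕ → Set
Pair n = Subset n × Subset n

infix 4 _∈ᵖ_
_∈ᵖ_ : Pair n → List (Pair n) → Bool
(σ , τ) ∈ᵖ L = any (λ (α , β) → (σ == α) ∧ (τ == β) ∨ (σ == β) ∧ (τ == α)) L

∈ᵖ⁻ : ∀ {r} {R : Subset n → Subset n → Set r} → (∀ {α β} → R α β → R β α) →
      ∀ {L σ τ} → All (λ (α , β) → R α β) L → T ((σ , τ) ∈ᵖ L) → R σ τ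
∈ᵖ⁻ {R = R} R-sym {L} {σ} {τ} RL t with find (Any.any⁻ _ L t)
... | (α , β) , p∈ , t′ with T-∨⁻ {(σ == α) ∧ (τ == β)} t′
...   | inj₁ q rewrite ==⇒≡ σ α (proj₁ (T-∧⁻ q)) | ==⇒≡ τ β (proj₂ (T-∧⁻ {σ == α} q)) = All.lookup RL p∈
...   | inj₂ q rewrite ==⇒≡ σ β (proj₁ (T-∧⁻ q)) | ==⇒≡ τ α (proj₂ (T-∧⁻ {σ == β} q)) = R-sym (All.lookup RL p∈)

-- A lists candidates for the support of the barycentre of X.  Some support point
-- is at least as heavy as the average, so it lies in out.
picksAbove : ℕ → ℕ → List (Subset n) → List (Subset n) → List (Subset n) → Bool
picksAbove w k A F out = all (λ ρ → not (w ℕ.≤ᵇ k ℕ.* weight F ρ) ∨ (ρ ∈ᵇ out)) A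

picks : List (Subset n) → List (Subset n) → List (Subset n) → List (Subset n) → Bool
picks A X F = picksAbove (totalWeight X F) (List.length X) A F

picks⁻ : ∀ (A X F out : List (Subset n)) {ρ} → T (picks A X F out) → ρ ∈ A → totalWeight X F ℕ.≤ List.length X ℕ.* weight F ρ → ρ ∈ out
picks⁻ A X F out {ρ} t ρ∈ le = [ (λ q → contradiction (ℕ.≤⇒≤ᵇ le) (not⁻ q)) , ∈ᵇ⇒∈ ]′
  (T-∨⁻ (all-∈ (λ ρ → not (totalWeight X F ℕ.≤ᵇ List.length X ℕ.* weight F ρ) ∨ (ρ ∈ᵇ out)) t ρ∈))

-- An opposite pair with an end outside `A` cannot occur in a cell whose vertices lie in `A`, so
-- only the other opposite pairs have to meet `out`.
squareHits : List (Subset n) → List (Subset n) → (σ τ : Subset n) → List (Subset n) → Bool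
squareHits L A σ τ out = isSquare L σ τ ∧ all (λ (α , β) → not (α ∈ᵇ A) ∨ not (β ∈ᵇ A) ∨ (α ∈ᵇ out) ∨ (β ∈ᵇ out)) (opposite σ τ)

heavy : Subset n → List (Subset n) → List (Subset n)
heavy U = List.filterᵇ (λ ρ → 2 ℕ.≤ᵇ common U ρ)

leans : Subset n → List (Subset n) → Bool
leans U X = 2 ℕ.* List.length X ℕ.<ᵇ totalWeight X (U ∷ [])

-- Elements are toggled in `base`. In rank four a base of size two yields pairs added to it, and one
-- of size six yields pairs removed from it, so one record serves both a minor of rank two and its
-- dual.
record Move (n : ℕ) : Set where
  constructor move
  field
    side          : Subset n
    base          : Subset n
    a a′ b c d    : Fin n

module Nine (m : Move n) where
  open Move m
  _⊙_ : Fin n → Fin n → Subset n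
  x ⊙ y = x · y · base

  ab  = a ⊙ b
  ac  = a ⊙ c
  ad  = a ⊙ d
  a′b = a′ ⊙ b
  a′c = a′ ⊙ c
  a′d = a′ ⊙ d
  bc  = b ⊙ c
  bd  = b ⊙ d
  cd  = c ⊙ d
  aa′ = a ⊙ a′

  X : List (Subset n)
  X = ab ∷ a′b ∷ cd ∷ cd ∷ []

  support : List (Subset n) → List (Subset n)
  support A = List.filterᵇ (between (meet ab (a′b ∷ cd ∷ cd ∷ [])) (join ab (a′b ∷ cd ∷ cd ∷ []))) A

  -- Each functional takes at the barycentre of `X` a value that, among the candidates, only the
  -- listed sets reach. For `bc`, `bd`, `cd` over a base of size two it is 2(b + c + d) up to a
  -- constant: this is 3 at the barycentre, but at most 2 on any pair containing `a` or `a′`.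
  selections : List (List (Subset n) × List (Subset n))
  selections =
    (aa′ ∷ ab ∷ bd ∷ cd ∷ cd ∷ []  , ad ∷ bd ∷ cd ∷ []) ∷
    (aa′ ∷ ab ∷ bc ∷ cd ∷ cd ∷ []  , ac ∷ bc ∷ cd ∷ []) ∷
    (bc ∷ bd ∷ cd ∷ []             , bc ∷ bd ∷ cd ∷ []) ∷
    (ac ∷ ad ∷ cd ∷ []             , ac ∷ ad ∷ cd ∷ []) ∷
    (ab ∷ ad ∷ bd ∷ []             , ab ∷ ad ∷ bd ∷ []) ∷
    (ab ∷ ac ∷ bc ∷ []             , ab ∷ ac ∷ bc ∷ []) ∷
    (aa′ ∷ a′b ∷ cd ∷ []           , a′b ∷ a′c ∷ a′d ∷ []) ∷
    (aa′ ∷ a′b ∷ bc ∷ bd ∷ cd ∷ [] , a′b ∷ bc ∷ bd ∷ []) ∷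
    (aa′ ∷ ab ∷ cd ∷ []            , ab ∷ ac ∷ ad ∷ []) ∷ []

  selectable : List (Subset n) → Bool
  selectable S = all (λ (F , out) → picks S X F out) selections

  isParallel : List (Subset n) → Bool
  isParallel L = all (_∈ᵇ L) X ∧ leans side X ∧ sameSum ac bd ab cd ∧ sameSum ad bc ab cd ∧
    squareHits L (heavy side L) ab a′c (a′b ∷ []) ∧ squareHits L (heavy side L) ab a′d (a′b ∷ []) ∧
    selectable (support (heavy side L))

-- Opaque, since unfolding it on a long list of moves duplicates the argument known.
opaque
  grow : List (Subset n) → List (Move n) → List (Pair n) → List (Pair n)
  grow L []       known = known
  grow L (m ∷ ms) known =
    grow L ms (if ((ab , cd) ∈ᵖ known) ∧ isParallel L then (a′b , cd) ∷ known else known)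
    where open Nine m

module Linking {c ℓ₁ ℓ₂} (K : OrderedField c ℓ₁ ℓ₂) where
  open OrderedFieldProperties K
  open MatroidPolytopes K
  open PolytopeProperties K
  open RegularSubdivisions K
  open MatroidSubdivisions K
  open Heights K
  open Cells K

  module Links (M : Matroid n) (D : Subdivision (matroidPolytope M)) (matroidal : IsMatroidal D) where
    open Matroid M using (bases)
    open MatroidalSubdivision M D matroidal

    -- For `U` equal to `Q` or `S` this forbids vertices strictly on both sides of the gluing wall.
    -- It is all that the propagation of diagonals takes from the fact that `D` refines the glued
    -- subdivision.
    Uncrossed : Subset n → Set _
    Uncrossed U = ∀ {C : Polytope n} {σ τ : Subset n} → Cell D C → C ∋ σ → C ∋ τ → 2 ℕ.< common U σ → 2 ℕ.≤ common U τ

    pick : ∀ {C : Polytope n} A ρ X F out → Hull (λ σ → C ∋ σ × σ ∈ A) (barycentre ρ X) → T (picks A (ρ ∷ X) F out) → Any (C ∋_) out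
    pick A ρ X F out H t =
      let (σ , (C∋σ , σ∈) , le) = barycentre-above ρ X F H
      in lose (picks⁻ A (ρ ∷ X) F out t σ∈ le) C∋σ

    hits : ∀ {C A σ τ out} → Cell D C → (∀ {ρ} → C ∋ ρ → ρ ∈ A) → C ∋ σ → C ∋ τ → T (squareHits bases A σ τ out) → Any (C ∋_) out
    hits {C} {A} {σ} {τ} {out} cell ⊆A σ∈ τ∈ t =
      let (t₁ , t₂) = T-∧⁻ {isSquare bases σ τ} t
          ((α , β) , p∈ , (C∋α , C∋β)) = find (square cell σ∈ τ∈ t₁)
      in hit C∋α C∋β (all-∈ check t₂ p∈)
      where
      check : Pair n → Bool
      check (α , β) = not (α ∈ᵇ A) ∨ not (β ∈ᵇ A) ∨ (α ∈ᵇ out) ∨ (β ∈ᵇ out)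
      hit : ∀ {α β} → C ∋ α → C ∋ β → T (check (α , β)) → Any (C ∋_) out
      hit {α} {β} C∋α C∋β t =
        [ (λ q → contradiction (∈⇒∈ᵇ (⊆A C∋α)) (not⁻ q))
        , (λ t → [ (λ q → contradiction (∈⇒∈ᵇ (⊆A C∋β)) (not⁻ q))
                 , (λ t → [ (λ q → lose (∈ᵇ⇒∈ q) C∋α) , (λ q → lose (∈ᵇ⇒∈ q) C∋β) ]′ (T-∨⁻ {α ∈ᵇ out} t))
                 ]′ (T-∨⁻ {not (β ∈ᵇ A)} t))
        ]′ (T-∨⁻ {not (α ∈ᵇ A)} t)

    -- An average above 2 forces a vertex strictly beyond the wall, and then no vertex of the cell
    -- can lie strictly on the other side.
    leaning : ∀ {C U} ρ X → Uncrossed U → Cell D C → ⟦ C ⟧ (barycentre ρ X) → T (leans U (ρ ∷ X)) →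
              ∀ {σ} → C ∋ σ → σ ∈ heavy U bases
    leaning {C} {U} ρ X uncrossed cell x∈ t {σ} C∋σ =
      let (σ₀ , C∋σ₀ , le) = barycentre-above ρ X (U ∷ []) (cell-Hull cell x∈)
          lt = ℕ.*-cancelˡ-< (List.length (ρ ∷ X)) 2 (weight (U ∷ []) σ₀)
                 (ℕ.<-≤-trans (≡.subst (ℕ._< totalWeight (ρ ∷ X) (U ∷ [])) (ℕ.*-comm 2 (List.length (ρ ∷ X))) (ℕ.<ᵇ⇒< _ _ t)) le)
      in ∈-filterᵇ⁺ _ (cell-basis cell C∋σ)
           (ℕ.≤⇒≤ᵇ (uncrossed cell C∋σ₀ C∋σ (≡.subst (2 ℕ.<_) (ℕ.+-identityʳ (common U σ₀)) lt)))

    -- Here a, a′ are parallel in a minor of rank two on a, a′, b, c, d, or coparallel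
    -- in one of rank three.  The proof examines the cell containing the point
    -- (ab + a′b + 2 cd) / 4.
    parallel : ∀ m → Uncrossed (Move.side m) → T (Nine.isParallel m bases) → Together (Nine.ab m) (Nine.cd m) → Together (Nine.a′b m) (Nine.cd m)
    parallel m uncrossed t tog =
      let (t₁ , r₁) = T-∧⁻ {all (_∈ᵇ bases) X} t
          (t₂ , r₂) = T-∧⁻ {leans side X} r₁
          (t₃ , r₃) = T-∧⁻ {sameSum ac bd ab cd} r₂
          (t₄ , r₄) = T-∧⁻ {sameSum ad bc ab cd} r₃
          (t₅ , r₅) = T-∧⁻ {squareHits bases (heavy side bases) ab a′c (a′b ∷ [])} r₄
          (t₆ , t₇) = T-∧⁻ {squareHits bases (heavy side bases) ab a′d (a′b ∷ [])} r₅
          (C , cell , x∈) = cellAt ab (a′b ∷ cd ∷ cd ∷ []) (All.map ∈ᵇ⇒∈ (All.all⁺ (_∈ᵇ bases) X t₁))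
          (C∋cd , C∋a′b) = inCell C cell x∈ t₂ t₃ t₄ t₅ t₆ t₇
      in C , cell , C∋a′b , C∋cd
      where
      open Move m
      open Nine m
      inCell : ∀ C → Cell D C → ⟦ C ⟧ (barycentre ab (a′b ∷ cd ∷ cd ∷ [])) → T (leans side X) →
               T (sameSum ac bd ab cd) → T (sameSum ad bc ab cd) →
               T (squareHits bases (heavy side bases) ab a′c (a′b ∷ [])) → T (squareHits bases (heavy side bases) ab a′d (a′b ∷ [])) →
               T (selectable (support (heavy side bases))) → C ∋ cd × C ∋ a′b
      inCell C cell x∈ t₂ t₃ t₄ t₅ t₆ t₇ = analyse (All.map (λ {p} → select p) (All.all⁺ (λ (F , out) → picks (support (heavy side bases)) X F out) selections t₇))
        where
        inside-A : ∀ {σ} → C ∋ σ → σ ∈ heavy side bases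
        inside-A = leaning {C} {side} ab (a′b ∷ cd ∷ cd ∷ []) uncrossed cell x∈ t₂
        H : Hull (λ σ → C ∋ σ × σ ∈ support (heavy side bases)) (barycentre ab (a′b ∷ cd ∷ cd ∷ []))
        H = Hull-map (λ (C∋σ , btw) → C∋σ , ∈-filterᵇ⁺ _ (inside-A C∋σ) btw)
              (barycentre-between ab (a′b ∷ cd ∷ cd ∷ []) (cell-Hull cell x∈))
        select : ∀ (p : List (Subset n) × List (Subset n)) → T (picks (support (heavy side bases)) X (proj₁ p) (proj₂ p)) → Any (C ∋_) (proj₂ p)
        select (F , out) = pick {C} (support (heavy side bases)) ab (a′b ∷ cd ∷ cd ∷ []) F out H
        ac,bd : C ∋ ac → C ∋ bd → C ∋ ab × C ∋ cd
        ac,bd p q = closure cell p q tog (exchanged t₃)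
        ad,bc : C ∋ ad → C ∋ bc → C ∋ ab × C ∋ cd
        ad,bc p q = closure cell p q tog (exchanged t₄)
        single : ∀ {σ} → Any (C ∋_) (σ ∷ []) → C ∋ σ
        single (here p) = p
        analyse : All (λ p → Any (C ∋_) (proj₂ p)) selections → C ∋ cd × C ∋ a′b
        analyse (p₁ ∷ p₂ ∷ p₃ ∷ p₄ ∷ p₅ ∷ p₆ ∷ p₇ ∷ p₈ ∷ p₉ ∷ []) = first p₁ p₂ p₃ p₄ , second p₅ p₆ p₈ p₉
          where
          -- When `cd` is never selected, the selections leave `ad` and `bc`, or `ac` and `bd`, in
          -- the cell. Either pair has the midpoint of `ab` and `cd`, so `closure` applies.
          first : Any (C ∋_) (ad ∷ bd ∷ cd ∷ []) → Any (C ∋_) (ac ∷ bc ∷ cd ∷ []) →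
                  Any (C ∋_) (bc ∷ bd ∷ cd ∷ []) → Any (C ∋_) (ac ∷ ad ∷ cd ∷ []) → C ∋ cd
          first (there (there (here p))) _ _ _ = p
          first _ (there (there (here p))) _ _ = p
          first _ _ (there (there (here p))) _ = p
          first _ _ _ (there (there (here p))) = p
          first (here ad∈)         (there (here bc∈)) _ _ = proj₂ (ad,bc ad∈ bc∈)
          first (there (here bd∈)) (here ac∈)         _ _ = proj₂ (ac,bd ac∈ bd∈)
          first (here ad∈) (here ac∈) (here bc∈)         _ = proj₂ (ad,bc ad∈ bc∈)
          first (here ad∈) (here ac∈) (there (here bd∈)) _ = proj₂ (ac,bd ac∈ bd∈)
          first (there (here bd∈)) (there (here bc∈)) _ (here ac∈)         = proj₂ (ac,bd ac∈ bd∈)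
          first (there (here bd∈)) (there (here bc∈)) _ (there (here ad∈)) = proj₂ (ad,bc ad∈ bc∈)
          -- Some vertex of the cell uses `a′`. If it is `a′c` or `a′d`, the square it forms with
          -- `ab` offers one pair through `aa′` and one through `a′b`, and `t₅` or `t₆` has ruled
          -- out the former.
          from-ab : C ∋ ab → C ∋ a′b
          from-ab ab∈ = go p₇
            where
            go : Any (C ∋_) (a′b ∷ a′c ∷ a′d ∷ []) → C ∋ a′b
            go (here p)                 = p
            go (there (here p))         = single (hits cell inside-A ab∈ p t₅)
            go (there (there (here p))) = single (hits cell inside-A ab∈ p t₆)
          second : Any (C ∋_) (ab ∷ ad ∷ bd ∷ []) → Any (C ∋_) (ab ∷ ac ∷ bc ∷ []) →
                   Any (C ∋_) (a′b ∷ bc ∷ bd ∷ []) → Any (C ∋_) (ab ∷ ac ∷ ad ∷ []) → C ∋ a′b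
          second (here ab∈) _ _ _ = from-ab ab∈
          second _ (here ab∈) _ _ = from-ab ab∈
          second _ _ (here p) _ = p
          second _ _ _ (here ab∈) = from-ab ab∈
          second (there (here ad∈)) (there (there (here bc∈))) _ _ = from-ab (proj₁ (ad,bc ad∈ bc∈))
          second (there (there (here bd∈))) (there (here ac∈)) _ _ = from-ab (proj₁ (ac,bd ac∈ bd∈))
          second (there (here ad∈)) (there (here ac∈)) (there (here bc∈)) _         = from-ab (proj₁ (ad,bc ad∈ bc∈))
          second (there (here ad∈)) (there (here ac∈)) (there (there (here bd∈))) _ = from-ab (proj₁ (ac,bd ac∈ bd∈))
          second (there (there (here bd∈))) (there (there (here bc∈))) _ (there (here ac∈))         = from-ab (proj₁ (ac,bd ac∈ bd∈))
          second (there (there (here bd∈))) (there (there (here bc∈))) _ (there (there (here ad∈))) = from-ab (proj₁ (ad,bc ad∈ bc∈))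

    Together-sym : ∀ {σ τ} → Together σ τ → Together τ σ
    Together-sym (C , cell , p , q) = C , cell , q , p

    AllTogether : List (Pair n) → Set _
    AllTogether = All (λ (σ , τ) → Together σ τ)

    opaque
      unfolding grow

      grow-together : ∀ ms known → (∀ {m} → m ∈ ms → Uncrossed (Move.side m)) → AllTogether known → AllTogether (grow bases ms known)
      grow-together []       known uncrossed all = all
      grow-together (m ∷ ms) known uncrossed all = grow-together ms _ (λ m∈ → uncrossed (there m∈)) (extend _ ≡.refl)
        where
        open Nine m
        extend : ∀ b → b ≡ ((ab , cd) ∈ᵖ known) ∧ isParallel bases → AllTogether (if b then (a′b , cd) ∷ known else known)
        extend false _  = all
        extend true  eq = let (p , q) = T-∧⁻ {(ab , cd) ∈ᵖ known} (≡.subst T eq tt)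
                          in parallel m (uncrossed (here ≡.refl)) q (∈ᵖ⁻ {R = Together} Together-sym all p) ∷ all

-- Octahedra, and cells generated by the neighbours of a basis

isOctahedron : List (Subset n) → Pair n → Pair n → Pair n → Bool
isOctahedron L (σ₁ , τ₁) (σ₂ , τ₂) (σ₃ , τ₃) =
  (σ₁ ∈ᵇ L) ∧ (τ₁ ∈ᵇ L) ∧ go (List.filterᵇ (between (meet σ₁ (τ₁ ∷ [])) (join σ₁ (τ₁ ∷ []))) L)
  where
  go : List (Subset _) → Bool
  go A = all (λ α → all (λ β → all (λ γ → picks A (σ₁ ∷ τ₁ ∷ []) (α ∷ β ∷ γ ∷ []) (α ∷ β ∷ γ ∷ []))
           (σ₃ ∷ τ₃ ∷ [])) (σ₂ ∷ τ₂ ∷ [])) (σ₁ ∷ τ₁ ∷ [])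

-- rule σ τ ρ ρ′ infers that ρ lies in a cell containing σ and τ, where σ + τ = ρ + ρ′.
record Rule (n : ℕ) : Set where
  constructor rule
  field
    σ τ ρ ρ′ : Subset n

record Selection (n : ℕ) : Set where
  constructor selection
  field
    functional : Subset n
    outcomes   : List (Subset n)
    rules      : List (Rule n)

module Spanning (L : List (Subset n)) (known : List (Pair n)) (U : Subset n) where

  applies : List (Subset n) → Rule n → Bool
  applies have (rule σ τ ρ ρ′) = (σ ∈ᵇ have) ∧ (τ ∈ᵇ have) ∧
    ((((ρ , ρ′) ∈ᵖ known) ∧ sameSum σ τ ρ ρ′) ∨ squareHits L (heavy U L) σ τ (ρ ∷ []))

  derive : List (Rule n) → List (Subset n) → List (Subset n)
  derive []       have = have
  derive (r ∷ rs) have = derive rs (if applies have r then Rule.ρ r ∷ have else have)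

  -- A vertex above the average may be at distance two from `U` instead of being an outcome. As `U`
  -- is in the cell, the square on the two then supplies an outcome.
  picksNear : ℕ → ℕ → Subset n → List (Subset n) → Bool
  picksNear w k V out = all (λ ρ → not (w ℕ.≤ᵇ k ℕ.* weight (V ∷ []) ρ) ∨ (ρ ∈ᵇ out) ∨ squareHits L (heavy U L) U ρ out) (heavy U L)

  -- A functional yields only the disjunction that one of the outcomes is in the cell. Since each
  -- outcome must derive all the others, every branch ends with the same conclusion.
  succeeds : List (Subset n) → List (Subset n) → Selection n → Bool
  succeeds X have (selection V out rules) =
    picksNear (totalWeight X (V ∷ [])) (List.length X) V out ∧
    all (λ ρ → all (_∈ᵇ derive rules (ρ ∷ have)) out) out

  select : List (Subset n) → List (Selection n) → List (Subset n) → List (Subset n)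
  select X []       have = have
  select X (s ∷ ss) have = select X ss (if succeeds X have s then Selection.outcomes s List.++ have else have)

  spans : List (Subset n) → List (Selection n) → List (Rule n) → Bool
  -- The third test puts `U` itself into the cell: no other basis meets `U` in as many elements as
  -- the average over the points.
  spans X selections rules = all (_∈ᵇ L) (U ∷ X) ∧ leans U (U ∷ X) ∧ picks L (U ∷ X) (U ∷ []) (U ∷ []) ∧
    covers (derive rules (select (U ∷ X) selections (U ∷ [])))
    where
    covers : List (Subset n) → Bool
    covers have = all (_∈ᵇ have) (heavy U L)

module SpanningCells {c ℓ₁ ℓ₂} (K : OrderedField c ℓ₁ ℓ₂) where
  open OrderedFieldProperties K
  open MatroidPolytopes K
  open PolytopeProperties K
  open RegularSubdivisions K
  open MatroidSubdivisions K
  open Heights K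
  open Cells K
  open Linking K

  module _ (M : Matroid n) (D : Subdivision (matroidPolytope M)) (matroidal : IsMatroidal D) where
    open Matroid M using (bases)
    open MatroidalSubdivision M D matroidal
    open Links M D matroidal

    -- If each of the three diagonals had an endpoint outside the cell containing the
    -- centre, then the centre would be too heavy for those three endpoints.
    octahedron : ∀ p₁ p₂ p₃ → T (isOctahedron bases p₁ p₂ p₃) →
      Together (proj₁ p₁) (proj₂ p₁) ⊎ Together (proj₁ p₂) (proj₂ p₂) ⊎ Together (proj₁ p₃) (proj₂ p₃)
    octahedron (σ₁ , τ₁) (σ₂ , τ₂) (σ₃ , τ₃) t =
      let (t₁ , r₁) = T-∧⁻ {σ₁ ∈ᵇ bases} t
          (t₂ , t₃) = T-∧⁻ {τ₁ ∈ᵇ bases} r₁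
          (C , cell , x∈) = cellAt σ₁ (τ₁ ∷ []) (∈ᵇ⇒∈ t₁ ∷ ∈ᵇ⇒∈ t₂ ∷ [])
      in inCell C cell x∈ t₃
      where
      A : List (Subset n)
      A = List.filterᵇ (between (meet σ₁ (τ₁ ∷ [])) (join σ₁ (τ₁ ∷ []))) bases
      inCell : ∀ C → Cell D C → ⟦ C ⟧ (barycentre σ₁ (τ₁ ∷ [])) →
        T (all (λ α → all (λ β → all (λ γ → picks A (σ₁ ∷ τ₁ ∷ []) (α ∷ β ∷ γ ∷ []) (α ∷ β ∷ γ ∷ []))
             (σ₃ ∷ τ₃ ∷ [])) (σ₂ ∷ τ₂ ∷ [])) (σ₁ ∷ τ₁ ∷ [])) →
        Together σ₁ τ₁ ⊎ Together σ₂ τ₂ ⊎ Together σ₃ τ₃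
      inCell C cell x∈ t = combine (both σ₁ τ₁ (C ∋? σ₁) (C ∋? τ₁)) (both σ₂ τ₂ (C ∋? σ₂) (C ∋? τ₂)) (both σ₃ τ₃ (C ∋? σ₃) (C ∋? τ₃))
        where
        Missing : Subset n → Subset n → Set _
        Missing σ τ = ∃[ α ] α ∈ σ ∷ τ ∷ [] × ¬ C ∋ α
        both : ∀ σ τ → Dec (C ∋ σ) → Dec (C ∋ τ) → Together σ τ ⊎ Missing σ τ
        both σ τ (yes p) (yes q) = inj₁ (C , cell , p , q)
        both σ τ (no p)  _       = inj₂ (σ , here ≡.refl , p)
        both σ τ _       (no q)  = inj₂ (τ , there (here ≡.refl) , q)
        H : Hull (λ σ → C ∋ σ × σ ∈ A) (barycentre σ₁ (τ₁ ∷ []))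
        H = Hull-map (λ (C∋σ , btw) → C∋σ , ∈-filterᵇ⁺ _ (cell-basis cell C∋σ) btw)
              (barycentre-between σ₁ (τ₁ ∷ []) (cell-Hull cell x∈))
        impossible : ∀ {α β γ} → ¬ C ∋ α → ¬ C ∋ β → ¬ C ∋ γ → ¬ Any (C ∋_) (α ∷ β ∷ γ ∷ [])
        impossible p q r (here a)                 = p a
        impossible p q r (there (here a))         = q a
        impossible p q r (there (there (here a))) = r a
        combine : Together σ₁ τ₁ ⊎ Missing σ₁ τ₁ → Together σ₂ τ₂ ⊎ Missing σ₂ τ₂ → Together σ₃ τ₃ ⊎ Missing σ₃ τ₃ →
                  Together σ₁ τ₁ ⊎ Together σ₂ τ₂ ⊎ Together σ₃ τ₃
        combine (inj₁ p) _        _        = inj₁ p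
        combine _        (inj₁ p) _        = inj₂ (inj₁ p)
        combine _        _        (inj₁ p) = inj₂ (inj₂ p)
        combine (inj₂ (α , α∈ , ∌α)) (inj₂ (β , β∈ , ∌β)) (inj₂ (γ , γ∈ , ∌γ)) =
          ⊥-elim (impossible ∌α ∌β ∌γ (pick A σ₁ (τ₁ ∷ []) (α ∷ β ∷ γ ∷ []) (α ∷ β ∷ γ ∷ []) H
            (all-∈ (λ γ → picks A (σ₁ ∷ τ₁ ∷ []) (α ∷ β ∷ γ ∷ []) (α ∷ β ∷ γ ∷ []))
              (all-∈ (λ β → all (λ γ → picks A (σ₁ ∷ τ₁ ∷ []) (α ∷ β ∷ γ ∷ []) (α ∷ β ∷ γ ∷ [])) (σ₃ ∷ τ₃ ∷ []))
                (all-∈ (λ α → all (λ β → all (λ γ → picks A (σ₁ ∷ τ₁ ∷ []) (α ∷ β ∷ γ ∷ []) (α ∷ β ∷ γ ∷ [])) (σ₃ ∷ τ₃ ∷ [])) (σ₂ ∷ τ₂ ∷ []))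
                  t α∈) β∈) γ∈)))

    module _ (known : List (Pair n)) (together : AllTogether known) (U : Subset n) (uncrossed : Uncrossed U) where
      open Spanning bases known U

      private
        module InCell (C : Polytope n) (cell : Cell D C) (light : ∀ {σ} → C ∋ σ → σ ∈ heavy U bases) where

          Has : List (Subset n) → Set _
          Has = All (C ∋_)

          has-∈ᵇ : ∀ {have σ} → Has have → T (σ ∈ᵇ have) → C ∋ σ
          has-∈ᵇ H t = All.lookup H (∈ᵇ⇒∈ t)

          single : ∀ {σ} → Any (C ∋_) (σ ∷ []) → C ∋ σ
          single (here p) = p

          applies-sound : ∀ have r → Has have → T (applies have r) → C ∋ Rule.ρ r
          applies-sound have (rule σ τ ρ ρ′) H t =
            let (t₁ , r₁) = T-∧⁻ {σ ∈ᵇ have} t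
                (t₂ , t₃) = T-∧⁻ {τ ∈ᵇ have} r₁
            in [ (λ q → let (q₁ , q₂) = T-∧⁻ {(ρ , ρ′) ∈ᵖ known} q
                        in proj₁ (closure {C} {σ} {τ} {ρ} {ρ′} cell (has-∈ᵇ H t₁) (has-∈ᵇ H t₂) (∈ᵖ⁻ {R = Together} Together-sym together q₁) (exchanged q₂)))
               , (λ q → single (hits {C} {heavy U bases} {σ} {τ} cell light (has-∈ᵇ H t₁) (has-∈ᵇ H t₂) q))
               ]′ (T-∨⁻ {((ρ , ρ′) ∈ᵖ known) ∧ sameSum σ τ ρ ρ′} t₃)

          derive-sound : ∀ rs have → Has have → Has (derive rs have)
          derive-sound []       have H = H
          derive-sound (r ∷ rs) have H = derive-sound rs _ (extend _ ≡.refl)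
            where
            extend : ∀ b → b ≡ applies have r → Has (if b then Rule.ρ r ∷ have else have)
            extend false _  = H
            extend true  eq = applies-sound have r H (≡.subst T eq tt) ∷ H

          succeeds-sound : ∀ ρ X have s → ⟦ C ⟧ (barycentre ρ X) → C ∋ U → Has have → T (succeeds (ρ ∷ X) have s) → Has (Selection.outcomes s)
          succeeds-sound ρ X have (selection V out rules) x∈ C∋U H t =
            let (t₁ , t₂) = T-∧⁻ {picksNear (totalWeight (ρ ∷ X) (V ∷ [])) (List.length (ρ ∷ X)) V out} t
                (σ , C∋σ , le) = barycentre-above ρ X (V ∷ []) (cell-Hull cell x∈)
                (o , o∈ , C∋o) = find (chosen σ C∋σ le (all-∈ check t₁ (light C∋σ)))
            in All.map (has-∈ᵇ (derive-sound rules (o ∷ have) (C∋o ∷ H)))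
                 (All.all⁺ (_∈ᵇ derive rules (o ∷ have)) out (all-∈ (λ o → all (_∈ᵇ derive rules (o ∷ have)) out) t₂ o∈))
            where
            w k : ℕ
            w = totalWeight (ρ ∷ X) (V ∷ [])
            k = List.length (ρ ∷ X)
            check : Subset n → Bool
            check σ = not (w ℕ.≤ᵇ k ℕ.* weight (V ∷ []) σ) ∨ (σ ∈ᵇ out) ∨ squareHits bases (heavy U bases) U σ out
            chosen : ∀ σ → C ∋ σ → w ℕ.≤ k ℕ.* weight (V ∷ []) σ → T (check σ) → Any (C ∋_) out
            chosen σ C∋σ le t =
              [ (λ q → contradiction (ℕ.≤⇒≤ᵇ le) (not⁻ q))
              , (λ q → [ (λ q → lose (∈ᵇ⇒∈ q) C∋σ) , hits cell light C∋U C∋σ ]′ (T-∨⁻ {σ ∈ᵇ out} q))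
              ]′ (T-∨⁻ {not (w ℕ.≤ᵇ k ℕ.* weight (V ∷ []) σ)} t)

          select-sound : ∀ ρ X ss have → ⟦ C ⟧ (barycentre ρ X) → C ∋ U → Has have → Has (select (ρ ∷ X) ss have)
          select-sound ρ X []       have x∈ C∋U H = H
          select-sound ρ X (s ∷ ss) have x∈ C∋U H = select-sound ρ X ss _ x∈ C∋U (extend _ ≡.refl)
            where
            extend : ∀ b → b ≡ succeeds (ρ ∷ X) have s → Has (if b then Selection.outcomes s List.++ have else have)
            extend false _  = H
            extend true  eq = All.++⁺ (succeeds-sound ρ X have s x∈ C∋U H (≡.subst T eq tt)) H

      spans-sound : ∀ X ss rs → T (spans X ss rs) → ∃[ C ] Cell D C × (∀ {ρ} → ρ ∈ heavy U bases → C ∋ ρ)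
      spans-sound X ss rs t =
        let (t₁ , r₁) = T-∧⁻ {all (_∈ᵇ bases) (U ∷ X)} t
            (t₂ , r₂) = T-∧⁻ {leans U (U ∷ X)} r₁
            (t₃ , t₄) = T-∧⁻ {picks bases (U ∷ X) (U ∷ []) (U ∷ [])} r₂
            (C , cell , x∈) = cellAt U X (All.map ∈ᵇ⇒∈ (All.all⁺ (_∈ᵇ bases) (U ∷ X) t₁))
        in C , cell , inCell C cell x∈ t₂ t₃ t₄
        where
        inCell : ∀ C → Cell D C → ⟦ C ⟧ (barycentre U X) → T (leans U (U ∷ X)) → T (picks bases (U ∷ X) (U ∷ []) (U ∷ [])) →
          T (all (_∈ᵇ derive rs (select (U ∷ X) ss (U ∷ []))) (heavy U bases)) → ∀ {ρ} → ρ ∈ heavy U bases → C ∋ ρ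
        inCell C cell x∈ t₂ t₃ t₄ ρ∈ =
          has-∈ᵇ (derive-sound rs _ (select-sound U X ss (U ∷ []) x∈ C∋U (C∋U ∷ []))) (all-∈ _ t₄ ρ∈)
          where
          open InCell C cell (leaning {C} {U} U X uncrossed cell x∈ t₂)
          C∋U : C ∋ U
          C∋U = single (pick bases U X (U ∷ []) (U ∷ [])
            (Hull-map (λ C∋σ → C∋σ , cell-basis cell C∋σ) (cell-Hull cell x∈)) t₃)

-- The example

pattern s₁ = 0F
pattern s₂ = 1F
pattern s₃ = 2F
pattern s₄ = 3F
pattern q₁ = 4F
pattern q₂ = 5F
pattern q₃ = 6F
pattern q₄ = 7F

∅ : Subset 8
∅ = Subset.⊥

S : Subset 8
S = true ∷ true ∷ true ∷ true ∷ false ∷ false ∷ false ∷ false ∷ []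

-- The nonbases of size four are the sets q_i q_j q_k s_l and s_i s_j s_k q_π(l)
-- with {i, j, k, l} = {1, 2, 3, 4}, where π is the cycle 2 ↦ 3 ↦ 4 ↦ 2.
circuitHyperplane : ℕ → Subset 8 → Bool
circuitHyperplane 1 (a ∷ b ∷ c ∷ d ∷ w ∷ x ∷ y ∷ z ∷ []) = (a xor w) ∧ (b xor x) ∧ (c xor y) ∧ (d xor z)
circuitHyperplane 3 (a ∷ b ∷ c ∷ d ∷ w ∷ x ∷ y ∷ z ∷ []) = (a xor w) ∧ (b xor y) ∧ (c xor z) ∧ (d xor x)
circuitHyperplane _ _ = false

basisM basisN : Subset 8 → Bool
basisM σ = (common σ σ ℕ.≡ᵇ 4) ∧ not (circuitHyperplane (common S σ) σ)
basisN σ = basisM σ ∧ (common S σ ℕ.≤ᵇ 2)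

-- N is represented by (I | A) for a generic skew matrix A of rank two, whose minors are
-- products of the Plücker coordinates p of its row space; heightN is their valuation
-- when p₁₂ has valuation one and the other coordinates are units.
heightM heightN : Subset 8 → ℕ
heightM σ = common S σ ℕ.∸ 2
heightN σ = (common (s₁ · s₂ · ∅) σ ℕ.∸ 1) ℕ.⊔ (1 ℕ.∸ common (q₁ · q₂ · ∅) σ) ℕ.⊔ (common (s₁ · s₂ · q₃ · q₄ · ∅) σ ℕ.∸ 2)

Q : Subset 8
Q = false ∷ false ∷ false ∷ false ∷ true ∷ true ∷ true ∷ true ∷ []
-- A breadth-first search in the graph whose edges are the applicable moves found these
-- lists: the first leads from two diagonals of an octahedron to the third, the second
-- from the latter to all diagonals of the octahedra at Q in N and at S in its counterpart.
preliminaryMoves : List (Move 8)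
preliminaryMoves =
  move S (s₂ · s₃ · ∅) s₄ q₁ q₄ s₁ q₃ ∷
  move S (s₂ · s₃ · ∅) s₁ q₂ q₃ q₁ q₄ ∷
  move Q (s₂ · s₃ · q₁ · q₂ · q₃ · q₄ · ∅) q₃ s₂ q₂ q₁ q₄ ∷
  move Q (s₂ · s₃ · q₁ · q₂ · q₃ · q₄ · ∅) q₂ s₃ s₂ q₁ q₄ ∷
  move Q (q₂ · q₃ · ∅) q₄ s₁ q₁ s₂ s₃ ∷
  move Q (q₂ · q₃ · ∅) q₁ s₄ s₁ s₂ s₃ ∷
  move S (s₁ · s₂ · s₃ · s₄ · q₂ · q₃ · ∅) s₂ q₂ s₃ s₁ s₄ ∷
  move S (s₂ · q₃ · ∅) q₂ q₄ s₃ s₁ s₄ ∷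
  move S (s₁ · s₂ · s₃ · s₄ · q₃ · q₄ · ∅) s₃ q₃ q₄ s₁ s₄ ∷
  move S (s₁ · s₂ · s₃ · s₄ · q₃ · q₄ · ∅) q₄ s₂ s₁ s₄ q₃ ∷
  move S (s₁ · s₂ · s₃ · s₄ · q₃ · q₄ · ∅) q₃ s₃ s₄ s₁ s₂ ∷
  move Q (q₃ · q₄ · ∅) s₂ q₁ s₁ s₃ s₄ ∷
  move Q (q₃ · q₄ · ∅) s₁ q₂ q₁ s₃ s₄ ∷
  move Q (s₃ · s₄ · q₁ · q₂ · q₃ · q₄ · ∅) s₄ q₃ s₃ q₁ q₂ ∷
  move Q (s₃ · s₄ · q₁ · q₂ · q₃ · q₄ · ∅) s₃ q₄ q₃ q₁ q₂ ∷
  move S (s₃ · s₄ · ∅) q₁ s₂ q₂ q₃ q₄ ∷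
  move S (s₂ · s₃ · s₄ · q₂ · q₃ · q₄ · ∅) s₂ s₄ q₂ q₃ q₄ ∷
  move S (s₂ · s₃ · ∅) q₂ s₁ s₄ q₃ q₄ ∷
  []

moves : List (Move 8)
moves =
  move S (s₁ · s₂ · s₃ · s₄ · q₃ · q₄ · ∅) q₄ s₂ q₃ s₁ s₄ ∷
  move S (s₃ · q₄ · ∅) q₃ q₂ s₂ s₁ s₄ ∷
  move S (s₁ · s₂ · s₃ · s₄ · q₂ · q₄ · ∅) s₄ q₄ s₁ s₂ q₂ ∷
  move S (s₃ · q₄ · ∅) q₃ q₁ s₂ s₁ s₄ ∷
  move S (s₁ · s₂ · s₃ · s₄ · q₁ · q₄ · ∅) s₁ q₄ s₄ s₂ q₁ ∷
  move S (s₁ · s₂ · s₃ · s₄ · q₃ · q₄ · ∅) q₃ s₃ q₄ s₁ s₄ ∷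
  move S (s₂ · q₃ · ∅) q₄ q₂ s₃ s₁ s₄ ∷
  move S (s₁ · s₂ · s₃ · s₄ · q₂ · q₃ · ∅) s₄ q₃ s₁ s₃ q₂ ∷
  move S (s₂ · q₃ · ∅) q₄ q₁ s₃ s₁ s₄ ∷
  move S (s₁ · s₂ · s₃ · s₄ · q₁ · q₃ · ∅) s₁ q₃ s₄ s₃ q₁ ∷
  move S (s₁ · s₂ · s₃ · s₄ · q₃ · q₄ · ∅) q₃ s₃ s₂ s₁ s₄ ∷
  move Q (q₃ · q₄ · ∅) s₁ q₂ s₄ s₂ s₃ ∷
  move Q (q₃ · q₄ · ∅) s₂ q₁ s₃ s₄ q₂ ∷
  move Q (s₂ · s₃ · s₄ · q₂ · q₃ · q₄ · ∅) q₂ q₃ s₄ s₂ s₃ ∷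
  move Q (q₂ · q₄ · ∅) s₃ q₁ s₂ s₄ q₃ ∷
  move Q (s₂ · s₃ · s₄ · q₂ · q₃ · q₄ · ∅) q₂ q₄ s₄ s₂ s₃ ∷
  move Q (q₂ · q₃ · ∅) s₄ q₁ q₄ s₂ s₃ ∷
  move S (s₃ · s₄ · ∅) s₂ q₁ q₂ s₁ q₄ ∷
  move S (s₁ · s₃ · s₄ · q₁ · q₂ · q₄ · ∅) s₁ s₃ q₄ q₁ q₂ ∷
  move S (s₁ · s₄ · ∅) q₄ s₂ s₃ q₁ q₂ ∷
  move S (s₁ · s₂ · s₃ · s₄ · q₁ · q₄ · ∅) q₁ s₃ s₂ s₁ s₄ ∷
  move Q (q₁ · q₄ · ∅) s₂ q₃ s₃ s₁ s₄ ∷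
  move Q (q₁ · q₄ · ∅) s₃ q₂ q₃ s₁ s₄ ∷
  move Q (s₁ · s₃ · s₄ · q₁ · q₃ · q₄ · ∅) q₃ q₄ s₃ s₁ s₄ ∷
  move Q (q₁ · q₃ · ∅) s₄ q₂ s₁ s₃ q₄ ∷
  move Q (q₂ · q₄ · ∅) q₃ s₁ s₄ s₂ q₁ ∷
  move Q (s₁ · s₂ · s₄ · q₁ · q₂ · q₄ · ∅) q₁ q₄ s₂ s₁ s₄ ∷
  move Q (q₁ · q₂ · ∅) s₄ q₃ s₁ s₂ q₄ ∷
  move S (s₃ · s₄ · ∅) s₁ q₃ q₄ q₁ q₂ ∷
  move Q (s₃ · s₄ · q₁ · q₂ · q₃ · q₄ · ∅) q₄ s₃ q₃ q₁ q₂ ∷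
  move Q (s₃ · s₄ · q₁ · q₂ · q₃ · q₄ · ∅) q₃ s₄ s₃ q₁ q₂ ∷
  move Q (s₄ · q₄ · ∅) s₃ s₂ q₃ q₁ q₂ ∷
  move Q (s₂ · s₄ · q₁ · q₂ · q₃ · q₄ · ∅) q₂ s₄ q₁ s₂ q₃ ∷
  move Q (s₄ · q₄ · ∅) s₃ s₁ q₃ q₁ q₂ ∷
  move Q (s₁ · s₄ · q₁ · q₂ · q₃ · q₄ · ∅) q₁ s₄ q₂ s₁ q₃ ∷
  move Q (s₃ · s₄ · q₁ · q₂ · q₃ · q₄ · ∅) q₃ s₄ q₄ q₁ q₂ ∷
  move Q (s₃ · q₃ · ∅) s₄ s₂ q₄ q₁ q₂ ∷
  move Q (s₂ · s₃ · q₁ · q₂ · q₃ · q₄ · ∅) q₂ s₃ q₁ s₂ q₄ ∷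
  move Q (s₃ · q₃ · ∅) s₄ s₁ q₄ q₁ q₂ ∷
  move Q (s₁ · s₃ · q₁ · q₂ · q₃ · q₄ · ∅) q₁ s₃ q₂ s₁ q₄ ∷
  move Q (q₂ · q₄ · ∅) q₃ s₁ s₂ s₄ q₁ ∷
  move Q (s₁ · s₂ · s₄ · q₁ · q₂ · q₄ · ∅) q₁ q₄ s₄ s₁ s₂ ∷
  move Q (q₁ · q₂ · ∅) s₄ q₃ q₄ s₁ s₂ ∷
  move Q (q₂ · q₄ · ∅) q₁ s₃ s₄ s₁ s₂ ∷
  move S (s₁ · s₂ · s₃ · s₄ · q₂ · q₄ · ∅) s₄ q₄ s₃ s₁ s₂ ∷
  move S (s₁ · s₂ · s₃ · s₄ · q₂ · q₄ · ∅) s₃ q₂ q₄ s₁ s₂ ∷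
  move S (s₄ · q₂ · ∅) q₄ q₃ s₃ s₁ s₂ ∷
  move S (s₁ · s₂ · s₃ · s₄ · q₂ · q₃ · ∅) s₂ q₂ s₁ s₃ q₃ ∷
  move S (s₄ · q₂ · ∅) q₄ q₁ s₃ s₁ s₂ ∷
  move S (s₁ · s₂ · s₃ · s₄ · q₁ · q₂ · ∅) s₁ q₂ s₂ s₃ q₁ ∷
  move S (s₁ · s₂ · s₃ · s₄ · q₂ · q₄ · ∅) s₃ q₂ s₄ s₁ s₂ ∷
  move S (s₃ · q₄ · ∅) q₂ q₁ s₄ s₁ s₂ ∷
  move S (s₁ · s₂ · s₃ · s₄ · q₁ · q₄ · ∅) s₁ q₄ s₂ s₄ q₁ ∷
  move S (s₃ · q₄ · ∅) q₂ q₃ s₄ s₁ s₂ ∷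
  move S (s₁ · s₂ · s₃ · s₄ · q₃ · q₄ · ∅) s₂ q₄ s₁ s₄ q₃ ∷
  move S (s₂ · s₄ · ∅) s₃ q₁ q₃ s₁ q₂ ∷
  move S (s₁ · s₂ · s₄ · q₁ · q₂ · q₃ · ∅) s₁ s₄ q₂ q₁ q₃ ∷
  move S (s₁ · s₂ · ∅) q₂ s₃ s₄ q₁ q₃ ∷
  move S (s₂ · s₄ · ∅) s₁ q₄ q₂ q₁ q₃ ∷
  move Q (s₂ · s₄ · q₁ · q₂ · q₃ · q₄ · ∅) q₂ s₄ q₄ q₁ q₃ ∷
  move Q (s₂ · s₄ · q₁ · q₂ · q₃ · q₄ · ∅) q₄ s₂ s₄ q₁ q₃ ∷
  move Q (s₂ · q₂ · ∅) s₄ s₁ q₄ q₁ q₃ ∷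
  move Q (s₁ · s₂ · q₁ · q₂ · q₃ · q₄ · ∅) q₁ s₂ q₃ s₁ q₄ ∷
  move Q (s₂ · q₂ · ∅) s₄ s₃ q₄ q₁ q₃ ∷
  move Q (s₂ · s₃ · q₁ · q₂ · q₃ · q₄ · ∅) q₃ s₂ q₁ s₃ q₄ ∷
  move Q (s₂ · s₄ · q₁ · q₂ · q₃ · q₄ · ∅) q₄ s₂ q₂ q₁ q₃ ∷
  move Q (s₄ · q₄ · ∅) s₂ s₃ q₂ q₁ q₃ ∷
  move Q (s₃ · s₄ · q₁ · q₂ · q₃ · q₄ · ∅) q₃ s₄ q₁ s₃ q₂ ∷
  move Q (s₄ · q₄ · ∅) s₂ s₁ q₂ q₁ q₃ ∷
  move Q (s₁ · s₄ · q₁ · q₂ · q₃ · q₄ · ∅) q₁ s₄ q₃ s₁ q₂ ∷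
  move Q (q₁ · q₂ · ∅) q₄ s₃ s₁ s₂ q₃ ∷
  move Q (s₁ · s₂ · s₃ · q₁ · q₂ · q₃ · ∅) q₃ q₂ s₂ s₁ s₃ ∷
  move Q (q₁ · q₃ · ∅) s₂ q₄ q₂ s₁ s₃ ∷
  move Q (q₁ · q₂ · ∅) q₃ s₄ s₂ s₁ s₃ ∷
  move S (s₁ · s₂ · s₃ · s₄ · q₁ · q₂ · ∅) s₁ q₂ s₃ s₂ s₄ ∷
  move S (s₁ · s₂ · s₃ · s₄ · q₁ · q₂ · ∅) s₄ q₁ s₂ s₃ q₂ ∷
  move S (s₁ · q₁ · ∅) q₂ q₃ s₃ s₂ s₄ ∷
  move S (s₁ · s₂ · s₃ · s₄ · q₁ · q₃ · ∅) s₂ q₁ s₄ s₃ q₃ ∷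
  move S (s₁ · q₁ · ∅) q₂ q₄ s₃ s₂ s₄ ∷
  move S (s₁ · s₂ · s₃ · s₄ · q₁ · q₄ · ∅) s₃ q₁ q₄ s₂ s₄ ∷
  move S (s₁ · s₂ · s₃ · s₄ · q₁ · q₂ · ∅) s₄ q₁ s₂ s₁ s₃ ∷
  move S (s₄ · q₂ · ∅) q₁ q₃ s₂ s₁ s₃ ∷
  move S (s₁ · s₂ · s₃ · s₄ · q₂ · q₃ · ∅) s₂ q₂ q₃ s₁ s₃ ∷
  move S (s₄ · q₂ · ∅) q₁ q₄ s₂ s₁ s₃ ∷
  move S (s₁ · s₂ · s₃ · s₄ · q₂ · q₄ · ∅) s₃ q₂ s₁ s₂ q₄ ∷
  move S (s₁ · s₂ · ∅) s₄ q₄ q₁ s₃ q₃ ∷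
  move S (s₁ · s₂ · s₃ · q₁ · q₃ · q₄ · ∅) s₃ s₁ q₃ q₁ q₄ ∷
  move S (s₂ · s₃ · ∅) q₁ s₄ q₄ s₁ q₃ ∷
  []

-- The neighbours of the basis U are the sets U - u k + v l with k ≠ l.
module Star (U : Subset 8) (u v : Fin 4 → Fin 8) where

  edge : Fin 4 → Fin 4 → Subset 8
  edge k l = u k · v l · U

  cross : Fin 4 → Fin 4 → Fin 4 → Fin 4 → Rule 8
  cross k l k′ l′ = rule (edge k l) (edge k′ l′) (edge k′ l) (edge k l′)

  -- Apart from U these are the edges of a flow with supplies 10, 2, 2, 2 at the u k
  -- and demands 1, 5, 5, 5 at the v l.  In each selection below the demands of the
  -- v l exceed the supplies of the u k, so some other u k must serve one of the v l.
  points : List (Subset 8)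
  points = List.replicate 16 U List.++ List.replicate 3 (edge 0F 1F) List.++ List.replicate 3 (edge 0F 2F) List.++
    List.replicate 4 (edge 0F 3F) List.++
    edge 1F 0F ∷ edge 1F 2F ∷ edge 2F 1F ∷ edge 2F 3F ∷ edge 3F 1F ∷ edge 3F 2F ∷ []

  selections : List (Selection 8)
  selections =
    selection (v 1F · u 2F · u 3F · ∅) (edge 0F 1F ∷ []) [] ∷
    selection (v 2F · u 1F · u 3F · ∅) (edge 0F 2F ∷ []) [] ∷
    selection (v 3F · u 1F · u 2F · ∅) (edge 0F 3F ∷ []) [] ∷
    selection (v 1F · v 2F · v 3F · u 0F · u 2F · u 3F · ∅) (edge 1F 2F ∷ edge 1F 3F ∷ [])
      (cross 0F 3F 1F 2F ∷ cross 0F 2F 1F 3F ∷ []) ∷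
    selection (v 1F · v 2F · v 3F · u 0F · u 1F · u 3F · ∅) (edge 2F 1F ∷ edge 2F 3F ∷ [])
      (cross 0F 3F 2F 1F ∷ cross 0F 1F 2F 3F ∷ []) ∷
    selection (v 1F · v 2F · v 3F · u 0F · u 1F · u 2F · ∅) (edge 3F 1F ∷ edge 3F 2F ∷ [])
      (cross 0F 2F 3F 1F ∷ cross 0F 1F 3F 2F ∷ []) ∷
    selection (v 0F · ∅) (edge 1F 0F ∷ edge 2F 0F ∷ edge 3F 0F ∷ [])
      (cross 1F 0F 2F 3F ∷ cross 1F 0F 3F 2F ∷ cross 2F 0F 1F 3F ∷ cross 2F 0F 3F 1F ∷ cross 3F 0F 1F 2F ∷ cross 3F 0F 2F 1F ∷ []) ∷ []

  pairs : List (Fin 4 × Fin 4)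
  pairs = (0F , 1F) ∷ (0F , 2F) ∷ (0F , 3F) ∷ (1F , 2F) ∷ (1F , 3F) ∷ (2F , 3F) ∷ []

  -- A basis at distance two from `U` has with `U` the midpoint of two neighbours of `U`. There are
  -- two matchings of the exchanged elements, and both are offered because one of them may use a
  -- dependent set `edge k k`.
  rules : List (Rule 8)
  rules = List.concatMap (λ (k , l) → List.concatMap (λ (i , j) →
    rule (edge k i) (edge l j) (u k · u l · v i · v j · U) U ∷
    rule (edge k j) (edge l i) (u k · u l · v i · v j · U) U ∷ []) pairs) pairs

spansFrom : (Subset 8) → (u v : Fin 4 → Fin 8) → List (Subset 8) → List (Subset 8 × Subset 8) → Bool
spansFrom U u v L known = Spanning.spans L known U points selections rules
  where open Star U u v

s q πq : Fin 4 → Fin 8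
s 0F = s₁
s 1F = s₂
s 2F = s₃
s 3F = s₄
q 0F = q₁
q 1F = q₂
q 2F = q₃
q 3F = q₄
πq 0F = q₁
πq 1F = q₃
πq 2F = q₄
πq 3F = q₂

-- The three diagonals of the octahedron at the vertex `S` that arises by fixing `s₂` and `s₃` and
-- varying `s₁`, `s₄`, `q₃`, `q₄`.
root second third : Subset 8 × Subset 8
root = s₁ · s₂ · s₃ · s₄ · ∅ , s₂ · s₃ · q₃ · q₄ · ∅
second = s₁ · s₂ · s₃ · q₃ · ∅ , s₂ · s₃ · s₄ · q₄ · ∅
third = s₁ · s₂ · s₃ · q₄ · ∅ , s₂ · s₃ · s₄ · q₃ · ∅

spansBoth : List (Subset 8) → List (Pair 8) → Bool
spansBoth L known = spansFrom Q q s L known ∧ spansFrom S s πq L known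

-- The centre of the octahedron puts at least one of its diagonals into a cell, without telling
-- which. Nine of the preliminary moves lead from `second` to `root` and the other nine from `third`
-- to `root`, both times through a diagonal ending in `Q` and back to `S`. So `root` holds in every
-- case and can start the remaining moves.
linkable : List (Subset 8) → Bool
linkable L = isOctahedron L root second third ∧ (root ∈ᵖ grow L preliminaryMoves (second ∷ [])) ∧
  (root ∈ᵖ grow L preliminaryMoves (third ∷ [])) ∧ spansBoth L (grow L moves (root ∷ []))

-- The leaves carry the linear pieces of the heights. For `heightN` these are zero and its three
-- terms without truncation; `mixed` recurs because the splitting hyperplanes cut through its cell.
treeM treeN : SplitTree 8
-- The outer node separates `Q` by x(S) = 1, since a single exchange cannot bring `Q` to the wall
-- x(S) = 2.
treeM = node (S ∷ []) 0 (leaf [] 0) (node (S ∷ []) 1 (leaf [] 0) (leaf (S ∷ []) 2))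
treeN = node (s₁ · s₂ · ∅ ∷ []) 0
  (node (q₁ · q₂ · ∅ ∷ []) 0
    -- The last leaf here is 1 - x(q₁ q₂), written through the complement of q₁ q₂ to keep
    -- coefficients natural: the bases have four elements, which turns 1 into the constant -3.
    (node (s₃ · s₄ · ∅ ∷ []) 0 mixed (leaf (s₁ · s₂ · s₃ · s₄ · q₃ · q₄ · ∅ ∷ []) 3))
    (node (s₃ · s₄ · ∅ ∷ []) 0
      (node (q₃ · q₄ · ∅ ∷ []) 0 (leaf [] 0) (node (s₁ · s₂ · q₃ · q₄ · ∅ ∷ []) 1 (leaf [] 0) mixed))
      (leaf [] 0)))
  (node (q₁ · q₂ · ∅ ∷ []) 0 mixed (node (q₃ · q₄ · ∅ ∷ []) 0 (leaf (s₁ · s₂ · ∅ ∷ []) 1) mixed))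
  where
  mixed : SplitTree 8
  mixed = leaf (s₁ · s₂ · q₃ · q₄ · ∅ ∷ []) 2

lowers : Subset 8 → Subset 8 → Subset 8 × Subset 8 → Bool
lowers σ τ (σ′ , τ′) = (heightM σ′ ℕ.+ heightM τ′ ℕ.<ᵇ heightM σ ℕ.+ heightM τ) ∧ basisM σ′ ∧ basisM τ′ ∧ sameSum σ τ σ′ τ′

belowWall aboveWall : Subset 8 → Bool
belowWall σ = basisM σ ∧ (common S σ ℕ.<ᵇ 2)
aboveWall σ = basisM σ ∧ (2 ℕ.<ᵇ common S σ)

lowerable : Subset 8 → Subset 8 → Bool
lowerable σ τ = any (lowers σ τ) (exchanges σ τ)

isComplementary : Subset 8 → Bool
isComplementary σ = common Q σ ℕ.+ common S σ ℕ.≡ᵇ 4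

isMatroid-M : Check (isMatroid 4 basisM)
isMatroid-M = passed tt

isMatroid-N : Check (isMatroid 4 basisN)
isMatroid-N = passed tt

convex-M : Check (exchangeConvex heightM basisM)
convex-M = passed tt

convex-N : Check (exchangeConvex heightN basisN)
convex-N = passed tt

valid-M : Check (validTree heightM basisM treeM basisM)
valid-M = passed tt

valid-N : Check (validTree heightN basisN treeN basisN)
valid-N = passed tt

crossing : Check (crosswise belowWall aboveWall lowerable)
crossing = passed tt

complementary : Check (everywhere basisM isComplementary)
complementary = passed tt

opaque
  M N : Matroid 8
  M = matroid 4 basisM (Q , tt) isMatroid-M
  N = matroid 4 basisN (Q , tt) isMatroid-N

  bases-M : Matroid.bases M ≡ members basisM
  bases-M = ≡.refl

  bases-N : Matroid.bases N ≡ members basisN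
  bases-N = ≡.refl

opaque
  unfolding M grow

  linked : Check (linkable (Matroid.bases M))
  linked = passed tt

sides : (ms : List (Move 8)) → T (all (λ m → (Move.side m == Q) ∨ (Move.side m == S)) ms) →
  All (λ m → Move.side m ≡ Q ⊎ Move.side m ≡ S) ms
sides ms t = All.map (λ {m} t → [ (λ p → inj₁ (==⇒≡ (Move.side m) Q p)) , (λ p → inj₂ (==⇒≡ (Move.side m) S p)) ]′ (T-∨⁻ t))
  (All.all⁺ (λ m → (Move.side m == Q) ∨ (Move.side m == S)) ms t)

moves-sides : All (λ m → Move.side m ≡ Q ⊎ Move.side m ≡ S) moves
moves-sides = sides moves tt

preliminary-sides : All (λ m → Move.side m ≡ Q ⊎ Move.side m ≡ S) preliminaryMoves
preliminary-sides = sides preliminaryMoves tt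

-- Stated for an arbitrary matroid M, so that the argument of linkable does not compute.
module LinkedCells {c ℓ₁ ℓ₂} (K : OrderedField c ℓ₁ ℓ₂) where
  open MatroidPolytopes K
  open PolytopeProperties K
  open Cells K
  open Linking K
  open SpanningCells K

  module _ (M : Matroid 8) (D : Subdivision (matroidPolytope M)) (matroidal : IsMatroidal D) where
    open Matroid M using (bases)
    open MatroidalSubdivision M D matroidal
    open Links M D matroidal

    heavyCells : Uncrossed Q → Uncrossed S → Check (linkable bases) →
      (∃[ C ] Cell D C × (∀ {ρ} → ρ ∈ heavy Q bases → C ∋ ρ)) × (∃[ C ] Cell D C × (∀ {ρ} → ρ ∈ heavy S bases → C ∋ ρ))
    heavyCells uncrossed-Q uncrossed-S (passed t) =
      let (t₁ , r₁) = T-∧⁻ {isOctahedron bases root second third} t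
          (t₂ , r₂) = T-∧⁻ {root ∈ᵖ grow bases preliminaryMoves (second ∷ [])} r₁
          (t₃ , t₄) = T-∧⁻ {root ∈ᵖ grow bases preliminaryMoves (third ∷ [])} r₂
          rooted    = connect (octahedron M D matroidal root second third t₁) t₂ t₃
      in fill (grow bases moves (root ∷ [])) (grow-together moves (root ∷ []) (uncrossed {moves} moves-sides) (rooted ∷ [])) t₄
      where
      fill : ∀ known → AllTogether known → T (spansBoth bases known) →
        (∃[ C ] Cell D C × (∀ {ρ} → ρ ∈ heavy Q bases → C ∋ ρ)) × (∃[ C ] Cell D C × (∀ {ρ} → ρ ∈ heavy S bases → C ∋ ρ))
      fill known together t =
        let (t₅ , t₆) = T-∧⁻ {spansFrom Q q s bases known} t
        in spans-sound M D matroidal known together Q uncrossed-Q (Star.points Q q s) (Star.selections Q q s) (Star.rules Q q s) t₅ ,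
           spans-sound M D matroidal known together S uncrossed-S (Star.points S s πq) (Star.selections S s πq) (Star.rules S s πq) t₆
      uncrossed : ∀ {ms} → All (λ m → Move.side m ≡ Q ⊎ Move.side m ≡ S) ms → ∀ {m} → m ∈ ms → Uncrossed (Move.side m)
      uncrossed sides m∈ = [ (λ eq → ≡.subst Uncrossed (≡.sym eq) uncrossed-Q)
                           , (λ eq → ≡.subst Uncrossed (≡.sym eq) uncrossed-S) ]′ (All.lookup sides m∈)
      link : ∀ p → Together (proj₁ p) (proj₂ p) → T (root ∈ᵖ grow bases preliminaryMoves (p ∷ [])) → Together (proj₁ root) (proj₂ root)
      link p tog t = ∈ᵖ⁻ {R = Together} Together-sym (grow-together preliminaryMoves (p ∷ []) (uncrossed {preliminaryMoves} preliminary-sides) (tog ∷ [])) t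
      connect : Together (proj₁ root) (proj₂ root) ⊎ Together (proj₁ second) (proj₂ second) ⊎ Together (proj₁ third) (proj₂ third) →
        T (root ∈ᵖ grow bases preliminaryMoves (second ∷ [])) → T (root ∈ᵖ grow bases preliminaryMoves (third ∷ [])) →
        Together (proj₁ root) (proj₂ root)
      connect (inj₁ tog)        _  _  = tog
      connect (inj₂ (inj₁ tog)) t₂ _  = link second tog t₂
      connect (inj₂ (inj₂ tog)) _  t₃ = link third tog t₃

-- Subdivisions with a cell in common

module Faces {c ℓ₁ ℓ₂} (K : OrderedField c ℓ₁ ℓ₂) where
  open MatroidPolytopes K

  IsFaceOf-resp-≐ : ∀ {Q Q′ P P′ : PointSet n} → Q ≐ Q′ → P ≐ P′ → IsFaceOf Q P → IsFaceOf Q′ P′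
  IsFaceOf-resp-≐ (Q⊆Q′ , Q′⊆Q) (P⊆P′ , P′⊆P) (a , b , valid , Q⊆ , ⊆Q) =
    a , b , valid ∘ P′⊆P , (λ x∈ → let (x∈P , eq) = Q⊆ (Q′⊆Q x∈) in P⊆P′ x∈P , eq) ,
    λ (x∈P′ , eq) → Q⊆Q′ (⊆Q (P′⊆P x∈P′ , eq))

  -- A cell inside `B` equals its intersection with `B` and is therefore a face of `B`. It is then a
  -- face of `B′`, and the faces of `B′` are cells of `D′`.
  shared-cell : ∀ {P : Polytope n} (D D′ : Subdivision P) {C B B′} → Cell D C → Cell D B → Cell D′ B′ →
    ⟦ B ⟧ ≐ ⟦ B′ ⟧ → ⟦ C ⟧ ⊆ ⟦ B ⟧ → ∃[ F ] Cell D′ F × ⟦ C ⟧ ≐ ⟦ F ⟧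
  shared-cell D D′ {C} {B} {B′} cellC cellB cellB′ B≐B′ C⊆B =
    let (F , cellF , F⊆C , C⊆F) = Subdivision.faces D′ cellB′ {⟦ C ⟧} (IsFaceOf-resp-≐
          {Q = ⟦ C ⟧ ∩ ⟦ B ⟧} {⟦ C ⟧} {⟦ B ⟧} {⟦ B′ ⟧} (proj₁ , λ x∈ → x∈ , C⊆B x∈) B≐B′ (proj₂ (Subdivision.intersection D cellC cellB)))
    in F , cellF , C⊆F , F⊆C

-- The glued subdivision: finest, with a maximal cell that is not rigid

module _ {c ℓ₁ ℓ₂} (K : OrderedField c ℓ₁ ℓ₂) where
  open OrderedFieldProperties K
  open MatroidPolytopes K
  open PolytopeProperties K
  open RegularSubdivisions K
  open MatroidSubdivisions K
  open Heights K
  open Cells K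
  open Linking K
  open SpanningCells K
  open Faces K
  open LinkedCells K

  subdivisionM : Subdivision (matroidPolytope M)
  subdivisionM = regular M heightM (attained M heightM basisM bases-M treeM valid-M)

  subdivisionM-matroidal : IsMatroidal subdivisionM
  subdivisionM-matroidal = regular-matroidal M heightM (attained M heightM basisM bases-M treeM valid-M)
    (exchangeConvex-sound M heightM basisM bases-M convex-M)

  subdivisionN : Subdivision (matroidPolytope N)
  subdivisionN = regular N heightN (attained N heightN basisN bases-N treeN valid-N)

  subdivisionN-matroidal : IsMatroidal subdivisionN
  subdivisionN-matroidal = regular-matroidal N heightN (attained N heightN basisN bases-N treeN valid-N)
    (exchangeConvex-sound N heightN basisN bases-N convex-N)

  subdivisionN-nontrivial : ¬ IsTrivial subdivisionN
  subdivisionN-nontrivial ((C , (lift (a , b , below , ≡.refl) , _) , (_ , P⊆C)) , _) =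
    -- On this octahedron the heights of the first two bases are 1 and 0 and those of the exchanged
    -- bases are both 0, so a cell equal to P_N would give 1 ≤ 0.
    ℕ.1+n≰n (tight-sum-≤ N heightN {a} {b} below {s₁ · s₂ · q₁ · q₂ · ∅} {s₃ · s₄ · q₁ · q₂ · ∅} {s₁ · s₃ · q₁ · q₂ · ∅} {s₂ · s₄ · q₁ · q₂ · ∅}
      (∈N {s₁ · s₃ · q₁ · q₂ · ∅} tt) (∈N {s₂ · s₄ · q₁ · q₂ · ∅} tt) (exchanged tt)
      (tightAt {s₁ · s₂ · q₁ · q₂ · ∅} tt) (tightAt {s₃ · s₄ · q₁ · q₂ · ∅} tt))
    where
    ∈N : ∀ {σ} → T (basisN σ) → σ ∈ Matroid.bases N
    ∈N = basis⇒∈ N heightN basisN bases-N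
    tightAt : ∀ {σ} → T (basisN σ) → Tight N heightN a b σ
    tightAt {σ} t = proj₂ (Hull-vertex {V = λ σ → σ ∈ Matroid.bases N × Tight N heightN a b σ} {σ = σ}
      (⟦tight⟧⇒Hull N heightN {a = a} {b} (P⊆C (indicator-∈ {σ = σ} {L = Matroid.bases N} (∈N t)))))

  N-flexible : ¬ IsRigid N
  N-flexible rigid = rigid (subdivisionN , subdivisionN-matroidal , subdivisionN-nontrivial)

  open Matroid M using (bases)

  ∈M⇒basis : ∀ {σ} → σ ∈ bases → T (basisM σ)
  ∈M⇒basis = ∈⇒basis M heightM basisM bases-M

  basis⇒∈M : ∀ {σ} → T (basisM σ) → σ ∈ bases
  basis⇒∈M = basis⇒∈ M heightM basisM bases-M

  -- An exchange between bases strictly on opposite sides of the wall lowers the total height, which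
  -- is impossible for a tight pair.
  tight-uncrossed : ∀ {a b σ τ} → Below M heightM a b → σ ∈ bases → τ ∈ bases → Tight M heightM a b σ → Tight M heightM a b τ →
    common S σ ℕ.< 2 → ¬ 2 ℕ.< common S τ
  tight-uncrossed {a} {b} {σ} {τ} below σ∈ τ∈ tσ tτ σ<2 2<τ =
    let ((σ′ , τ′) , _ , t₀) = any-∃ (lowers σ τ) (exchanges σ τ)
          (crosswise⁻ belowWall aboveWall lowerable {σ} {τ} crossing
            (T-∧⁺ {basisM σ} (∈M⇒basis σ∈) (ℕ.<⇒<ᵇ σ<2)) (T-∧⁺ {basisM τ} (∈M⇒basis τ∈) (ℕ.<⇒<ᵇ 2<τ)))
        (p₁ , t₁) = T-∧⁻ {heightM σ′ ℕ.+ heightM τ′ ℕ.<ᵇ heightM σ ℕ.+ heightM τ} t₀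
        (p₂ , t₂) = T-∧⁻ {basisM σ′} t₁
        (p₃ , p₄) = T-∧⁻ {basisM τ′} t₂
    in ℕ.<⇒≱ (ℕ.<ᵇ⇒< (heightM σ′ ℕ.+ heightM τ′) (heightM σ ℕ.+ heightM τ) p₁)
         (tight-sum-≤ M heightM {a} {b} below {σ} {τ} {σ′} {τ′} (basis⇒∈M {σ′} p₂) (basis⇒∈M {τ′} p₃) (exchanged p₄) tσ tτ)

  common-Q+S : ∀ {σ} → σ ∈ bases → common Q σ ℕ.+ common S σ ≡ 4
  common-Q+S {σ} σ∈ = ℕ.≡ᵇ⇒≡ (common Q σ ℕ.+ common S σ) 4 (everywhere⁻ basisM isComplementary {σ} complementary (∈M⇒basis σ∈))

  2<Q⇒S<2 : ∀ {σ} → σ ∈ bases → 2 ℕ.< common Q σ → common S σ ℕ.< 2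
  2<Q⇒S<2 {σ} σ∈ lt = ℕ.+-cancelˡ-< 2 (common S σ) 2 (≡.subst (2 ℕ.+ common S σ ℕ.<_) (common-Q+S σ∈) (ℕ.+-monoˡ-< (common S σ) lt))

  Q<2⇒2<S : ∀ {σ} → σ ∈ bases → common Q σ ℕ.< 2 → 2 ℕ.< common S σ
  Q<2⇒2<S {σ} σ∈ lt = ℕ.+-cancelˡ-< 2 2 (common S σ) (≡.subst (ℕ._< 2 ℕ.+ common S σ) (common-Q+S σ∈) (ℕ.+-monoˡ-< (common S σ) lt))

  S<2⇒2<Q : ∀ {σ} → σ ∈ bases → common S σ ℕ.< 2 → 2 ℕ.< common Q σ
  S<2⇒2<Q {σ} σ∈ lt = ℕ.+-cancelʳ-< 2 2 (common Q σ) (≡.subst (ℕ._< common Q σ ℕ.+ 2) (common-Q+S σ∈) (ℕ.+-monoʳ-< (common Q σ) lt))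

  module Refinement (D : Subdivision (matroidPolytope M)) (matroidal : IsMatroidal D) (refines : Refines D subdivisionM) where
    open MatroidalSubdivision M D matroidal
    open Links M D matroidal

    uncrossed-< : ∀ {C σ τ} → Cell D C → C ∋ σ → C ∋ τ → common S σ ℕ.< 2 → ¬ 2 ℕ.< common S τ
    uncrossed-< {C} {σ} {τ} cell C∋σ C∋τ = within (refines cell)
      where
      within : (∃[ B ] RegularCell M heightM B × ⟦ C ⟧ ⊆ ⟦ B ⟧) → common S σ ℕ.< 2 → ¬ 2 ℕ.< common S τ
      within (_ , lift (a , b , below , ≡.refl) , C⊆B) =
        tight-uncrossed {a} {b} below (cell-basis cell C∋σ) (cell-basis cell C∋τ) (tightAt C∋σ) (tightAt C∋τ)
        where
        tightAt : ∀ {σ} → C ∋ σ → Tight M heightM a b σ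
        tightAt {σ} C∋σ = proj₂ (Hull-vertex {V = λ σ → σ ∈ bases × Tight M heightM a b σ} {σ = σ}
          (⟦tight⟧⇒Hull M heightM {a = a} {b} (C⊆B (∋⇒⟦⟧ {C = C} {σ = σ} C∋σ))))

    uncrossed-Q : Uncrossed Q
    uncrossed-Q {C} {σ} {τ} cell C∋σ C∋τ 2<Qσ = ℕ.≮⇒≥ λ Qτ<2 →
      uncrossed-< cell C∋σ C∋τ (2<Q⇒S<2 (cell-basis cell C∋σ) 2<Qσ) (Q<2⇒2<S (cell-basis cell C∋τ) Qτ<2)

    uncrossed-S : Uncrossed S
    uncrossed-S cell C∋σ C∋τ 2<Sσ = ℕ.≮⇒≥ λ Sτ<2 → uncrossed-< cell C∋τ C∋σ Sτ<2 2<Sσ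

    heavy⁺ : ∀ {C U σ} → Cell D C → C ∋ σ → 2 ℕ.≤ common U σ → σ ∈ heavy U bases
    heavy⁺ {U = U} cell C∋σ le = ∈-filterᵇ⁺ (λ ρ → 2 ℕ.≤ᵇ common U ρ) (cell-basis cell C∋σ) (ℕ.≤⇒≤ᵇ le)

    -- A vertex below x(S) = 2 lies strictly on the side of `Q` and keeps the whole cell there; if
    -- none exists, the cell is on the side of `S` by definition.
    one-sided : ∀ {C} → Cell D C → (∀ {σ} → C ∋ σ → σ ∈ heavy Q bases) ⊎ (∀ {σ} → C ∋ σ → σ ∈ heavy S bases)
    one-sided {C} cell = decide (Any.any? (λ σ → (C ∋? σ) ×-dec (common S σ ℕ.<? 2)) bases)
      where
      decide : Dec (Any (λ σ → C ∋ σ × common S σ ℕ.< 2) bases) →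
        (∀ {σ} → C ∋ σ → σ ∈ heavy Q bases) ⊎ (∀ {σ} → C ∋ σ → σ ∈ heavy S bases)
      decide (yes p) = inj₁ λ C∋τ → let (σ , σ∈ , C∋σ , lt) = find p
                                    in heavy⁺ {U = Q} cell C∋τ (uncrossed-Q cell C∋σ C∋τ (S<2⇒2<Q σ∈ lt))
      decide (no ¬p) = inj₂ λ C∋τ → heavy⁺ {U = S} cell C∋τ (ℕ.≮⇒≥ λ lt → ¬p (lose (cell-basis cell C∋τ) (C∋τ , lt)))

  affine-below : ∀ F c → (∀ {σ} → σ ∈ bases → weight F σ ℕ.≤ heightM σ ℕ.+ c) → Below M heightM (functional F) (ι c)
  affine-below F c le {σ} σ∈ = ≤-respˡ-≈ (sym (dot-functional F σ)) (≤-respʳ-≈ (ι-+ (heightM σ) c) (ι-mono-≤ (le σ∈)))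

  affine-tight⁺ : ∀ F c {σ} → weight F σ ≡ heightM σ ℕ.+ c → Tight M heightM (functional F) (ι c) σ
  affine-tight⁺ F c {σ} eq = trans (dot-functional F σ) (trans (reflexive (≡.cong ι eq)) (ι-+ (heightM σ) c))

  affine-tight⁻ : ∀ F c {σ} → Tight M heightM (functional F) (ι c) σ → weight F σ ≡ heightM σ ℕ.+ c
  affine-tight⁻ F c {σ} t = ι-injective (trans (sym (dot-functional F σ)) (trans t (sym (ι-+ (heightM σ) c))))

  2<S⇒Q<2 : ∀ {σ} → σ ∈ bases → 2 ℕ.< common S σ → common Q σ ℕ.< 2
  2<S⇒Q<2 {σ} σ∈ lt = ℕ.+-cancelʳ-< 2 (common Q σ) 2 (≡.subst (common Q σ ℕ.+ 2 ℕ.<_) (common-Q+S σ∈) (ℕ.+-monoʳ-< (common Q σ) lt))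

  below-Q : Below M heightM (functional []) (ι 0)
  below-Q = affine-below [] 0 λ _ → ℕ.z≤n

  below-S : Below M heightM (functional (S ∷ [])) (ι 2)
  below-S = affine-below (S ∷ []) 2 λ {σ} _ → ≡.subst (ℕ._≤ heightM σ ℕ.+ 2) (≡.sym (ℕ.+-identityʳ (common S σ)))
    (≡.subst (common S σ ℕ.≤_) (ℕ.+-comm 2 (heightM σ)) (ℕ.m≤n+m∸n (common S σ) 2))

  cell-Q cell-S : Polytope 8
  cell-Q = tightPolytope M heightM (functional []) (ι 0)
  cell-S = tightPolytope M heightM (functional (S ∷ [])) (ι 2)

  isCell-Q : Cell subdivisionM cell-Q
  isCell-Q = lift (functional [] , ι 0 , below-Q , ≡.refl)

  isCell-S : Cell subdivisionM cell-S
  isCell-S = lift (functional (S ∷ []) , ι 2 , below-S , ≡.refl)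

  tight-Q⁺ : ∀ {σ} → common S σ ℕ.≤ 2 → Tight M heightM (functional []) (ι 0) σ
  tight-Q⁺ {σ} le = affine-tight⁺ [] 0 {σ} (≡.sym (≡.trans (ℕ.+-identityʳ (heightM σ)) (ℕ.m≤n⇒m∸n≡0 le)))

  tight-Q⁻ : ∀ {σ} → Tight M heightM (functional []) (ι 0) σ → common S σ ℕ.≤ 2
  tight-Q⁻ {σ} t = ℕ.m∸n≡0⇒m≤n (≡.trans (≡.sym (ℕ.+-identityʳ (heightM σ))) (≡.sym (affine-tight⁻ [] 0 {σ} t)))

  tight-S⁺ : ∀ {σ} → 2 ℕ.≤ common S σ → Tight M heightM (functional (S ∷ [])) (ι 2) σ
  tight-S⁺ {σ} le = affine-tight⁺ (S ∷ []) 2 {σ} (≡.trans (ℕ.+-identityʳ (common S σ)) (≡.sym (ℕ.m∸n+n≡m le)))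

  tight-S⁻ : ∀ {σ} → Tight M heightM (functional (S ∷ [])) (ι 2) σ → 2 ℕ.≤ common S σ
  tight-S⁻ {σ} t = ≡.subst (2 ℕ.≤_) (≡.trans (≡.sym (affine-tight⁻ (S ∷ []) 2 {σ} t)) (ℕ.+-identityʳ (common S σ))) (ℕ.m≤n+m 2 (heightM σ))

  -- This does not depend on the order or repetition of the listed vertices, so cells of two
  -- different subdivisions can be compared through it.
  Represents : Polytope 8 → Subset 8 → Set _
  Represents C U = (∀ {ρ} → ρ ∈ heavy U bases → C ∋ ρ) × (∀ {x} → ⟦ C ⟧ x → Hull (_∈ heavy U bases) x)

  represents-≐ : ∀ {C C′ U} → Represents C U → Represents C′ U → ⟦ C ⟧ ≐ ⟦ C′ ⟧
  represents-≐ {C} {C′} (⊇C , C⊆) (⊇C′ , C′⊆) = (λ x∈ → Hull⇒⟦⟧ {C = C′} ⊇C′ (C⊆ x∈)) , λ x∈ → Hull⇒⟦⟧ {C = C} ⊇C (C′⊆ x∈)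

  ∈-heavy⁺ : ∀ U {σ} → σ ∈ bases → 2 ℕ.≤ common U σ → σ ∈ heavy U bases
  ∈-heavy⁺ U σ∈ le = ∈-filterᵇ⁺ (λ ρ → 2 ℕ.≤ᵇ common U ρ) σ∈ (ℕ.≤⇒≤ᵇ le)

  ∈-heavy⁻ : ∀ U {σ} → σ ∈ heavy U bases → σ ∈ bases × 2 ℕ.≤ common U σ
  ∈-heavy⁻ U {σ} σ∈ = let (p , t) = ∈-filterᵇ⁻ (λ ρ → 2 ℕ.≤ᵇ common U ρ) {L = bases} σ∈ in p , ℕ.≤ᵇ⇒≤ 2 (common U σ) t

  represents-Q : Represents cell-Q Q
  represents-Q =
    (λ {ρ} ρ∈ → let (ρ∈B , le) = ∈-heavy⁻ Q ρ∈
                in ∋-map⁺ (∈-tight⁺ M heightM {a = functional []} {ι 0} ρ∈B (tight-Q⁺ {ρ} (ℕ.≮⇒≥ λ lt → ℕ.<⇒≱ (2<S⇒Q<2 ρ∈B lt) le)))) ,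
    λ x∈ → Hull-map (λ {ρ} (ρ∈ , t) → ∈-heavy⁺ Q ρ∈ (ℕ.≮⇒≥ λ lt → ℕ.<⇒≱ (Q<2⇒2<S ρ∈ lt) (tight-Q⁻ {ρ} t)))
             (⟦tight⟧⇒Hull M heightM {a = functional []} {ι 0} x∈)

  represents-S : Represents cell-S S
  represents-S =
    (λ {ρ} ρ∈ → let (ρ∈B , le) = ∈-heavy⁻ S ρ∈
                in ∋-map⁺ (∈-tight⁺ M heightM {a = functional (S ∷ [])} {ι 2} ρ∈B (tight-S⁺ {ρ} le))) ,
    λ x∈ → Hull-map (λ {ρ} (ρ∈ , t) → ∈-heavy⁺ S ρ∈ (tight-S⁻ {ρ} t))
             (⟦tight⟧⇒Hull M heightM {a = functional (S ∷ [])} {ι 2} x∈)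

  -- Once both subdivisions contain the two halves of P_M as cells, every cell inside a half is a
  -- face of it, and the faces of the halves are common to both.
  transfer : (D₁ D₂ : Subdivision (matroidPolytope M)) → ∀ {A₁ A₂ B₁ B₂} →
    Cell D₁ A₁ → Represents A₁ Q → Cell D₂ A₂ → Represents A₂ Q →
    Cell D₁ B₁ → Represents B₁ S → Cell D₂ B₂ → Represents B₂ S →
    ∀ {C} → Cell D₁ C → (∀ {x} → ⟦ C ⟧ x → Hull (_∈ heavy Q bases) x) ⊎ (∀ {x} → ⟦ C ⟧ x → Hull (_∈ heavy S bases) x) →
    ∃[ F ] Cell D₂ F × ⟦ C ⟧ ≐ ⟦ F ⟧
  transfer D₁ D₂ {A₁} {A₂} {B₁} {B₂} a₁ r₁ a₂ r₂ b₁ t₁ b₂ t₂ {C} cell (inj₁ C⊆) =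
    shared-cell D₁ D₂ {C} {A₁} {A₂} cell a₁ a₂ (represents-≐ {A₁} {A₂} {Q} r₁ r₂) (λ x∈ → Hull⇒⟦⟧ {C = A₁} (proj₁ r₁) (C⊆ x∈))
  transfer D₁ D₂ {A₁} {A₂} {B₁} {B₂} a₁ r₁ a₂ r₂ b₁ t₁ b₂ t₂ {C} cell (inj₂ C⊆) =
    shared-cell D₁ D₂ {C} {B₁} {B₂} cell b₁ b₂ (represents-≐ {B₁} {B₂} {S} t₁ t₂) (λ x∈ → Hull⇒⟦⟧ {C = B₁} (proj₁ t₁) (C⊆ x∈))

  module Comparison (D : Subdivision (matroidPolytope M)) (matroidal : IsMatroidal D) (refines : Refines D subdivisionM) where
    open MatroidalSubdivision M D matroidal
    open Refinement D matroidal refines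

    inHeavy : ∀ {C U} → Cell D C → (∀ {σ} → C ∋ σ → σ ∈ heavy U bases) → ∀ {x} → ⟦ C ⟧ x → Hull (_∈ heavy U bases) x
    inHeavy {C} cell C⊆ x∈ = Hull-map C⊆ (cell-Hull cell x∈)

    heavyRepresents : ∀ {U} → 3 ℕ.≤ common U U → U ∈ heavy U bases → (∀ {C σ τ} → Cell D C → C ∋ σ → C ∋ τ → 2 ℕ.< common U σ → 2 ℕ.≤ common U τ) →
      (∃[ C ] Cell D C × (∀ {ρ} → ρ ∈ heavy U bases → C ∋ ρ)) → ∃[ C ] Cell D C × Represents C U
    heavyRepresents {U} 3≤ U∈ uncrossed (C , cell , all) =
      C , cell , all , inHeavy {C} {U} cell (λ C∋ρ → ∈-heavy⁺ U (cell-basis cell C∋ρ) (uncrossed cell (all U∈) C∋ρ 3≤))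

  one-sided-≐ : (D : Subdivision (matroidPolytope M)) (matroidal : IsMatroidal D) (refines : Refines D subdivisionM) →
    ∀ {C} → Cell D C → (∀ {x} → ⟦ C ⟧ x → Hull (_∈ heavy Q bases) x) ⊎ (∀ {x} → ⟦ C ⟧ x → Hull (_∈ heavy S bases) x)
  one-sided-≐ D matroidal refines {C} cell = convert (one-sided cell)
    where
    open Refinement D matroidal refines
    open Comparison D matroidal refines
    convert : (∀ {σ} → C ∋ σ → σ ∈ heavy Q bases) ⊎ (∀ {σ} → C ∋ σ → σ ∈ heavy S bases) →
      (∀ {x} → ⟦ C ⟧ x → Hull (_∈ heavy Q bases) x) ⊎ (∀ {x} → ⟦ C ⟧ x → Hull (_∈ heavy S bases) x)
    convert (inj₁ f) = inj₁ (inHeavy {C} {Q} cell f)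
    convert (inj₂ f) = inj₂ (inHeavy {C} {S} cell f)

  Q-heavy : Q ∈ heavy Q bases
  Q-heavy = ∈-heavy⁺ Q (basis⇒∈M {Q} tt) (ℕ.s≤s (ℕ.s≤s ℕ.z≤n))

  S-heavy : S ∈ heavy S bases
  S-heavy = ∈-heavy⁺ S (basis⇒∈M {S} tt) (ℕ.s≤s (ℕ.s≤s ℕ.z≤n))

  finest : IsFinest M subdivisionM
  finest (D , matroidal , refines , different) = different (same
    (heavyRepresents {Q} (ℕ.s≤s (ℕ.s≤s (ℕ.s≤s ℕ.z≤n))) Q-heavy uncrossed-Q (proj₁ cells))
    (heavyRepresents {S} (ℕ.s≤s (ℕ.s≤s (ℕ.s≤s ℕ.z≤n))) S-heavy uncrossed-S (proj₂ cells)))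
    where
    open Refinement D matroidal refines
    open Comparison D matroidal refines
    cells = heavyCells M D matroidal uncrossed-Q uncrossed-S linked
    same : (∃[ C ] Cell D C × Represents C Q) → (∃[ C ] Cell D C × Represents C S) → Same D subdivisionM
    same (A , a , rA) (B , b , rB) =
      (λ {C} cell → transfer D subdivisionM {A} {cell-Q} {B} {cell-S} a rA isCell-Q represents-Q b rB isCell-S represents-S {C} cell
        (one-sided-≐ D matroidal refines {C} cell)) ,
      λ {C} cell → transfer subdivisionM D {cell-Q} {A} {cell-S} {B} isCell-Q represents-Q a rA isCell-S represents-S b rB {C} cell
        -- The glued subdivision refines itself, so the same dichotomy holds for its own cells.
        (one-sided-≐ subdivisionM subdivisionM-matroidal (λ {C} cell → C , cell , λ x∈ → x∈) {C} cell)

  -- A larger cell would still contain the basis `Q`, which lies strictly on one side of the wall,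
  -- so none of its vertices could lie strictly beyond.
  maximal-Q : IsMaximal subdivisionM cell-Q
  maximal-Q = isCell-Q , λ { (lift (a , b , below , ≡.refl)) Q⊆C x∈ →
    Hull⇒⟦tight⟧ M heightM {a = functional []} {ι 0} (Hull-map
      (λ {σ} (σ∈ , t) → σ∈ , tight-Q⁺ {σ} (ℕ.≮⇒≥ λ lt → tight-uncrossed {a} {b} {Q} {σ} below (basis⇒∈M {Q} tt) σ∈ (Q-tight a b Q⊆C) t (ℕ.s≤s ℕ.z≤n) lt))
      (⟦tight⟧⇒Hull M heightM {a = a} {b} x∈)) }
    where
    Q-tight : ∀ a b → ⟦ cell-Q ⟧ ⊆ ⟦ tightPolytope M heightM a b ⟧ → Tight M heightM a b Q
    Q-tight a b Q⊆C = proj₂ (Hull-vertex {V = λ σ → σ ∈ bases × Tight M heightM a b σ} {σ = Q}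
      (⟦tight⟧⇒Hull M heightM {a = a} {b} (Q⊆C (∋⇒⟦⟧ {C = cell-Q} {σ = Q} (proj₁ represents-Q Q-heavy)))))

  cell-Q≐N : ⟦ cell-Q ⟧ ≐ ⟦ matroidPolytope N ⟧
  cell-Q≐N =
    (λ x∈ → Hull⇒⟦⟧-map (Hull-map (λ {σ} (σ∈ , t) → basis⇒∈ N heightN basisN bases-N {σ} (T-∧⁺ {basisM σ} (∈M⇒basis σ∈) (ℕ.≤⇒≤ᵇ (tight-Q⁻ {σ} t))))
              (⟦tight⟧⇒Hull M heightM {a = functional []} {ι 0} x∈))) ,
    λ x∈ → Hull⇒⟦tight⟧ M heightM {a = functional []} {ι 0} (Hull-map
             (λ {σ} σ∈ → let (p , le) = T-∧⁻ {basisM σ} (∈⇒basis N heightN basisN bases-N {σ} σ∈)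
                         in basis⇒∈M {σ} p , tight-Q⁺ {σ} (ℕ.≤ᵇ⇒≤ (common S σ) 2 le))
             (⟦⟧⇒Hull-map (Matroid.bases N) x∈))

theorem5p1 : ∀ {c ℓ₁ ℓ₂} (K : OrderedField c ℓ₁ ℓ₂) →
    let open MatroidPolytopes K in
    Σ ℕ λ n → Σ (Matroid n) λ M → Σ (Subdivision (matroidPolytope M)) λ D →
    IsMatroidal D ×
    IsFinest M D ×
    (∃[ C ] IsMaximal D C ×
    Σ (Matroid n) λ N → ⟦ C ⟧ ≐ ⟦ matroidPolytope N ⟧ × ¬ IsRigid N)
theorem5p1 K = 8 , M , subdivisionM K , subdivisionM-matroidal K , finest K , cell-Q K , maximal-Q K , N , cell-Q≐N K , N-flexible K
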